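{- Let $P$ be a lattice $3$-polytope of width larger than one and of sublattice index two. Then $P$ is unimodularly equivalent to one of $E_{(7,2)}$, $E^1_{(8,2)}$, $E^2_{(8,2)}$, $E^3_{(8,2)}$, or to one of $\widetilde F_2(a,b)$ with $(a,b)\ne(0,1)$, $\widetilde F_3(a,b,k)$ with $k\in\{0,\dots,b\}$ and $(a,b,k)\ne(0,1,1)$, or $\widetilde F_4(a,b)$, where $a,b\in\mathbb{Z}$, $a\le 0<b$.
   Context: A lattice $3$-polytope is a polytope in $\mathbb{R}^3$ with vertices in $\mathbb{Z}^3$ and dimension $3$; width is the minimum of $\max f(P)-\min f(P)$ over non-constant affine functionals $f$ with $f(\mathbb{Z}^3)\subseteq\mathbb{Z}$. Sublattice index: index in $\mathbb{Z}^3$ of the affine lattice generated (integer affine combinations) by $P\cap\mathbb{Z}^3$. Unimodular equivalence: affine $f$ with $f(\mathbb{Z}^3)=\mathbb{Z}^3$. $S_{a,b}=\conv\{(0,0,a),(0,0,b)\}$; $\widetilde F_2(a,b)=\conv(S_{a,b}\cup\{(-1,-1,1),(1,-1,0),(-1,1,0)\})$; $\widetilde F_3(a,b,k)=\conv(S_{a,b}\cup\{(-1,-1,1),(1,-1,0),(-1,1,0),(1,1,2k-1)\})$; $\widetilde F_4(a,b)=\conv(S_{a,b}\cup\{(-1,-1,1),(1,-1,0),(-1,1,0),(3,-1,-1)\})$. With $B=\conv\{(-1,-1,0),(2,0,0),(1,2,0)\}$: $E_{(7,2)}=\conv(B\cup\{(0,-1,2)\})$, $E^1_{(8,2)}=\conv(B\cup\{(0,-1,2),(0,1,-2)\})$,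 $E^2_{(8,2)}=\conv(B\cup\{(0,-1,2),(-2,-1,-2)\})$; and $E^3_{(8,2)}=\conv\{(0,-1,-1),(2,0,2),(1,2,-1),(-1,1,2)\}$. -}

module Defs where

open import Data.Integer as ℤ using (ℤ; +_; -[1+_])
open import Data.Rational as ℚ using (ℚ; 0ℚ; 1ℚ)
open import Data.List using (List; []; _∷_)
open import Data.List.Membership.Propositional using (_∈_)
open import Data.List.Relation.Unary.All using (All)
open import Data.Product using (Σ; _×_; _,_; ∃; ∃-syntax)
open import Data.Sum using (_⊎_)
open import Relation.Binary.PropositionalEquality using (_≡_)
open import Relation.Nullary using (¬_)
open import Function.Bundles using (_⇔_)

-- Points of ℤ³ and ℚ³ (ℚ³ stands in for ℝ³: all vertices are integral,
-- so every relevant point / functional value is rational).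
record V3 (A : Set) : Set where
  constructor ⟨_,_,_⟩
  field x y z : A
open V3 public

Pt : Set
Pt = V3 ℤ

QPt : Set
QPt = V3 ℚ

ι : ℤ → ℚ
ι n = n ℚ./ 1

toQ : Pt → QPt
toQ ⟨ a , b , c ⟩ = ⟨ ι a , ι b , ι c ⟩

_⊕_ : Pt → Pt → Pt
⟨ a , b , c ⟩ ⊕ ⟨ d , e , f ⟩ = ⟨ a ℤ.+ d , b ℤ.+ e , c ℤ.+ f ⟩

_⊙_ : ℤ → Pt → Pt
l ⊙ ⟨ a , b , c ⟩ = ⟨ l ℤ.* a , l ℤ.* b , l ℤ.* c ⟩

_⊖_ : Pt → Pt → Pt
p ⊖ q = p ⊕ ((ℤ.- (+ 1)) ⊙ q)

𝟎 : Pt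
𝟎 = ⟨ + 0 , + 0 , + 0 ⟩

_⊕ᵩ_ : QPt → QPt → QPt
⟨ a , b , c ⟩ ⊕ᵩ ⟨ d , e , f ⟩ = ⟨ a ℚ.+ d , b ℚ.+ e , c ℚ.+ f ⟩

_⊙ᵩ_ : ℚ → QPt → QPt
l ⊙ᵩ ⟨ a , b , c ⟩ = ⟨ l ℚ.* a , l ℚ.* b , l ℚ.* c ⟩

_⊖ᵩ_ : QPt → QPt → QPt
p ⊖ᵩ q = p ⊕ᵩ ((ℚ.- 1ℚ) ⊙ᵩ q)

𝟎ᵩ : QPt
𝟎ᵩ = ⟨ 0ℚ , 0ℚ , 0ℚ ⟩

dotᵩ : QPt → QPt → ℚ
dotᵩ ⟨ a , b , c ⟩ ⟨ d , e , f ⟩ = a ℚ.* d ℚ.+ b ℚ.* e ℚ.+ c ℚ.* f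

det3ᵩ : QPt → QPt → QPt → ℚ
det3ᵩ ⟨ a , b , c ⟩ ⟨ d , e , f ⟩ ⟨ g , h , i ⟩ =
  a ℚ.* (e ℚ.* i ℚ.- f ℚ.* h) ℚ.- b ℚ.* (d ℚ.* i ℚ.- f ℚ.* g) ℚ.+ c ℚ.* (d ℚ.* h ℚ.- e ℚ.* g)

-- Convex hulls.  A lattice polytope is given as conv S for a finite
-- list S of integer points; P is a predicate on ℚ³.

weightSum : List (ℚ × Pt) → ℚ
weightSum [] = 0ℚ
weightSum ((w , _) ∷ ws) = w ℚ.+ weightSum ws

weightedSum : List (ℚ × Pt) → QPt
weightedSum [] = 𝟎ᵩ
weightedSum ((w , p) ∷ ws) = (w ⊙ᵩ toQ p) ⊕ᵩ weightedSum ws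

Conv : List Pt → QPt → Set
Conv S q = ∃[ ws ] (All (λ wp → (0ℚ ℚ.≤ Data.Product.proj₁ wp) × (Data.Product.proj₂ wp ∈ S)) ws
                    × weightSum ws ≡ 1ℚ × weightedSum ws ≡ q)

Dim3 : List Pt → Set
Dim3 S = ∃[ p₀ ] ∃[ p₁ ] ∃[ p₂ ] ∃[ p₃ ]
  (Conv S p₀ × Conv S p₁ × Conv S p₂ × Conv S p₃ ×
   ¬ (det3ᵩ (p₁ ⊖ᵩ p₀) (p₂ ⊖ᵩ p₀) (p₃ ⊖ᵩ p₀) ≡ 0ℚ))

WidthGt1 : List Pt → Set
WidthGt1 S = ∀ (c : Pt) (d : ℤ) → ¬ (c ≡ 𝟎) →
  ∃[ p ] ∃[ q ] (Conv S p × Conv S q ×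
    (1ℚ ℚ.< (dotᵩ (toQ c) p ℚ.+ ι d) ℚ.- (dotᵩ (toQ c) q ℚ.+ ι d)))

intSum : List (ℤ × Pt) → ℤ
intSum [] = + 0
intSum ((l , _) ∷ ls) = l ℤ.+ intSum ls

intComb : List (ℤ × Pt) → Pt
intComb [] = 𝟎
intComb ((l , p) ∷ ls) = (l ⊙ p) ⊕ intComb ls

LatPt : List Pt → Pt → Set
LatPt S p = Conv S (toQ p)

-- linear part of the affine lattice generated by P ∩ ℤ³:
-- integer combinations of lattice points of P with coefficient sum 0
-- (= differences of elements of the affine lattice).
LinLattice : List Pt → Pt → Set
LinLattice S v = ∃[ ls ] (All (λ lp → LatPt S (Data.Product.proj₂ lp)) ls
                          × intSum ls ≡ + 0 × intComb ls ≡ v)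

-- ℤ³ / L has exactly two elements: two distinct cosets 0 + L and a + L
-- which together exhaust ℤ³.
Index2 : List Pt → Set
Index2 S = ∃[ a ] (¬ LinLattice S a × (∀ v → LinLattice S v ⊎ LinLattice S (v ⊖ a)))

-- Unimodular equivalence: affine f(v) = A v + t with integer A, t and
-- f(ℤ³) = ℤ³ (integrality of A, t is forced by f(ℤ³) ⊆ ℤ³), f(P) = Q.
record Aff : Set where
  constructor aff
  field r₁ r₂ r₃ t : Pt

applyℤ : Aff → Pt → Pt
applyℤ (aff r₁ r₂ r₃ t) v =
  ⟨ dot r₁ v , dot r₂ v , dot r₃ v ⟩ ⊕ t
  where
  dot : Pt → Pt → ℤ
  dot ⟨ a , b , c ⟩ ⟨ d , e , f ⟩ = a ℤ.* d ℤ.+ b ℤ.* e ℤ.+ c ℤ.* f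

applyℚ : Aff → QPt → QPt
applyℚ (aff r₁ r₂ r₃ t) v =
  ⟨ dotᵩ (toQ r₁) v , dotᵩ (toQ r₂) v , dotᵩ (toQ r₃) v ⟩ ⊕ᵩ toQ t

UnimodEquiv : List Pt → List Pt → Set
UnimodEquiv S T = ∃[ f ]
  ((∀ w → ∃[ v ] applyℤ f v ≡ w) ×
   (∀ q → (Conv T q ⇔ (∃[ p ] (Conv S p × applyℚ f p ≡ q)))))

Hyp : List Pt → Set
Hyp S = Dim3 S × WidthGt1 S × Index2 S

pt : ℤ → ℤ → ℤ → Pt
pt a b c = ⟨ a , b , c ⟩

-1ℤ : ℤ
-1ℤ = -[1+ 0 ]
-2ℤ : ℤ
-2ℤ = -[1+ 1 ]

F2 : ℤ → ℤ → List Pt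
F2 a b = pt (+ 0) (+ 0) a ∷ pt (+ 0) (+ 0) b ∷ pt -1ℤ -1ℤ (+ 1) ∷ pt (+ 1) -1ℤ (+ 0) ∷ pt -1ℤ (+ 1) (+ 0) ∷ []

F3 : ℤ → ℤ → ℤ → List Pt
F3 a b k = pt (+ 0) (+ 0) a ∷ pt (+ 0) (+ 0) b ∷ pt -1ℤ -1ℤ (+ 1) ∷ pt (+ 1) -1ℤ (+ 0) ∷ pt -1ℤ (+ 1) (+ 0)
         ∷ pt (+ 1) (+ 1) ((+ 2) ℤ.* k ℤ.- + 1) ∷ []

F4 : ℤ → ℤ → List Pt
F4 a b = pt (+ 0) (+ 0) a ∷ pt (+ 0) (+ 0) b ∷ pt -1ℤ -1ℤ (+ 1) ∷ pt (+ 1) -1ℤ (+ 0) ∷ pt -1ℤ (+ 1) (+ 0)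
       ∷ pt (+ 3) -1ℤ -1ℤ ∷ []

Bpts : List Pt
Bpts = pt -1ℤ -1ℤ (+ 0) ∷ pt (+ 2) (+ 0) (+ 0) ∷ pt (+ 1) (+ 2) (+ 0) ∷ []

E72 : List Pt
E72 = pt (+ 0) -1ℤ (+ 2) ∷ Bpts

E82¹ : List Pt
E82¹ = pt (+ 0) -1ℤ (+ 2) ∷ pt (+ 0) (+ 1) -2ℤ ∷ Bpts

E82² : List Pt
E82² = pt (+ 0) -1ℤ (+ 2) ∷ pt -2ℤ -1ℤ -2ℤ ∷ Bpts

E82³ : List Pt
E82³ = pt (+ 0) -1ℤ -1ℤ ∷ pt (+ 2) (+ 0) (+ 2) ∷ pt (+ 1) (+ 2) -1ℤ ∷ pt -1ℤ (+ 1) (+ 2) ∷ []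

{-# OPTIONS --safe #-}
-- Let K be the set of lattice points of P and L the sublattice of index two spanned by their differences. Integral midpoints
-- of points of K lie in K, hence in a coset of L; so K meets exactly four classes modulo 2L, and these are affinely independent.
-- Fix a point of K in each class. Moving a point of K halfway towards the fixed point of its class stays in K, and iterating
-- this ends inside the tetrahedron of the fixed points. If that tetrahedron has minimal volume, it contains no further point
-- of K; then its edges form a basis of L, and every point of K arises from its vertices O, Z, u, v by steps p ↦ 2p - e with e
-- a vertex. In the coordinates of the tetrahedron at most one coordinate of a point of K is odd, and together with
-- midpoints this rule forbids almost every step: the points of K fill a line OZ with few points beside it (F̃₂, F̃₃, F̃₄),
-- or they form one of four configurations in which the steps run around a cycle of vertices (the Eᵢ). All other
-- possibilities lie on two consecutive lattice planes, which the width excludes.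
module Submission where

open import Defs
open import Data.Bool using (Bool; true; false; not; _∧_; _∨_; _xor_; if_then_else_)
import Data.Bool as Bool
open import Data.Bool.ListAction using (any)
open import Data.Bool.Properties using (∧-zeroʳ; ∧-identityʳ; xor-same; xor-identityʳ)
open import Data.Empty using (⊥; ⊥-elim)
open import Data.Fin as Fin using (Fin; zero; suc)
open import Data.Integer as ℤ using (ℤ; +_; -[1+_]; ∣_∣; _+_; _*_; _-_; -_; _≤_; _<_; +≤+; -≤+; -≤-)
import Data.Integer.Properties as ℤP
open import Data.List using (List; []; _∷_; _++_; map)
open import Data.List.Membership.Propositional using (_∈_)
import Data.List.Membership.DecPropositional as DecMembership
open import Data.List.Relation.Unary.All as All using (All; []; _∷_)
open import Data.List.Relation.Unary.All.Properties using (++⁺)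
open import Data.List.Relation.Unary.Any using (here; there)
open import Data.Nat as ℕ using (ℕ; zero; suc; ⌊_/2⌋; z≤n; s≤s)
open import Data.Nat.Induction using (<-wellFounded)
import Data.Nat.Properties as ℕP
import Data.Nat.Tactic.RingSolver as ℕSolver
open import Data.Product using (Σ; _×_; _,_; ∃-syntax; proj₁; proj₂)
open import Data.Rational as ℚ using (ℚ; 0ℚ; 1ℚ; toℚᵘ)
import Data.Rational.Properties as ℚP
import Data.Rational.Unnormalised as ℚᵘ
import Data.Rational.Unnormalised.Properties as ℚᵘP
open import Data.Sum as Sum using (_⊎_; inj₁; inj₂)
open import Function using (_∘_; id)
open import Function.Bundles using (mk⇔)
open import Induction.WellFounded using (Acc; acc)
open import Level using (0ℓ)
open import Relation.Binary.PropositionalEquality using (_≡_; refl; sym; trans; cong; cong₂; subst; subst₂)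
open import Relation.Nullary using (¬_; Dec; yes; no; does)
open import Relation.Nullary.Decidable using (True; toWitness; dec⇒maybe; map′; _×-dec_; _⊎-dec_)
open import Tactic.RingSolver.Core.AlmostCommutativeRing using (AlmostCommutativeRing; fromCommutativeRing)

-- Why at most one coordinate is odd: measure from a point of `K`, and let e be twice a vector
-- outside `L`. Two points of `K` whose difference is congruent to e modulo `2L` would have a
-- lattice midpoint outside `L`. So `K` meets at most one class of each of the four pairs of classes
-- that differ by e. Since `K` generates `L` it meets four affinely independent classes, and e can
-- then only be the sum of these four. In the coordinates of the tetrahedron the empty coset is
-- therefore that of ⟨½,½,½⟩, and no two points of `K` have an all-odd sum; taking a vertex as one
-- of them gives the rule. Membership in a hull is never decided. A classification proposes a set of
-- points, follows every step out of it, and returns either a proof that all generators lie in the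
-- set or a witness of a step that leaves it. Such an exit is not analysed in place: a permutation
-- or reflection of the vertices turns it into the hypothesis of an earlier lemma. The order of the
-- lemmas (cycles, long spikes, short spikes, single steps) makes this process end.

module Hulls where

  open import Tactic.RingSolver using (solve-∀)

  ℚ-ring : AlmostCommutativeRing 0ℓ 0ℓ
  ℚ-ring = fromCommutativeRing ℚP.+-*-commutativeRing (λ p → dec⇒maybe (0ℚ ℚ.≟ p))

  -- Rational weights: convex hulls, affine images and width.

  toᵘι : ∀ n → toℚᵘ (ι n) ℚᵘ.≃ ℚᵘ.mkℚᵘ n 0
  toᵘι n = ℚP.toℚᵘ-fromℚᵘ (ℚᵘ.mkℚᵘ n 0)

  -- Normalised fractions do not compute on variables, so the identity is proved among unnormalised
  -- ones and brought back.
  ι-+ : ∀ m n → ι (m ℤ.+ n) ≡ ι m ℚ.+ ι n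
  ι-+ m n = ℚP.toℚᵘ-injective (begin
    toℚᵘ (ι (m ℤ.+ n))                   ≈⟨ toᵘι (m ℤ.+ n) ⟩
    ℚᵘ.mkℚᵘ (m ℤ.+ n) 0                  ≈⟨ ℚᵘ.*≡* (cong (ℤ._* + 1) (cong₂ ℤ._+_ (sym (ℤP.*-identityʳ m)) (sym (ℤP.*-identityʳ n)))) ⟩
    ℚᵘ.mkℚᵘ m 0 ℚᵘ.+ ℚᵘ.mkℚᵘ n 0         ≈⟨ ℚᵘP.+-cong (toᵘι m) (toᵘι n) ⟨
    toℚᵘ (ι m) ℚᵘ.+ toℚᵘ (ι n)           ≈⟨ ℚP.toℚᵘ-homo-+ (ι m) (ι n) ⟨
    toℚᵘ (ι m ℚ.+ ι n)                   ∎)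
    where open ℚᵘP.≃-Reasoning

  ι-* : ∀ m n → ι (m ℤ.* n) ≡ ι m ℚ.* ι n
  ι-* m n = ℚP.toℚᵘ-injective (begin
    toℚᵘ (ι (m ℤ.* n))                   ≈⟨ toᵘι (m ℤ.* n) ⟩
    ℚᵘ.mkℚᵘ m 0 ℚᵘ.* ℚᵘ.mkℚᵘ n 0         ≈⟨ ℚᵘP.*-cong (toᵘι m) (toᵘι n) ⟨
    toℚᵘ (ι m) ℚᵘ.* toℚᵘ (ι n)           ≈⟨ ℚP.toℚᵘ-homo-* (ι m) (ι n) ⟨
    toℚᵘ (ι m ℚ.* ι n)                   ∎)
    where open ℚᵘP.≃-Reasoning

  ι-mono : ∀ {m n} → m ℤ.≤ n → ι m ℚ.≤ ι n
  ι-mono {m} {n} m≤n = ℚP.toℚᵘ-cancel-≤ (begin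
    toℚᵘ (ι m)   ≃⟨ toᵘι m ⟩
    ℚᵘ.mkℚᵘ m 0  ≤⟨ ℚᵘ.*≤* (ℤP.*-monoʳ-≤-nonNeg (+ 1) m≤n) ⟩
    ℚᵘ.mkℚᵘ n 0  ≃⟨ toᵘι n ⟨
    toℚᵘ (ι n)   ∎)
    where open ℚᵘP.≤-Reasoning

  V3-≡ : {A : Set} {a b c a′ b′ c′ : A} → a ≡ a′ → b ≡ b′ → c ≡ c′ → ⟨ a , b , c ⟩ ≡ ⟨ a′ , b′ , c′ ⟩
  V3-≡ refl refl refl = refl

  cong₃ : {A B : Set} {a b c a′ b′ c′ : A} (f : A → A → A → B) → a ≡ a′ → b ≡ b′ → c ≡ c′ → f a b c ≡ f a′ b′ c′
  cong₃ f refl refl refl = refl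

  toQ-⊕ : ∀ p q → toQ (p ⊕ q) ≡ toQ p ⊕ᵩ toQ q
  toQ-⊕ ⟨ a , b , c ⟩ ⟨ d , e , f ⟩ = V3-≡ (ι-+ a d) (ι-+ b e) (ι-+ c f)

  toQ-⊙ : ∀ l p → toQ (l ⊙ p) ≡ ι l ⊙ᵩ toQ p
  toQ-⊙ l ⟨ a , b , c ⟩ = V3-≡ (ι-* l a) (ι-* l b) (ι-* l c)

  ⊙ᵩ-assoc : ∀ s t q → s ⊙ᵩ (t ⊙ᵩ q) ≡ (s ℚ.* t) ⊙ᵩ q
  ⊙ᵩ-assoc s t ⟨ a , b , c ⟩ = sym (V3-≡ (ℚP.*-assoc s t a) (ℚP.*-assoc s t b) (ℚP.*-assoc s t c))

  ⊙ᵩ-distrib : ∀ s p q → s ⊙ᵩ (p ⊕ᵩ q) ≡ (s ⊙ᵩ p) ⊕ᵩ (s ⊙ᵩ q)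
  ⊙ᵩ-distrib s ⟨ a , b , c ⟩ ⟨ d , e , f ⟩ =
    V3-≡ (ℚP.*-distribˡ-+ s a d) (ℚP.*-distribˡ-+ s b e) (ℚP.*-distribˡ-+ s c f)

  ⊙ᵩ-zero : ∀ s → s ⊙ᵩ 𝟎ᵩ ≡ 𝟎ᵩ
  ⊙ᵩ-zero s = V3-≡ (ℚP.*-zeroʳ s) (ℚP.*-zeroʳ s) (ℚP.*-zeroʳ s)

  ⊙ᵩ-identity : ∀ q → 1ℚ ⊙ᵩ q ≡ q
  ⊙ᵩ-identity ⟨ a , b , c ⟩ = V3-≡ (ℚP.*-identityˡ a) (ℚP.*-identityˡ b) (ℚP.*-identityˡ c)

  ⊕ᵩ-assoc : ∀ p q r → (p ⊕ᵩ q) ⊕ᵩ r ≡ p ⊕ᵩ (q ⊕ᵩ r)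
  ⊕ᵩ-assoc ⟨ a , b , c ⟩ ⟨ d , e , f ⟩ ⟨ g , h , i ⟩ =
    V3-≡ (ℚP.+-assoc a d g) (ℚP.+-assoc b e h) (ℚP.+-assoc c f i)

  ⊕ᵩ-identityˡ : ∀ q → 𝟎ᵩ ⊕ᵩ q ≡ q
  ⊕ᵩ-identityˡ ⟨ a , b , c ⟩ = V3-≡ (ℚP.+-identityˡ a) (ℚP.+-identityˡ b) (ℚP.+-identityˡ c)

  -- Conv S is Cone S 1ℚ.
  Cone : List Pt → ℚ → QPt → Set
  Cone S s q = ∃[ ws ] (All (λ wp → (0ℚ ℚ.≤ proj₁ wp) × (proj₂ wp ∈ S)) ws × weightSum ws ≡ s × weightedSum ws ≡ q)

  weightSum-++ : ∀ us vs → weightSum (us ++ vs) ≡ weightSum us ℚ.+ weightSum vs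
  weightSum-++ []             vs = sym (ℚP.+-identityˡ _)
  weightSum-++ ((w , _) ∷ us) vs = trans (cong (w ℚ.+_) (weightSum-++ us vs)) (sym (ℚP.+-assoc w _ _))

  weightedSum-++ : ∀ us vs → weightedSum (us ++ vs) ≡ weightedSum us ⊕ᵩ weightedSum vs
  weightedSum-++ []             vs = sym (⊕ᵩ-identityˡ _)
  weightedSum-++ ((w , p) ∷ us) vs =
    trans (cong ((w ⊙ᵩ toQ p) ⊕ᵩ_) (weightedSum-++ us vs)) (sym (⊕ᵩ-assoc (w ⊙ᵩ toQ p) _ _))

  cone-+ : ∀ {S s t p q} → Cone S s p → Cone S t q → Cone S (s ℚ.+ t) (p ⊕ᵩ q)
  cone-+ (us , aus , refl , refl) (vs , avs , refl , refl) =
    us ++ vs , ++⁺ aus avs , weightSum-++ us vs , weightedSum-++ us vs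

  scale : ℚ → List (ℚ × Pt) → List (ℚ × Pt)
  scale t = map (λ wp → t ℚ.* proj₁ wp , proj₂ wp)

  *-nonNeg : ∀ {s t} → 0ℚ ℚ.≤ s → 0ℚ ℚ.≤ t → 0ℚ ℚ.≤ s ℚ.* t
  *-nonNeg {s} {t} 0≤s 0≤t =
    subst (ℚ._≤ s ℚ.* t) (ℚP.*-zeroʳ s) (ℚP.*-monoˡ-≤-nonNeg s {{ℚ.nonNegative 0≤s}} 0≤t)

  cone-scale : ∀ {S s q} t → 0ℚ ℚ.≤ t → Cone S s q → Cone S (t ℚ.* s) (t ⊙ᵩ q)
  cone-scale {S} t 0≤t (us , aus , refl , refl) = scale t us , nonNeg us aus , sums us , combs us
    where
    nonNeg : ∀ us → All (λ wp → (0ℚ ℚ.≤ proj₁ wp) × (proj₂ wp ∈ S)) us →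
             All (λ wp → (0ℚ ℚ.≤ proj₁ wp) × (proj₂ wp ∈ S)) (scale t us)
    nonNeg []       []             = []
    nonNeg (_ ∷ us) ((h , m) ∷ hs) = (*-nonNeg 0≤t h , m) ∷ nonNeg us hs
    sums : ∀ us → weightSum (scale t us) ≡ t ℚ.* weightSum us
    sums []             = sym (ℚP.*-zeroʳ t)
    sums ((w , _) ∷ us) = trans (cong (t ℚ.* w ℚ.+_) (sums us)) (sym (ℚP.*-distribˡ-+ t w _))
    combs : ∀ us → weightedSum (scale t us) ≡ t ⊙ᵩ weightedSum us
    combs []             = sym (⊙ᵩ-zero t)
    combs ((w , p) ∷ us) =
      trans (cong₂ _⊕ᵩ_ (sym (⊙ᵩ-assoc t w (toQ p))) (combs us)) (sym (⊙ᵩ-distrib t (w ⊙ᵩ toQ p) _))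

  -- Nested combinations flatten: each weight multiplies the generator weights behind its point.
  cone-combination : ∀ {S} ws → All (λ wp → (0ℚ ℚ.≤ proj₁ wp) × LatPt S (proj₂ wp)) ws →
                     Cone S (weightSum ws) (weightedSum ws)
  cone-combination []             []             = [] , [] , refl , refl
  cone-combination ((w , p) ∷ ws) ((h , l) ∷ hs) =
    cone-+ (subst (λ s → Cone _ s (w ⊙ᵩ toQ p)) (ℚP.*-identityʳ w) (cone-scale w h l)) (cone-combination ws hs)

  generator : ∀ {S p} → p ∈ S → LatPt S p
  generator {p = p} m =
    (1ℚ , p) ∷ [] , (ℚP.nonNegative⁻¹ 1ℚ , m) ∷ [] , refl ,
    trans (cong (_⊕ᵩ 𝟎ᵩ) (⊙ᵩ-identity (toQ p))) (unitʳ (toQ p))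
    where
    unitʳ : ∀ q → q ⊕ᵩ 𝟎ᵩ ≡ q
    unitʳ ⟨ a , b , c ⟩ = V3-≡ (ℚP.+-identityʳ a) (ℚP.+-identityʳ b) (ℚP.+-identityʳ c)

  -- Dividing by the total `suc N` turns multiplicities into convex weights; later convexity
  -- arguments thus need integer coefficients only.
  latticePoint : ∀ {S} N ls m → All (λ lp → (+ 0 ℤ.≤ proj₁ lp) × LatPt S (proj₂ lp)) ls →
                 intSum ls ≡ + ℕ.suc N → intComb ls ≡ (+ ℕ.suc N) ⊙ m → LatPt S m
  latticePoint {S} N ls m hs sum≡ comb≡ =
    subst₂ (Cone S) total centre (cone-combination (weights ls) (nonNeg ls hs))
    where
    r : ℚ
    r = + 1 ℚ./ ℕ.suc N
    r*N : r ℚ.* ι (+ ℕ.suc N) ≡ 1ℚ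
    r*N = ℚP.toℚᵘ-injective (begin
      toℚᵘ (r ℚ.* ι (+ ℕ.suc N))                ≈⟨ ℚP.toℚᵘ-homo-* r (ι (+ ℕ.suc N)) ⟩
      toℚᵘ r ℚᵘ.* toℚᵘ (ι (+ ℕ.suc N))          ≈⟨ ℚᵘP.*-cong (ℚP.toℚᵘ-fromℚᵘ (ℚᵘ.mkℚᵘ (+ 1) N)) (toᵘι (+ ℕ.suc N)) ⟩
      ℚᵘ.mkℚᵘ (+ 1) N ℚᵘ.* ℚᵘ.mkℚᵘ (+ ℕ.suc N) 0  ≈⟨ ℚᵘ.*≡* (solve 1 (λ n → (con (+ 1) :* n) :* con (+ 1) := con (+ 1) :* (n :* con (+ 1))) refl (+ ℕ.suc N)) ⟩
      toℚᵘ 1ℚ                                   ∎)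
      where open ℚᵘP.≃-Reasoning
            open import Data.Integer.Solver using (module +-*-Solver)
            open +-*-Solver
    0≤r : 0ℚ ℚ.≤ r
    0≤r = ℚP.nonNegative⁻¹ r {{ℚP.normalize-nonNeg 1 (ℕ.suc N)}}
    weights : List (ℤ × Pt) → List (ℚ × Pt)
    weights = map (λ lp → r ℚ.* ι (proj₁ lp) , proj₂ lp)
    nonNeg : ∀ ls → All (λ lp → (+ 0 ℤ.≤ proj₁ lp) × LatPt S (proj₂ lp)) ls →
             All (λ wp → (0ℚ ℚ.≤ proj₁ wp) × LatPt S (proj₂ wp)) (weights ls)
    nonNeg []       []             = []
    nonNeg (_ ∷ ls) ((h , l) ∷ hs) = (*-nonNeg 0≤r (ι-mono h) , l) ∷ nonNeg ls hs
    sums : ∀ ls → weightSum (weights ls) ≡ r ℚ.* ι (intSum ls)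
    sums []             = sym (ℚP.*-zeroʳ r)
    sums ((l , _) ∷ ls) = trans (cong (r ℚ.* ι l ℚ.+_) (sums ls))
      (trans (sym (ℚP.*-distribˡ-+ r _ _)) (cong (r ℚ.*_) (sym (ι-+ l _))))
    combs : ∀ ls → weightedSum (weights ls) ≡ r ⊙ᵩ toQ (intComb ls)
    combs []             = sym (⊙ᵩ-zero r)
    combs ((l , p) ∷ ls) = trans
      (cong₂ _⊕ᵩ_ (trans (sym (⊙ᵩ-assoc r (ι l) (toQ p))) (cong (r ⊙ᵩ_) (sym (toQ-⊙ l p)))) (combs ls))
      (trans (sym (⊙ᵩ-distrib r (toQ (l ⊙ p)) _)) (cong (r ⊙ᵩ_) (sym (toQ-⊕ (l ⊙ p) _))))
    total : weightSum (weights ls) ≡ 1ℚ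
    total = trans (sums ls) (trans (cong (λ n → r ℚ.* ι n) sum≡) r*N)
    centre : weightedSum (weights ls) ≡ toQ m
    centre = trans (combs ls) (trans (cong (λ v → r ⊙ᵩ toQ v) comb≡)
      (trans (cong (r ⊙ᵩ_) (toQ-⊙ (+ ℕ.suc N) m))
      (trans (⊙ᵩ-assoc r _ (toQ m)) (trans (cong (_⊙ᵩ toQ m) r*N) (⊙ᵩ-identity (toQ m))))))

  -- The scalar product inside `applyℤ` is local to it; by eta for `V3` this copy unfolds to the
  -- same sums.
  dot : Pt → Pt → ℤ
  dot ⟨ a , b , c ⟩ ⟨ d , e , f ⟩ = a ℤ.* d ℤ.+ b ℤ.* e ℤ.+ c ℤ.* f

  dot-ι : ∀ p q → ι (dot p q) ≡ dotᵩ (toQ p) (toQ q)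
  dot-ι ⟨ a , b , c ⟩ ⟨ d , e , f ⟩ =
    trans (ι-+ (a ℤ.* d ℤ.+ b ℤ.* e) (c ℤ.* f))
      (cong₂ ℚ._+_ (trans (ι-+ (a ℤ.* d) (b ℤ.* e)) (cong₂ ℚ._+_ (ι-* a d) (ι-* b e))) (ι-* c f))

  dotᵩ-step : ∀ c w p q → dotᵩ c ((w ⊙ᵩ p) ⊕ᵩ q) ≡ w ℚ.* dotᵩ c p ℚ.+ dotᵩ c q
  dotᵩ-step ⟨ a , b , c ⟩ w ⟨ d , e , f ⟩ ⟨ g , h , i ⟩ = identity a b c w d e f g h i
    where
    identity : ∀ a b c w d e f g h i →
      a ℚ.* (w ℚ.* d ℚ.+ g) ℚ.+ b ℚ.* (w ℚ.* e ℚ.+ h) ℚ.+ c ℚ.* (w ℚ.* f ℚ.+ i) ≡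
      w ℚ.* (a ℚ.* d ℚ.+ b ℚ.* e ℚ.+ c ℚ.* f) ℚ.+ (a ℚ.* g ℚ.+ b ℚ.* h ℚ.+ c ℚ.* i)
    identity = solve-∀ ℚ-ring

  dotᵩ-zero : ∀ c → dotᵩ c 𝟎ᵩ ≡ 0ℚ
  dotᵩ-zero ⟨ a , b , c ⟩ = identity a b c
    where
    identity : ∀ a b c → a ℚ.* 0ℚ ℚ.+ b ℚ.* 0ℚ ℚ.+ c ℚ.* 0ℚ ≡ 0ℚ
    identity = solve-∀ ℚ-ring

  applyℚ-toQ : ∀ f p → applyℚ f (toQ p) ≡ toQ (applyℤ f p)
  applyℚ-toQ (aff r₁ r₂ r₃ t) p =
    trans (cong (_⊕ᵩ toQ t) (sym (V3-≡ (dot-ι r₁ p) (dot-ι r₂ p) (dot-ι r₃ p))))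
      (sym (toQ-⊕ ⟨ dot r₁ p , dot r₂ p , dot r₃ p ⟩ t))

  image : Aff → List (ℚ × Pt) → List (ℚ × Pt)
  image f = map (λ wp → proj₁ wp , applyℤ f (proj₂ wp))

  weightSum-image : ∀ f ws → weightSum (image f ws) ≡ weightSum ws
  weightSum-image f []             = refl
  weightSum-image f ((w , _) ∷ ws) = cong (w ℚ.+_) (weightSum-image f ws)

  -- The induction runs on the homogeneous form, in which the translation is multiplied by the total
  -- weight, because tails of `ws` do not have total weight one.
  weightedSum-image : ∀ f ws → weightSum ws ≡ 1ℚ → weightedSum (image f ws) ≡ applyℚ f (weightedSum ws)
  weightedSum-image f@(aff r₁ r₂ r₃ t) ws total =
    trans (homogeneous ws) (cong (lin (weightedSum ws) ⊕ᵩ_) (trans (cong (_⊙ᵩ toQ t) total) (⊙ᵩ-identity (toQ t))))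
    where
    lin : QPt → QPt
    lin v = ⟨ dotᵩ (toQ r₁) v , dotᵩ (toQ r₂) v , dotᵩ (toQ r₃) v ⟩
    lin-step : ∀ w p q → lin ((w ⊙ᵩ p) ⊕ᵩ q) ≡ (w ⊙ᵩ lin p) ⊕ᵩ lin q
    lin-step w p q = V3-≡ (dotᵩ-step (toQ r₁) w p q) (dotᵩ-step (toQ r₂) w p q) (dotᵩ-step (toQ r₃) w p q)
    shuffle : ∀ w l m b s → w ℚ.* (l ℚ.+ b) ℚ.+ (m ℚ.+ s ℚ.* b) ≡ (w ℚ.* l ℚ.+ m) ℚ.+ (w ℚ.+ s) ℚ.* b
    shuffle = solve-∀ ℚ-ring
    shuffle₃ : ∀ w l m b s → (w ⊙ᵩ (l ⊕ᵩ b)) ⊕ᵩ (m ⊕ᵩ (s ⊙ᵩ b)) ≡ ((w ⊙ᵩ l) ⊕ᵩ m) ⊕ᵩ ((w ℚ.+ s) ⊙ᵩ b)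
    shuffle₃ w ⟨ a , b , c ⟩ ⟨ d , e , f ⟩ ⟨ g , h , i ⟩ s =
      V3-≡ (shuffle w a d g s) (shuffle w b e h s) (shuffle w c f i s)
    homogeneous : ∀ ws → weightedSum (image f ws) ≡ lin (weightedSum ws) ⊕ᵩ (weightSum ws ⊙ᵩ toQ t)
    homogeneous [] = sym (trans (cong₂ _⊕ᵩ_ (V3-≡ (dotᵩ-zero (toQ r₁)) (dotᵩ-zero (toQ r₂)) (dotᵩ-zero (toQ r₃)))
      (zeroˡ (toQ t))) refl)
      where
      zeroˡ : ∀ q → 0ℚ ⊙ᵩ q ≡ 𝟎ᵩ
      zeroˡ ⟨ a , b , c ⟩ = V3-≡ (ℚP.*-zeroˡ a) (ℚP.*-zeroˡ b) (ℚP.*-zeroˡ c)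
    homogeneous ((w , p) ∷ ws) =
      trans (cong₂ _⊕ᵩ_ (cong (w ⊙ᵩ_) (sym (applyℚ-toQ f p))) (homogeneous ws))
      (trans (shuffle₃ w (lin (toQ p)) (lin (weightedSum ws)) (toQ t) (weightSum ws))
        (cong (_⊕ᵩ ((w ℚ.+ weightSum ws) ⊙ᵩ toQ t)) (sym (lin-step w (toQ p) (weightedSum ws)))))

  -- Generators suffice: weights are pushed forward along `f`, and for the converse each generator
  -- of `T` in a combination is replaced by its chosen preimage.
  unimodEquiv : ∀ {S T} (f : Aff) → (∀ w → ∃[ v ] applyℤ f v ≡ w) →
                (∀ {s} → s ∈ S → LatPt T (applyℤ f s)) →
                (∀ {t} → t ∈ T → ∃[ s ] (LatPt S s × applyℤ f s ≡ t)) → UnimodEquiv S T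
  unimodEquiv {S} {T} f surj S⇒T T⇒S = f , surj , λ q → mk⇔ (backward q) (forward q)
    where
    forward : ∀ q → ∃[ p ] (Conv S p × applyℚ f p ≡ q) → Conv T q
    forward q (p , (ws , hs , total , refl) , refl) =
      subst₂ (Cone T) (trans (weightSum-image f ws) total) (weightedSum-image f ws total)
        (cone-combination (image f ws) (images ws hs))
      where
      images : ∀ ws → All (λ wp → (0ℚ ℚ.≤ proj₁ wp) × (proj₂ wp ∈ S)) ws →
               All (λ wp → (0ℚ ℚ.≤ proj₁ wp) × LatPt T (proj₂ wp)) (image f ws)
      images []       []             = []
      images (_ ∷ ws) ((h , m) ∷ hs) = (h , S⇒T m) ∷ images ws hs
    lift : ∀ ws → All (λ wp → (0ℚ ℚ.≤ proj₁ wp) × (proj₂ wp ∈ T)) ws →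
           ∃[ us ] (All (λ wp → (0ℚ ℚ.≤ proj₁ wp) × LatPt S (proj₂ wp)) us × image f us ≡ ws)
    lift []             []             = [] , [] , refl
    lift ((w , t) ∷ ws) ((h , m) ∷ hs) with T⇒S m | lift ws hs
    ... | s , l , refl | us , ls , refl = (w , s) ∷ us , (h , l) ∷ ls , refl
    backward : ∀ q → Conv T q → ∃[ p ] (Conv S p × applyℚ f p ≡ q)
    backward q (ws , hs , total , refl) with lift ws hs
    ... | us , ls , refl =
      weightedSum us , subst (λ s → Cone S s (weightedSum us)) total′ (cone-combination us ls) ,
      sym (weightedSum-image f us total′)
      where
      total′ : weightSum us ≡ 1ℚ
      total′ = trans (sym (weightSum-image f us)) total

  -- Bounds on the generators pass to weighted sums, multiplied by the total weight; two values in
  -- an interval of length one cannot differ by more than one.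
  no-slab : ∀ {S} → WidthGt1 S → ∀ c lo → ¬ (c ≡ 𝟎) →
            ¬ (∀ {s} → s ∈ S → (lo ℤ.≤ dot c s) × (dot c s ℤ.≤ lo ℤ.+ + 1))
  no-slab {S} wide c lo c≢0 slab with wide c (+ 0) c≢0
  ... | p , q , (us , aus , su , refl) , (vs , avs , sv , refl) , gap =
    ℚP.<-irrefl refl (ℚP.<-≤-trans gap (subst₂ ℚ._≤_ refl (identity (ι lo) (ι (+ 0)))
      (ℚP.+-mono-≤ (ℚP.+-monoˡ-≤ (ι (+ 0)) (subst (dotᵩ (toQ c) (weightedSum us) ℚ.≤_) (one (ι lo ℚ.+ 1ℚ) su) (upper us aus)))
        (ℚP.neg-antimono-≤ (ℚP.+-monoˡ-≤ (ι (+ 0)) (subst (ℚ._≤ dotᵩ (toQ c) (weightedSum vs)) (one (ι lo) sv) (lower vs avs)))))))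
    where
    one : ∀ x {y} → y ≡ 1ℚ → x ℚ.* y ≡ x
    one x refl = ℚP.*-identityʳ x
    identity : ∀ l d → (l ℚ.+ 1ℚ ℚ.+ d) ℚ.- (l ℚ.+ d) ≡ 1ℚ
    identity = solve-∀ ℚ-ring
    step : ∀ m w y → w ℚ.* m ℚ.+ m ℚ.* y ≡ m ℚ.* (w ℚ.+ y)
    step = solve-∀ ℚ-ring
    upper : ∀ ws → All (λ wp → (0ℚ ℚ.≤ proj₁ wp) × (proj₂ wp ∈ S)) ws →
            dotᵩ (toQ c) (weightedSum ws) ℚ.≤ (ι lo ℚ.+ 1ℚ) ℚ.* weightSum ws
    upper [] [] = ℚP.≤-reflexive (trans (dotᵩ-zero (toQ c)) (sym (ℚP.*-zeroʳ (ι lo ℚ.+ 1ℚ))))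
    upper ((w , s) ∷ ws) ((h , m) ∷ hs) =
      subst₂ ℚ._≤_ (sym (dotᵩ-step (toQ c) w (toQ s) (weightedSum ws))) (step (ι lo ℚ.+ 1ℚ) w (weightSum ws))
        (ℚP.+-mono-≤ (ℚP.*-monoˡ-≤-nonNeg w {{ℚ.nonNegative h}}
          (subst₂ ℚ._≤_ (dot-ι c s) (ι-+ lo (+ 1)) (ι-mono (proj₂ (slab m))))) (upper ws hs))
    lower : ∀ ws → All (λ wp → (0ℚ ℚ.≤ proj₁ wp) × (proj₂ wp ∈ S)) ws →
            ι lo ℚ.* weightSum ws ℚ.≤ dotᵩ (toQ c) (weightedSum ws)
    lower [] [] = ℚP.≤-reflexive (sym (trans (dotᵩ-zero (toQ c)) (sym (ℚP.*-zeroʳ (ι lo)))))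
    lower ((w , s) ∷ ws) ((h , m) ∷ hs) =
      subst₂ ℚ._≤_ (step (ι lo) w (weightSum ws)) (sym (dotᵩ-step (toQ c) w (toQ s) (weightedSum ws)))
        (ℚP.+-mono-≤ (ℚP.*-monoˡ-≤-nonNeg w {{ℚ.nonNegative h}}
          (subst (ι lo ℚ.≤_) (dot-ι c s) (ι-mono (proj₁ (slab m))))) (lower ws hs))

open Hulls

-- Parity, halving towards a vertex, and sets closed under steps.

module Configurations where

  open import Data.Integer.Tactic.RingSolver using (solve-∀)

  oddℕ : ℕ → Bool
  oddℕ zero          = false
  oddℕ (suc zero)    = true
  oddℕ (suc (suc n)) = oddℕ n

  odd : ℤ → Bool
  odd (+ n)    = oddℕ n
  odd -[1+ n ] = not (oddℕ n)

  -- The ceiling of n / 2.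
  half : ℤ → ℤ
  half (+ n)    = + ⌊ suc n /2⌋
  half -[1+ n ] = - + ⌊ suc n /2⌋

  ⌊n/2⌋-spec : ∀ n → n ≡ ⌊ n /2⌋ ℕ.+ ⌊ n /2⌋ ℕ.+ (if oddℕ n then 1 else 0)
  ⌊n/2⌋-spec zero          = refl
  ⌊n/2⌋-spec (suc zero)    = refl
  ⌊n/2⌋-spec (suc (suc n)) = cong suc (trans (cong suc (⌊n/2⌋-spec n))
    (cong (ℕ._+ (if oddℕ n then 1 else 0)) (sym (ℕP.+-suc ⌊ n /2⌋ ⌊ n /2⌋))))

  oddℕ-suc : ∀ n → oddℕ (suc n) ≡ not (oddℕ n)
  oddℕ-suc zero          = refl
  oddℕ-suc (suc zero)    = refl
  oddℕ-suc (suc (suc n)) = oddℕ-suc n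

  half-spec : ∀ n → n ≡ + 2 * half n - (if odd n then + 1 else + 0)
  half-spec (+ n) = nonneg n
    where
    identity₀ : ∀ h s → s + + 1 ≡ h + h + + 0 → s ≡ + 2 * h - + 1
    identity₀ h s e = trans (shift s) (trans (cong (_- + 1) e) (double h))
      where
      shift : ∀ s → s ≡ s + + 1 - + 1
      shift = solve-∀
      double : ∀ h → h + h + + 0 - + 1 ≡ + 2 * h - + 1
      double = solve-∀
    identity₁ : ∀ h s → s + + 1 ≡ h + h + + 1 → s ≡ + 2 * h - + 0
    identity₁ h s e = trans (shift s) (trans (cong (_- + 1) e) (double h))
      where
      shift : ∀ s → s ≡ s + + 1 - + 1
      shift = solve-∀
      double : ∀ h → h + h + + 1 - + 1 ≡ + 2 * h - + 0
      double = solve-∀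
    nonneg : ∀ n → + n ≡ + 2 * + ⌊ suc n /2⌋ - (if oddℕ n then + 1 else + 0)
    nonneg n with oddℕ n | oddℕ (suc n) | oddℕ-suc n | ⌊n/2⌋-spec (suc n)
    ... | true  | false | _ | e = identity₀ (+ ⌊ suc n /2⌋) (+ n) (trans (cong +_ (ℕP.+-comm n 1)) (cong +_ e))
    ... | false | true  | _ | e = identity₁ (+ ⌊ suc n /2⌋) (+ n) (trans (cong +_ (ℕP.+-comm n 1)) (cong +_ e))
  half-spec -[1+ n ] = trans (cong -_ (cong +_ (⌊n/2⌋-spec (suc n)))) (final n)
    where
    identity : ∀ h d → - (h + h + d) ≡ + 2 * (- h) - d
    identity = solve-∀
    final : ∀ n → - (+ (⌊ suc n /2⌋ ℕ.+ ⌊ suc n /2⌋ ℕ.+ (if oddℕ (suc n) then 1 else 0))) ≡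
            + 2 * (- + ⌊ suc n /2⌋) - (if not (oddℕ n) then + 1 else + 0)
    final n with oddℕ n | oddℕ (suc n) | oddℕ-suc n
    ... | true  | false | _ = identity (+ ⌊ suc n /2⌋) (+ 0)
    ... | false | true  | _ = identity (+ ⌊ suc n /2⌋) (+ 1)

  -- Rounding up fits the step `p ↦ 2p - e`, since an odd coordinate comes from a vertex coordinate
  -- 1. The summand `- + 0` makes the index agree syntactically with `2[ p ]- e`.
  data Half : ℤ → Bool → Set where
    2m   : ∀ m → Half (+ 2 * m - + 0) false
    2m-1 : ∀ m → Half (+ 2 * m - + 1) true

  halve : ∀ n → Half n (odd n)
  halve n with odd n | half-spec n
  ... | false | e = subst (λ k → Half k false) (sym e) (2m (half n))
  ... | true  | e = subst (λ k → Half k true) (sym e) (2m-1 (half n))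

  2*m-odd : ∀ m → odd (+ 2 * m) ≡ false
  2*m-odd (+ n)    = trans (cong odd (sym (ℤP.pos-* 2 n))) (oddℕ-double n)
    where
    oddℕ-double : ∀ n → oddℕ (2 ℕ.* n) ≡ false
    oddℕ-double zero = refl
    oddℕ-double (suc n) rewrite ℕP.+-suc n (n ℕ.+ 0) = oddℕ-double n
  2*m-odd -[1+ n ] = cong not (oddℕ-double n)
    where
    oddℕ-double : ∀ n → oddℕ (n ℕ.+ suc (n ℕ.+ 0)) ≡ true
    oddℕ-double zero = refl
    oddℕ-double (suc n) rewrite ℕP.+-suc n (suc (n ℕ.+ 0)) = oddℕ-double n

  odd-pred : ∀ n → odd (n - + 1) ≡ not (odd n)
  odd-pred (+ zero)  = refl
  odd-pred (+ suc n) = trans (not-involutive (oddℕ n)) (cong not (sym (oddℕ-suc n)))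
    where
    not-involutive : ∀ b → b ≡ not (not b)
    not-involutive true  = refl
    not-involutive false = refl
  odd-pred -[1+ n ] rewrite ℕP.+-identityʳ n = cong not (oddℕ-suc n)

  odd-2m-1 : ∀ m → odd (+ 2 * m - + 1) ≡ true
  odd-2m-1 m = trans (odd-pred (+ 2 * m)) (cong not (2*m-odd m))

  -- At most one of three integers is odd.
  sparse : Pt → Bool
  sparse ⟨ a , b , c ⟩ = if odd b then not (odd c) ∧ not (odd a) else not (odd c) ∨ not (odd a)

  ∣m∣≤∣2m∣ : ∀ m → ∣ m ∣ ℕ.≤ ∣ + 2 * m ∣
  ∣m∣≤∣2m∣ m rewrite ℤP.∣i*j∣≡∣i∣*∣j∣ (+ 2) m = ℕP.m≤m+n ∣ m ∣ _

  n≤k+1*n : ∀ k n → n ℕ.≤ k ℕ.+ 1 ℕ.* n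
  n≤k+1*n k n = ℕP.≤-trans (ℕP.≤-reflexive (sym (ℕP.*-identityˡ n))) (ℕP.m≤n+m (1 ℕ.* n) k)

  -- The fixed points of halving, 0 here and 1 for odd numbers, are the coordinates of the vertices;
  -- everywhere else the absolute value drops.
  shrink-even : ∀ m → m ≡ + 0 ⊎ ∣ m ∣ ℕ.< ∣ + 2 * m ∣
  shrink-even (+ zero)  = inj₁ refl
  shrink-even (+ suc n) = inj₂ (s≤s (n≤k+1*n n (suc n)))
  shrink-even -[1+ n ]  = inj₂ (s≤s (n≤k+1*n n (suc n)))

  shrink-odd : ∀ m → m ≡ + 1 ⊎ ∣ m ∣ ℕ.< ∣ + 2 * m - + 1 ∣
  shrink-odd (+ zero)        = inj₂ (s≤s z≤n)
  shrink-odd (+ suc zero)    = inj₁ refl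
  shrink-odd (+ suc (suc n)) = inj₂ (s≤s (n≤k+1*n n (suc (suc n))))
  shrink-odd -[1+ n ]        = inj₂ (s≤s (s≤s (ℕP.≤-trans (ℕP.n≤1+n n) (ℕP.≤-trans (n≤k+1*n n (suc n)) (ℕP.m≤m+n _ 0)))))

  ∣m∣≤∣2m-1∣ : ∀ m → ∣ m ∣ ℕ.≤ ∣ + 2 * m - + 1 ∣
  ∣m∣≤∣2m-1∣ m with shrink-odd m
  ... | inj₁ refl = s≤s z≤n
  ... | inj₂ lt   = ℕP.<⇒≤ lt

  norm : Pt → ℕ
  norm ⟨ a , b , c ⟩ = ∣ a ∣ ℕ.+ ∣ b ∣ ℕ.+ ∣ c ∣

  shrink-sum : ∀ {A B C : Set} {a b c a′ b′ c′} → a ℕ.≤ a′ → b ℕ.≤ b′ → c ℕ.≤ c′ →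
               A ⊎ a ℕ.< a′ → B ⊎ b ℕ.< b′ → C ⊎ c ℕ.< c′ →
               (A × B × C) ⊎ a ℕ.+ b ℕ.+ c ℕ.< a′ ℕ.+ b′ ℕ.+ c′
  shrink-sum p q r (inj₁ x) (inj₁ y) (inj₁ z) = inj₁ (x , y , z)
  shrink-sum p q r (inj₂ x) _        _        = inj₂ (ℕP.+-mono-<-≤ (ℕP.+-mono-<-≤ x q) r)
  shrink-sum p q r _        (inj₂ y) _        = inj₂ (ℕP.+-mono-<-≤ (ℕP.+-mono-≤-< p y) r)
  shrink-sum p q r _        _        (inj₂ z) = inj₂ (ℕP.+-mono-≤-< (ℕP.+-mono-≤ p q) z)

  Oₚ Zₚ uₚ vₚ : Pt
  Oₚ = pt (+ 0) (+ 0) (+ 0)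
  Zₚ = pt (+ 1) (+ 0) (+ 0)
  uₚ = pt (+ 0) (+ 1) (+ 0)
  vₚ = pt (+ 0) (+ 0) (+ 1)

  2[_]-_ : Pt → Pt → Pt
  2[ ⟨ a , b , c ⟩ ]- ⟨ d , e , f ⟩ = ⟨ + 2 * a - d , + 2 * b - e , + 2 * c - f ⟩

  data Vertex : Pt → Set where
    O : Vertex Oₚ
    Z : Vertex Zₚ
    u : Vertex uₚ
    v : Vertex vₚ

  _≟ₚ_ : (p q : Pt) → Dec (p ≡ q)
  ⟨ a , b , c ⟩ ≟ₚ ⟨ d , e , f ⟩ = map′ (λ { (refl , refl , refl) → refl }) (λ { refl → refl , refl , refl })
    ((a ℤ.≟ d) ×-dec (b ℤ.≟ e) ×-dec (c ℤ.≟ f))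

  open DecMembership _≟ₚ_ using (_∈?_)

  vertices : List Pt
  vertices = Oₚ ∷ Zₚ ∷ uₚ ∷ vₚ ∷ []

  -- All that the combinatorial part uses about the lattice points of a polytope. Midpoints are
  -- stated by coordinates so that numerical instances hold by `refl`; `between` asks for convexity
  -- on the line OZ only.
  record Config (K : Pt → Set) : Set where
    field
      mid    : ∀ {a b c a′ b′ c′} m n o → K ⟨ a , b , c ⟩ → K ⟨ a′ , b′ , c′ ⟩ →
               a + a′ ≡ m + m → b + b′ ≡ n + n → c + c′ ≡ o + o → K ⟨ m , n , o ⟩
      law    : ∀ {p} → K p → sparse p ≡ true
      vertex : ∀ {e} → Vertex e → K e
      between : ∀ {i j} m → K ⟨ i , + 0 , + 0 ⟩ → K ⟨ j , + 0 , + 0 ⟩ → i ℤ.≤ m → m ℤ.≤ j → K ⟨ m , + 0 , + 0 ⟩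

  sparse-even : ∀ a b c → odd b ∨ odd c ≡ true → sparse ⟨ a , b , c ⟩ ≡ true → odd a ≡ false
  sparse-even a b c _ _ with odd a | odd b | odd c
  sparse-even a b c _ _  | false | _     | _     = refl
  sparse-even a b c _ () | true  | true  | true
  sparse-even a b c _ () | true  | true  | false
  sparse-even a b c _ () | true  | false | true
  sparse-even a b c () _ | true  | false | false

  -- The lattice points of F̃₂, F̃₃ and F̃₄; for F̃₂ the further point r is v itself.
  data Spiked (r : Pt) : Pt → Set where
    spike : ∀ a → Spiked r ⟨ a , + 0 , + 0 ⟩
    u     : Spiked r uₚ
    u′    : Spiked r ⟨ + 0 , -1ℤ , + 0 ⟩
    v     : Spiked r vₚ
    w     : Spiked r r

  -- The points of `Spiked` off the line OZ. Their steps away from O or Z are the ones whose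
  -- exclusion depends on the length of the spike.
  data Side (r : Pt) : Pt → Set where
    u  : Side r uₚ
    u′ : Side r ⟨ + 0 , -1ℤ , + 0 ⟩
    v  : Side r vₚ
    w  : Side r r

  -- By the law such a point of `K` has even first coordinate, which makes it the only point of `K`
  -- on its parallel to OZ (`rigid`).
  Anchored : Pt → Set
  Anchored p = odd (y p) ∨ odd (z p) ≡ true

  anchored : ∀ {r q} → Anchored r → Side r q → Anchored q
  anchored h u  = refl
  anchored h u′ = refl
  anchored h v  = refl
  anchored h w  = h

  step-apart : ∀ a d → ¬ (d ≡ + 0) → ¬ (a ≡ a + d)
  step-apart a d d≢0 e = d≢0 (trans (difference a d) (trans (cong (λ t → t - a) (sym e)) (ℤP.+-inverseʳ a)))
    where
    difference : ∀ a d → d ≡ a + d - a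
    difference = solve-∀

  module _ {K : Pt → Set} (C : Config K) where
    open Config C

    private
      2m-d+d : ∀ m d → + 2 * m - d + d ≡ m + m
      2m-d+d = solve-∀

    parent : ∀ p {e} → Vertex e → K (2[ p ]- e) → K p
    parent ⟨ a , b , c ⟩ {⟨ d , e , f ⟩} V k = mid a b c k (vertex V) (2m-d+d a d) (2m-d+d b e) (2m-d+d c f)

    -- Halving towards the vertex of equal parity strictly decreases the norm until a vertex is reached.
    closure : (X : Pt → Set) {E : Set} → (∀ {e} → Vertex e → X e) →
              (∀ p {e} → Vertex e → X p → K p → K (2[ p ]- e) → X (2[ p ]- e) ⊎ E) →
              ∀ q → K q → X q ⊎ E
    closure X {E} base step q k = go q k (<-wellFounded (norm q))
      where
      go : ∀ q → K q → Acc ℕ._<_ (norm q) → X q ⊎ E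
      up : ∀ p {e} → Vertex e → K (2[ p ]- e) → Acc ℕ._<_ (norm (2[ p ]- e)) →
           (p ≡ e) ⊎ norm p ℕ.< norm (2[ p ]- e) → X (2[ p ]- e) ⊎ E
      up p V k (acc rs) (inj₂ lt) with go p (parent p V k) (rs lt)
      ... | inj₁ x = step p V x (parent p V k) k
      ... | inj₂ e = inj₂ e
      up p {⟨ d , e , f ⟩} V k _ (inj₁ refl) = inj₁ (subst X (sym (cong₃ pt (same d) (same e) (same f))) (base V))
        where
        same : ∀ d → + 2 * d - d ≡ d
        same = solve-∀
      ev : ∀ m → m ≡ + 0 ⊎ ∣ m ∣ ℕ.< ∣ + 2 * m - + 0 ∣
      ev m = subst (λ n → m ≡ + 0 ⊎ ∣ m ∣ ℕ.< ∣ n ∣) (sym (ℤP.+-identityʳ (+ 2 * m))) (shrink-even m)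
      ev≤ : ∀ m → ∣ m ∣ ℕ.≤ ∣ + 2 * m - + 0 ∣
      ev≤ m = subst (λ n → ∣ m ∣ ℕ.≤ ∣ n ∣) (sym (ℤP.+-identityʳ (+ 2 * m))) (∣m∣≤∣2m∣ m)
      eq₃ : ∀ {a b c a′ b′ c′ : ℤ} {n : Set} → (a ≡ a′ × b ≡ b′ × c ≡ c′) ⊎ n → (pt a b c ≡ pt a′ b′ c′) ⊎ n
      eq₃ (inj₁ (refl , refl , refl)) = inj₁ refl
      eq₃ (inj₂ y)                    = inj₂ y
      -- The law leaves four parity patterns, one for each vertex; the order second, third, first
      -- coordinate follows the tests in `sparse`.
      go ⟨ a , b , c ⟩ k wf with odd b | halve b | odd c | halve c | odd a | halve a | law k
      ... | _ | 2m n   | _ | 2m o   | _ | 2m m   | _ = up ⟨ m , n , o ⟩ O k wf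
        (eq₃ (shrink-sum (ev≤ m) (ev≤ n) (ev≤ o) (ev m) (ev n) (ev o)))
      ... | _ | 2m n   | _ | 2m o   | _ | 2m-1 m | _ = up ⟨ m , n , o ⟩ Z k wf
        (eq₃ (shrink-sum (∣m∣≤∣2m-1∣ m) (ev≤ n) (ev≤ o) (shrink-odd m) (ev n) (ev o)))
      ... | _ | 2m-1 n | _ | 2m o   | _ | 2m m   | _ = up ⟨ m , n , o ⟩ u k wf
        (eq₃ (shrink-sum (ev≤ m) (∣m∣≤∣2m-1∣ n) (ev≤ o) (ev m) (shrink-odd n) (ev o)))
      ... | _ | 2m n   | _ | 2m-1 o | _ | 2m m   | _ = up ⟨ m , n , o ⟩ v k wf
        (eq₃ (shrink-sum (ev≤ m) (ev≤ n) (∣m∣≤∣2m-1∣ o) (ev m) (ev n) (shrink-odd o)))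

    -- A midpoint only under `evenSum`; odd sums are rounded up.
    midpoint : Pt → Pt → Pt
    midpoint ⟨ a , b , c ⟩ ⟨ d , e , f ⟩ = ⟨ half (a + d) , half (b + e) , half (c + f) ⟩

    evenSum : Pt → Pt → Bool
    evenSum ⟨ a , b , c ⟩ ⟨ d , e , f ⟩ = not (odd (a + d)) ∧ (not (odd (b + e)) ∧ not (odd (c + f)))

    midpoint∈ : ∀ p q → K p → K q → evenSum p q ≡ true → K (midpoint p q)
    midpoint∈ ⟨ a , b , c ⟩ ⟨ d , e , f ⟩ k l h
      with odd (a + d) | half-spec (a + d) | odd (b + e) | half-spec (b + e) | odd (c + f) | half-spec (c + f) | h
    ... | false | p | false | q | false | r | _ =
      mid (half (a + d)) (half (b + e)) (half (c + f)) k l (trans p (double (half (a + d)))) (trans q (double (half (b + e)))) (trans r (double (half (c + f))))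
      where
      double : ∀ m → + 2 * m - + 0 ≡ m + m
      double = solve-∀

    -- Midpoints of q with points of L, iterated d times, reach a point violating the law.
    refutes : ℕ → List Pt → Pt → Bool
    refutes zero    L q = not (sparse q)
    refutes (suc d) L q = not (sparse q) ∨ any (λ r → evenSum r q ∧ refutes d L (midpoint r q)) L

    refutes-sound : ∀ d L q → All K L → K q → ¬ (refutes d L q ≡ true)
    refutes-sound zero    L q _  k h rewrite law k with () ← h
    refutes-sound (suc d) L q ks k h rewrite law k = search L ks h
      where
      search : ∀ M → All K M → ¬ (any (λ r → evenSum r q ∧ refutes d L (midpoint r q)) M ≡ true)
      search (r ∷ M) (l ∷ ls) h with evenSum r q in e | refutes d L (midpoint r q) in f
      ... | true  | true  = refutes-sound d L (midpoint r q) ks (midpoint∈ r q l k e) f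
      ... | true  | false = search M ls h
      ... | false | _     = search M ls h

    Closed : ℕ → List Pt → List Pt → Pt → Pt → Set
    Closed d L exits p e = (2[ p ]- e ∈ L) ⊎ (2[ p ]- e ∈ exits) ⊎ (refutes d L (2[ p ]- e) ≡ true)

    closed? : ∀ d L exits → Dec (All (λ p → All (Closed d L exits p) vertices) L)
    closed? d L exits = All.all? (λ p → All.all? (λ e →
      (2[ p ]- e ∈? L) ⊎-dec ((2[ p ]- e ∈? exits) ⊎-dec (refutes d L (2[ p ]- e) Bool.≟ true))) vertices) L

    -- For a concrete list the check is an evaluation: every step from `L` along a vertex stays in
    -- `L`, hits a listed exit, or is refuted by at most `d` successive midpoints with points of
    -- `L`. The two `True` arguments are filled in by computation.
    finite-closure : ∀ d L exits → All K L → {_ : True (All.all? (_∈? L) vertices)} →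
                     {_ : True (closed? d L exits)} → ∀ q → K q → q ∈ L ⊎ (∃[ r ] (r ∈ exits × K r))
    finite-closure d L exits ks {base} {check} = closure (_∈ L) (λ V → All.lookup (toWitness base) (position V)) step
      where
      position : ∀ {e} → Vertex e → e ∈ vertices
      position O = here refl
      position Z = there (here refl)
      position u = there (there (here refl))
      position v = there (there (there (here refl)))
      step : ∀ p {e} → Vertex e → p ∈ L → K p → K (2[ p ]- e) → (2[ p ]- e ∈ L) ⊎ (∃[ r ] (r ∈ exits × K r))
      step p V m _ k with All.lookup (All.lookup (toWitness check) m) (position V)
      ... | inj₁ m′        = inj₁ m′
      ... | inj₂ (inj₁ m′) = inj₂ (_ , m′ , k)
      ... | inj₂ (inj₂ h)  = ⊥-elim (refutes-sound d L _ ks k h)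

    clash : ∀ {A : Set} {p} → K p → sparse p ≡ false → A
    clash k e with () ← trans (sym (law k)) e

    -- Infinite descent on the distance: by the law both points have even first coordinate, so their
    -- midpoint is integral, lies in `K` on the same line, and halves the distance.
    rigid : ∀ b c → odd b ∨ odd c ≡ true → ∀ x y → K ⟨ x , b , c ⟩ → K ⟨ y , b , c ⟩ → x ≡ y
    rigid b c anchor = λ x y k l → difference x y (vanish (y - x) x k (subst (λ t → K ⟨ t , b , c ⟩) (add x y) l) (<-wellFounded _))
      where
      add : ∀ x y → y ≡ x + (y - x)
      add = solve-∀
      cancel : ∀ x y → x ≡ y - (y - x)
      cancel = solve-∀
      difference : ∀ x y → y - x ≡ + 0 → x ≡ y
      difference x y e = trans (cancel x y) (trans (cong (λ t → y - t) e) (ℤP.+-identityʳ y))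
      midˣ : ∀ x m → x + (x + (+ 2 * m - + 0)) ≡ (x + m) + (x + m)
      midˣ = solve-∀
      split : ∀ m n → (+ 2 * m - + 0) + (+ 2 * n - + 1) ≡ + 2 * (m + n) - + 1
      split = solve-∀
      vanish : ∀ n x → K ⟨ x , b , c ⟩ → K ⟨ x + n , b , c ⟩ → Acc ℕ._<_ ∣ n ∣ → n ≡ + 0
      vanish n x k l (acc rs)
        with odd n | halve n | odd x | halve x | sparse-even x b c anchor (law k) | sparse-even (x + n) b c anchor (law l)
      ... | _ | 2m-1 n′ | _ | 2m x′ | _ | e with () ← trans (sym e) (trans (cong odd (split x′ n′)) (odd-2m-1 (x′ + n′)))
      ... | _ | 2m n′ | _ | _ | _ | _ with shrink-even n′
      ... | inj₁ refl = refl
      ... | inj₂ lt   = cong (λ m → + 2 * m - + 0) (vanish n′ x k (mid (x + n′) b c k l (midˣ x n′) refl refl)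
        (rs (subst (λ m → ∣ n′ ∣ ℕ.< ∣ m ∣) (sym (ℤP.+-identityʳ (+ 2 * n′))) lt)))

    -- The midpoint of `2p` with a spike point at distance two from O is a neighbour of `p` on the
    -- parallel to OZ, while `p` itself is in `K` by halving; this contradicts `rigid`.
    noO : ∀ p → Anchored p → K (2[ p ]- Oₚ) → ¬ (K ⟨ + 2 , + 0 , + 0 ⟩ ⊎ K ⟨ -2ℤ , + 0 , + 0 ⟩)
    noO p@(⟨ a , b , c ⟩) anchor k (inj₁ l) = step-apart a (+ 1) (λ ())
      (rigid b c anchor a (a + + 1) (parent p O k) (mid (a + + 1) b c k l (next a) (2m-d+d b (+ 0)) (2m-d+d c (+ 0))))
      where
      next : ∀ a → + 2 * a - + 0 + + 2 ≡ (a + + 1) + (a + + 1)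
      next = solve-∀
    noO p@(⟨ a , b , c ⟩) anchor k (inj₂ l) = step-apart a -1ℤ (λ ())
      (rigid b c anchor a (a + -1ℤ) (parent p O k) (mid (a + -1ℤ) b c k l (next a) (2m-d+d b (+ 0)) (2m-d+d c (+ 0))))
      where
      next : ∀ a → + 2 * a - + 0 + -2ℤ ≡ (a + -1ℤ) + (a + -1ℤ)
      next = solve-∀

    -- The same with Z as centre: -1 and 3 are the spike points at distance two from Z.
    noZ : ∀ p → Anchored p → K (2[ p ]- Zₚ) → ¬ (K ⟨ -1ℤ , + 0 , + 0 ⟩ ⊎ K ⟨ + 3 , + 0 , + 0 ⟩)
    noZ p@(⟨ a , b , c ⟩) anchor k (inj₁ l) = step-apart a -1ℤ (λ ())
      (rigid b c anchor a (a + -1ℤ) (parent p Z k) (mid (a + -1ℤ) b c k l (next a) (2m-d+d b (+ 0)) (2m-d+d c (+ 0))))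
      where
      next : ∀ a → + 2 * a - + 1 + -1ℤ ≡ (a + -1ℤ) + (a + -1ℤ)
      next = solve-∀
    noZ p@(⟨ a , b , c ⟩) anchor k (inj₂ l) = step-apart a (+ 1) (λ ())
      (rigid b c anchor a (a + + 1) (parent p Z k) (mid (a + + 1) b c k l (next a) (2m-d+d b (+ 0)) (2m-d+d c (+ 0))))
      where
      next : ∀ a → + 2 * a - + 1 + + 3 ≡ (a + + 1) + (a + + 1)
      next = solve-∀

    module _ (ku : K ⟨ + 0 , -1ℤ , + 0 ⟩) where

      private
        spike-u : ∀ a → K ⟨ + 2 * a - + 0 , -1ℤ , + 0 ⟩ → a ≡ + 0
        spike-u a k = ℤP.*-cancelˡ-≡ (+ 2) a (+ 0)
          (trans (sym (ℤP.+-identityʳ (+ 2 * a))) (rigid -1ℤ (+ 0) refl (+ 2 * a - + 0) (+ 0) k ku))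

        -3u : K ⟨ + 0 , -[1+ 2 ] , + 0 ⟩ → K ⟨ + 0 , -2ℤ , + 0 ⟩
        -3u k = mid (+ 0) -2ℤ (+ 0) k ku refl refl refl

        v↛u : {A : Set} → K ⟨ + 0 , -1ℤ , + 2 ⟩ → A
        v↛u k = clash (mid (+ 0) -1ℤ (+ 1) k ku refl refl refl) refl

        x+0 : ∀ a → + 2 * a - + 0 + + 0 ≡ a + a
        x+0 = solve-∀
        0+x : ∀ a → + 0 + (+ 2 * a - + 0) ≡ a + a
        0+x = solve-∀

      -- The two ways of adding a point to F̃₂: reflecting v in a point of the spike, or reflecting
      -- it in u or in -u.
      F₃-extension F₄-extension : Set
      F₃-extension = ∃[ k ] (K ⟨ k , + 0 , + 0 ⟩ × K (2[ ⟨ k , + 0 , + 0 ⟩ ]- vₚ))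
      F₄-extension = K ⟨ + 0 , + 2 , -1ℤ ⟩ ⊎ K ⟨ + 0 , -2ℤ , -1ℤ ⟩

      -- A step from the spike along u can only start at O, by `rigid` against -u; the step from v
      -- along u yields a point with two odd coordinates. What remains besides the two extensions
      -- are steps of side points away from O or Z, and these are left to the caller.
      F₂-closure : {E : Set} → (∀ {r} → Side vₚ r → K (2[ r ]- Oₚ) → E) → (∀ {r} → Side vₚ r → K (2[ r ]- Zₚ) → E) →
                   ∀ q → K q → Spiked vₚ q ⊎ (F₃-extension ⊎ F₄-extension ⊎ E)
      F₂-closure {E} hO hZ = closure (Spiked vₚ) (λ { O → spike _ ; Z → spike _ ; u → u ; v → v }) step
        where
        step : ∀ p {e} → Vertex e → Spiked vₚ p → K p → K (2[ p ]- e) →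
               Spiked vₚ (2[ p ]- e) ⊎ (F₃-extension ⊎ F₄-extension ⊎ E)
        step _ O (spike a) _ k = inj₁ (spike _)
        step _ Z (spike a) _ k = inj₁ (spike _)
        step _ u (spike a) _ k with refl ← spike-u a k = inj₁ u′
        step _ v (spike a) l k = inj₂ (inj₁ (a , l , k))
        step _ O u _ k = inj₂ (inj₂ (inj₂ (hO u k)))
        step _ Z u _ k = inj₂ (inj₂ (inj₂ (hZ u k)))
        step _ u u _ k = inj₁ u
        step _ v u _ k = inj₂ (inj₂ (inj₁ (inj₁ k)))
        step _ O u′ _ k = inj₂ (inj₂ (inj₂ (hO u′ k)))
        step _ Z u′ _ k = inj₂ (inj₂ (inj₂ (hZ u′ k)))
        -- The step leads to -3u; its midpoint with -u is -2u, which is the step of -u away from O.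
        step _ u u′ _ k = inj₂ (inj₂ (inj₂ (hO u′ (-3u k))))
        step _ v u′ _ k = inj₂ (inj₂ (inj₁ (inj₂ k)))
        step _ O v _ k = inj₂ (inj₂ (inj₂ (hO v k)))
        step _ Z v _ k = inj₂ (inj₂ (inj₂ (hZ v k)))
        step _ u v _ k = v↛u k
        step _ v v _ k = inj₁ v
        step _ O w _ k = inj₂ (inj₂ (inj₂ (hO v k)))
        step _ Z w _ k = inj₂ (inj₂ (inj₂ (hZ v k)))
        step _ u w _ k = v↛u k
        step _ v w _ k = inj₁ v

      F₃-closure : ∀ {E : Set} k → let w₃ = 2[ ⟨ k , + 0 , + 0 ⟩ ]- vₚ in K w₃ →
                   (∀ {r} → Side w₃ r → K (2[ r ]- Oₚ) → E) → (∀ {r} → Side w₃ r → K (2[ r ]- Zₚ) → E) →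
                   ∀ q → K q → Spiked w₃ q ⊎ E
      F₃-closure {E} k kw hO hZ = closure (Spiked w₃) (λ { O → spike _ ; Z → spike _ ; u → u ; v → v }) step
        where
        w₃ : Pt
        w₃ = 2[ ⟨ k , + 0 , + 0 ⟩ ]- vₚ
        triple : ∀ k → + 2 * (+ 2 * k - + 0) - + 0 + (+ 2 * k - + 0) ≡ + 3 * k + + 3 * k
        triple = solve-∀
        quadruple : ∀ k → + 2 * (+ 2 * k - + 0) - + 0 + + 0 ≡ (+ 2 * k - + 0) + (+ 2 * k - + 0)
        quadruple = solve-∀
        even-half : ∀ m → + 3 * (+ 2 * m - + 0) + + 0 ≡ + 3 * m + + 3 * m
        even-half = solve-∀
        odd-half : ∀ m → + 3 * (+ 2 * m - + 1) + + 1 ≡ (+ 3 * m - + 1) + (+ 3 * m - + 1)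
        odd-half = solve-∀
        even-zero : ∀ m → + 3 * m ≡ + 2 * (+ 2 * m - + 0) - + 0 → m ≡ + 0
        even-zero m e = trans (first m) (trans (cong (_- + 3 * m) (sym e)) (ℤP.+-inverseʳ (+ 3 * m)))
          where
          first : ∀ m → m ≡ + 2 * (+ 2 * m - + 0) - + 0 - + 3 * m
          first = solve-∀
        odd-one : ∀ m → + 3 * m - + 1 ≡ + 2 * (+ 2 * m - + 1) - + 0 → m ≡ + 1
        odd-one m e = trans (first m) (trans (cong (λ t → t - (+ 3 * m - + 1) + + 1) (sym e)) (last m))
          where
          first : ∀ m → m ≡ + 2 * (+ 2 * m - + 1) - + 0 - (+ 3 * m - + 1) + + 1
          first = solve-∀
          last : ∀ m → + 3 * m - + 1 - (+ 3 * m - + 1) + + 1 ≡ + 1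
          last = solve-∀
        -- The point ⟨3k,0,-2⟩ is halved towards O or Z according to the parity of k and lands on
        -- the parallel to OZ through w₃. Rigidity then forces k = 0 or k = 1, where the given point
        -- is the step of w₃ away from O or from Z.
        beyond : ∀ k → K (2[ ⟨ k , + 0 , + 0 ⟩ ]- vₚ) → K ⟨ + 3 * k , + 0 , -2ℤ ⟩ →
                 (k ≡ + 0 × K ⟨ + 0 , + 0 , -2ℤ ⟩) ⊎ (k ≡ + 1 × K ⟨ + 3 , + 0 , -2ℤ ⟩)
        beyond k kw l with odd k | halve k
        ... | _ | 2m m with refl ← even-zero m (rigid (+ 0) -1ℤ refl _ _ (mid (+ 3 * m) (+ 0) -1ℤ l (vertex O) (even-half m) refl refl) kw) = inj₁ (refl , l)
        ... | _ | 2m-1 m with refl ← odd-one m (rigid (+ 0) -1ℤ refl _ _ (mid (+ 3 * m - + 1) (+ 0) -1ℤ l (vertex Z) (odd-half m) refl refl) kw) = inj₂ (refl , l)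
        w-v : K (2[ w₃ ]- vₚ) → E
        w-v l with beyond k kw (mid (+ 3 * k) (+ 0) -2ℤ l kw (triple k) refl refl)
        ... | inj₁ (refl , l′) = hO w l′
        ... | inj₂ (refl , l′) = hZ w l′
        step : ∀ p {e} → Vertex e → Spiked w₃ p → K p → K (2[ p ]- e) → Spiked w₃ (2[ p ]- e) ⊎ E
        step _ O (spike a) _ l = inj₁ (spike _)
        step _ Z (spike a) _ l = inj₁ (spike _)
        step _ u (spike a) _ l with refl ← spike-u a l = inj₁ u′
        step _ v (spike a) _ l = inj₁ (subst (λ t → Spiked w₃ ⟨ t , + 0 , -1ℤ ⟩) (sym (rigid (+ 0) -1ℤ refl _ _ l kw)) w)
        step _ O u _ l = inj₂ (hO u l)
        step _ Z u _ l = inj₂ (hZ u l)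
        step _ u u _ l = inj₁ u
        step _ v u _ l = clash (mid k (+ 1) -1ℤ l kw (0+x k) refl refl) refl
        step _ O u′ _ l = inj₂ (hO u′ l)
        step _ Z u′ _ l = inj₂ (hZ u′ l)
        step _ u u′ _ l = inj₂ (hO u′ (-3u l))
        step _ v u′ _ l = clash (mid k -1ℤ -1ℤ l kw (0+x k) refl refl) refl
        step _ O v _ l = inj₂ (hO v l)
        step _ Z v _ l = inj₂ (hZ v l)
        step _ u v _ l = v↛u l
        step _ v v _ l = inj₁ v
        step _ O w _ l = inj₂ (hO w l)
        step _ Z w _ l = inj₂ (hZ w l)
        step _ u w _ l = clash (mid (+ 2 * k - + 0) -1ℤ -1ℤ l ku (quadruple k) refl refl) refl
        step _ v w _ l = inj₂ (w-v l)

      -- Each step that is refuted here leads, by midpoints with -u or w₄, to a point whose second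
      -- and third coordinates are both odd.
      F₄-closure : {E : Set} → let w₄ = ⟨ + 0 , + 2 , -1ℤ ⟩ in K w₄ →
                   (∀ {r} → Side w₄ r → K (2[ r ]- Oₚ) → E) → (∀ {r} → Side w₄ r → K (2[ r ]- Zₚ) → E) →
                   ∀ q → K q → Spiked w₄ q ⊎ E
      F₄-closure {E} kw hO hZ = closure (Spiked w₄) (λ { O → spike _ ; Z → spike _ ; u → u ; v → v }) step
        where
        w₄ : Pt
        w₄ = ⟨ + 0 , + 2 , -1ℤ ⟩
        w↛u : {A : Set} → K ⟨ + 0 , + 3 , -2ℤ ⟩ → A
        w↛u l = clash (mid (+ 0) (+ 1) -1ℤ l ku refl refl refl) refl
        -v : {A : Set} → K ⟨ + 0 , + 0 , -1ℤ ⟩ → A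
        -v l = clash (mid (+ 0) (+ 1) -1ℤ l kw refl refl refl) refl
        step : ∀ p {e} → Vertex e → Spiked w₄ p → K p → K (2[ p ]- e) → Spiked w₄ (2[ p ]- e) ⊎ E
        step _ O (spike a) _ l = inj₁ (spike _)
        step _ Z (spike a) _ l = inj₁ (spike _)
        step _ u (spike a) _ l with refl ← spike-u a l = inj₁ u′
        step _ v (spike a) _ l = clash (mid a (+ 1) -1ℤ l kw (x+0 a) refl refl) refl
        step _ O u _ l = inj₂ (hO u l)
        step _ Z u _ l = inj₂ (hZ u l)
        step _ u u _ l = inj₁ u
        step _ v u _ l = inj₁ w
        step _ O u′ _ l = inj₂ (hO u′ l)
        step _ Z u′ _ l = inj₂ (hZ u′ l)
        step _ u u′ _ l = inj₂ (hO u′ (-3u l))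
        step _ v u′ _ l = -v (mid (+ 0) (+ 0) -1ℤ l kw refl refl refl)
        step _ O v _ l = inj₂ (hO v l)
        step _ Z v _ l = inj₂ (hZ v l)
        step _ u v _ l = v↛u l
        step _ v v _ l = inj₁ v
        step _ O w _ l = inj₂ (hO w l)
        step _ Z w _ l = inj₂ (hZ w l)
        step _ u w _ l = w↛u l
        step _ v w _ l = w↛u (mid (+ 0) (+ 3) -2ℤ l kw refl refl refl)

open Configurations

-- Frames: coordinates in which the chosen tetrahedron is standard.

module Frames where

  open import Data.Integer.Tactic.RingSolver using (solve-∀)

  -- The conclusion of `latticePoint` as a property of a set; in this integral form it passes to
  -- preimages under affine maps, hence to coordinates.
  Convex : (Pt → Set) → Set
  Convex A = ∀ N ls m → All (λ lp → (+ 0 ℤ.≤ proj₁ lp) × A (proj₂ lp)) ls →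
             intSum ls ≡ + suc N → intComb ls ≡ (+ suc N) ⊙ m → A m

  convex-preimage : ∀ {A} f → Convex A → Convex (λ p → A (applyℤ f p))
  convex-preimage {A} f@(aff r₁ r₂ r₃ t) convex N ls m hs sum≡ comb≡ =
    convex N (push ls) (applyℤ f m) (pushed ls hs) (trans (push-sum ls) sum≡)
      (trans (push-comb ls) (trans (cong₂ (λ p n → lin p ⊕ (n ⊙ t)) comb≡ sum≡) (lin-⊙ (+ suc N) m)))
    where
    push : List (ℤ × Pt) → List (ℤ × Pt)
    push = map (λ lp → proj₁ lp , applyℤ f (proj₂ lp))
    lin : Pt → Pt
    lin p = ⟨ dot r₁ p , dot r₂ p , dot r₃ p ⟩
    pushed : ∀ ls → All (λ lp → (+ 0 ℤ.≤ proj₁ lp) × A (applyℤ f (proj₂ lp))) ls →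
             All (λ lp → (+ 0 ℤ.≤ proj₁ lp) × A (proj₂ lp)) (push ls)
    pushed []       []       = []
    pushed (_ ∷ ls) (h ∷ hs) = h ∷ pushed ls hs
    push-sum : ∀ ls → intSum (push ls) ≡ intSum ls
    push-sum []             = refl
    push-sum ((l , _) ∷ ls) = cong (λ t → l + t) (push-sum ls)
    step : ∀ a b c l d e f g h i t s → l * (a * d + b * e + c * f + t) + ((a * g + b * h + c * i) + s * t) ≡
           (a * (l * d + g) + b * (l * e + h) + c * (l * f + i)) + (l + s) * t
    step = solve-∀
    zero-comb : ∀ a b c t → + 0 ≡ a * + 0 + b * + 0 + c * + 0 + + 0 * t
    zero-comb = solve-∀
    push-comb : ∀ ls → intComb (push ls) ≡ lin (intComb ls) ⊕ (intSum ls ⊙ t)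
    push-comb [] = V3-≡ (zero-comb (x r₁) (y r₁) (z r₁) (x t)) (zero-comb (x r₂) (y r₂) (z r₂) (y t))
      (zero-comb (x r₃) (y r₃) (z r₃) (z t))
    push-comb ((l , ⟨ d , e , k ⟩) ∷ ls) = trans (cong ((l ⊙ applyℤ f ⟨ d , e , k ⟩) ⊕_) (push-comb ls))
      (V3-≡ (row r₁ (x t)) (row r₂ (y t)) (row r₃ (z t)))
      where
      row : ∀ r τ → l * (dot r ⟨ d , e , k ⟩ + τ) + (dot r (intComb ls) + intSum ls * τ) ≡
            dot r ((l ⊙ ⟨ d , e , k ⟩) ⊕ intComb ls) + (l + intSum ls) * τ
      row ⟨ a , b , c ⟩ τ = step a b c l d e k (x (intComb ls)) (y (intComb ls)) (z (intComb ls)) τ (intSum ls)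
    scaled : ∀ a b c n d e f t → a * (n * d) + b * (n * e) + c * (n * f) + n * t ≡ n * (a * d + b * e + c * f + t)
    scaled = solve-∀
    lin-⊙ : ∀ n m → lin (n ⊙ m) ⊕ (n ⊙ t) ≡ n ⊙ applyℤ f m
    lin-⊙ n ⟨ d , e , k ⟩ = V3-≡ (scaled (x r₁) (y r₁) (z r₁) n d e k (x t)) (scaled (x r₂) (y r₂) (z r₂) n d e k (y t))
      (scaled (x r₃) (y r₃) (z r₃) n d e k (z t))

  convex-mid : ∀ {A} → Convex A → ∀ {p q} m → p ⊕ q ≡ m ⊕ m → A p → A q → A m
  convex-mid convex {⟨ a , b , c ⟩} {⟨ d , e , f ⟩} m@(⟨ i , j , k ⟩) eq hp hq =
    convex 1 ((+ 1 , ⟨ a , b , c ⟩) ∷ (+ 1 , ⟨ d , e , f ⟩) ∷ []) m ((+≤+ z≤n , hp) ∷ (+≤+ z≤n , hq) ∷ []) refl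
      (V3-≡ (trans (left a d) (trans (cong x eq) (right i))) (trans (left b e) (trans (cong y eq) (right j)))
        (trans (left c f) (trans (cong z eq) (right k))))
    where
    left : ∀ a d → + 1 * a + (+ 1 * d + + 0) ≡ a + d
    left = solve-∀
    right : ∀ i → i + i ≡ + 2 * i
    right = solve-∀

  ≤⇒∃ : ∀ {i j} → i ℤ.≤ j → ∃[ n ] j ≡ i + + n
  ≤⇒∃ {i} {j} i≤j = ∣ j - i ∣ , trans (add i j) (cong (λ t → i + t) (sym (ℤP.0≤i⇒+∣i∣≡i (ℤP.i≤j⇒0≤j-i i≤j))))
    where
    add : ∀ i j → j ≡ i + (j - i)
    add = solve-∀

  convex-between : ∀ {A} → Convex A → ∀ {i j} m → A ⟨ i , + 0 , + 0 ⟩ → A ⟨ j , + 0 , + 0 ⟩ →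
                   i ℤ.≤ m → m ℤ.≤ j → A ⟨ m , + 0 , + 0 ⟩
  convex-between {A} convex {i} m hi hj i≤m m≤j with ≤⇒∃ i≤m | ≤⇒∃ m≤j
  ... | k , refl | l , refl = go (k ℕ.+ l) refl
    where
    total : ∀ k l → l + (k + + 0) ≡ k + l
    total = solve-∀
    centre : ∀ i k l → l * i + (k * (i + k + l) + + 0) ≡ (k + l) * (i + k)
    centre = solve-∀
    vanish : ∀ k l n → l * + 0 + (k * + 0 + + 0) ≡ n * + 0
    vanish = solve-∀
    go : ∀ n → k ℕ.+ l ≡ n → A ⟨ i + + k , + 0 , + 0 ⟩
    -- With `k + l = 0` there is no total to divide by; then the point is the left end itself.
    go zero    e = subst (λ t → A ⟨ t , + 0 , + 0 ⟩)
      (trans (sym (ℤP.+-identityʳ i)) (cong (λ t → i + + t) (sym (ℕP.m+n≡0⇒m≡0 k e)))) hi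
    go (suc N) e = convex N ((+ l , ⟨ i , + 0 , + 0 ⟩) ∷ (+ k , ⟨ i + + k + + l , + 0 , + 0 ⟩) ∷ []) ⟨ i + + k , + 0 , + 0 ⟩
      ((+≤+ z≤n , hi) ∷ (+≤+ z≤n , hj) ∷ []) (trans (total (+ k) (+ l)) (cong +_ e))
      (V3-≡ (trans (centre i (+ k) (+ l)) (cong (λ t → + t * (i + + k)) e)) (vanish (+ k) (+ l) (+ suc N)) (vanish (+ k) (+ l) (+ suc N)))

  _∘ₐ_ : Aff → Aff → Aff
  aff r₁ r₂ r₃ t ∘ₐ aff s₁ s₂ s₃ o =
    aff (row r₁) (row r₂) (row r₃) (⟨ dot r₁ o , dot r₂ o , dot r₃ o ⟩ ⊕ t)
    where
    row : Pt → Pt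
    row r = (x r ⊙ s₁) ⊕ ((y r ⊙ s₂) ⊕ (z r ⊙ s₃))

  ∘ₐ-apply : ∀ f g p → applyℤ (f ∘ₐ g) p ≡ applyℤ f (applyℤ g p)
  ∘ₐ-apply (aff r₁ r₂ r₃ t) (aff s₁ s₂ s₃ o) p = V3-≡ (component r₁ (x t)) (component r₂ (y t)) (component r₃ (z t))
    where
    identity : ∀ a b c d e f g h i j k l m n o p q r τ →
      (a * d + (b * g + c * j)) * m + (a * e + (b * h + c * k)) * n + (a * f + (b * i + c * l)) * o + ((a * p + b * q + c * r) + τ) ≡
      a * (d * m + e * n + f * o + p) + b * (g * m + h * n + i * o + q) + c * (j * m + k * n + l * o + r) + τ
    identity = solve-∀
    component : ∀ ρ τ → _ ≡ _
    component ρ τ = identity (x ρ) (y ρ) (z ρ) (x s₁) (y s₁) (z s₁) (x s₂) (y s₂) (z s₂) (x s₃) (y s₃) (z s₃)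
      (x p) (y p) (z p) (x o) (y o) (z o) τ

  record Uni : Set where
    no-eta-equality
    field
      fwd bwd : Aff
      fwd-bwd : ∀ p → applyℤ fwd (applyℤ bwd p) ≡ p
      bwd-fwd : ∀ p → applyℤ bwd (applyℤ fwd p) ≡ p
  open Uni

  opaque
    -- Opaque so that stacked frame changes do not unfold into nested matrix products; the two
    -- composition laws below are used instead.
    _∘ᵤ_ : Uni → Uni → Uni
    g ∘ᵤ h = record
      { fwd = fwd g ∘ₐ fwd h
      ; bwd = bwd h ∘ₐ bwd g
      ; fwd-bwd = λ p → trans (∘ₐ-apply (fwd g) (fwd h) _) (trans (cong (applyℤ (fwd g))
          (trans (cong (applyℤ (fwd h)) (∘ₐ-apply (bwd h) (bwd g) p)) (fwd-bwd h _))) (fwd-bwd g p))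
      ; bwd-fwd = λ p → trans (∘ₐ-apply (bwd h) (bwd g) _) (trans (cong (applyℤ (bwd h))
          (trans (cong (applyℤ (bwd g)) (∘ₐ-apply (fwd g) (fwd h) p)) (bwd-fwd g _))) (bwd-fwd h p))
      }

    ∘ᵤ-fwd : ∀ g h p → applyℤ (fwd (g ∘ᵤ h)) p ≡ applyℤ (fwd g) (applyℤ (fwd h) p)
    ∘ᵤ-fwd g h p = ∘ₐ-apply (fwd g) (fwd h) p

    ∘ᵤ-bwd : ∀ g h p → applyℤ (bwd (g ∘ᵤ h)) p ≡ applyℤ (bwd h) (applyℤ (bwd g) p)
    ∘ᵤ-bwd g h p = ∘ₐ-apply (bwd h) (bwd g) p

  -- The point with coordinates ⟨ a , b , c ⟩ with respect to the frame
  -- O = (0,0,0), Z = (0,0,1), u = (1,-1,0), v = (-1,-1,1) of the paper's F̃ᵢ.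
  combₐ : Aff
  combₐ = aff (pt (+ 0) (+ 1) -1ℤ) (pt (+ 0) -1ℤ -1ℤ) (pt (+ 1) (+ 0) (+ 1)) 𝟎

  -- The determinant is -2, and the image is the sublattice of points whose first two coordinates
  -- have an even sum.
  comb : Pt → Pt
  comb = applyℤ combₐ

  -- A record and not a synonym, so that `g` and `q` can be recovered by unification.
  record Seen (S : List Pt) (g : Uni) (q : Pt) : Set where
    constructor seen
    field lattice : LatPt S (applyℤ (fwd g) (comb q))
  open Seen

  seen-convex : ∀ S g → Convex (Seen S g)
  seen-convex S g N ls m hs s t = seen (convex-preimage {λ p → LatPt S (applyℤ (fwd g) p)} combₐ
    (convex-preimage (fwd g) latticePoint) N ls m (All.map (λ h → proj₁ h , lattice (proj₂ h)) hs) s t)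

  -- The four vertices are lattice points of the polytope, and `cover` says that the coset of
  -- half-integral frame coordinates contains none.
  record Frame (S : List Pt) (g : Uni) : Set where
    field
      vertex : ∀ {e} → Vertex e → Seen S g e
      cover  : ∀ p → LatPt S p → ∃[ q ] p ≡ applyℤ (fwd g) (comb q)

  comb-coordinates : ∀ a b c → comb ⟨ a , b , c ⟩ ≡ ⟨ b - c , - b - c , a + c ⟩
  comb-coordinates a b c = V3-≡ (first a b c) (second a b c) (third a b c)
    where
    first : ∀ a b c → + 0 * a + + 1 * b + -1ℤ * c + + 0 ≡ b - c
    first = solve-∀
    second : ∀ a b c → + 0 * a + -1ℤ * b + -1ℤ * c + + 0 ≡ - b - c
    second = solve-∀
    third : ∀ a b c → + 1 * a + + 0 * b + + 1 * c + + 0 ≡ a + c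
    third = solve-∀

  false≢true : ¬ (false ≡ true)
  false≢true ()

  -- The image under comb of ⟨ α - ½ , β - ½ , γ - ½ ⟩.
  halfway : ℤ → ℤ → ℤ → Pt
  halfway α β γ = ⟨ β - γ , + 1 - β - γ , α + γ - + 1 ⟩

  halfway-mid : ∀ p q α β γ → p ⊕ q ≡ ⟨ + 2 * α - + 1 , + 2 * β - + 1 , + 2 * γ - + 1 ⟩ →
                comb p ⊕ comb q ≡ halfway α β γ ⊕ halfway α β γ
  halfway-mid ⟨ a , b , c ⟩ ⟨ d , e , f ⟩ α β γ eq =
    trans (cong₂ _⊕_ (comb-coordinates a b c) (comb-coordinates d e f))
      (V3-≡ (trans (left₁ b c e f) (trans (cong₂ _-_ (cong y eq) (cong z eq)) (right₁ β γ)))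
            (trans (left₂ b c e f) (trans (cong₂ (λ s t → - s - t) (cong y eq) (cong z eq)) (right₂ β γ)))
            (trans (left₃ a c d f) (trans (cong₂ _+_ (cong x eq) (cong z eq)) (right₃ α γ))))
    where
    left₁ : ∀ b c e f → (b - c) + (e - f) ≡ (b + e) - (c + f)
    left₁ = solve-∀
    right₁ : ∀ β γ → (+ 2 * β - + 1) - (+ 2 * γ - + 1) ≡ (β - γ) + (β - γ)
    right₁ = solve-∀
    left₂ : ∀ b c e f → (- b - c) + (- e - f) ≡ - (b + e) - (c + f)
    left₂ = solve-∀
    right₂ : ∀ β γ → - (+ 2 * β - + 1) - (+ 2 * γ - + 1) ≡ (+ 1 - β - γ) + (+ 1 - β - γ)
    right₂ = solve-∀
    left₃ : ∀ a c d f → (a + c) + (d + f) ≡ (a + d) + (c + f)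
    left₃ = solve-∀
    right₃ : ∀ α γ → (+ 2 * α - + 1) + (+ 2 * γ - + 1) ≡ (α + γ - + 1) + (α + γ - + 1)
    right₃ = solve-∀

  -- The first two coordinates have an odd sum on one side and an even sum on the other.
  halfway-not-comb : ∀ α β γ q → ¬ (halfway α β γ ≡ comb q)
  halfway-not-comb α β γ ⟨ i , j , k ⟩ eq = false≢true (trans (sym (2*m-odd (γ - k))) (cong odd
    (trans (sum β γ k) (trans (cong (λ t → + 1 - t - + 2 * k) (cong₂ _+_ (cong x eq′) (cong y eq′))) (parity j k)))))
    where
    eq′ : halfway α β γ ≡ ⟨ j - k , - j - k , i + k ⟩
    eq′ = trans eq (comb-coordinates i j k)
    sum : ∀ β γ k → + 2 * (γ - k) ≡ + 1 - ((β - γ) + (+ 1 - β - γ)) - + 2 * k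
    sum = solve-∀
    parity : ∀ j k → + 1 - ((j - k) + (- j - k)) - + 2 * k ≡ + 1
    parity = solve-∀

  module _ {S : List Pt} {g : Uni} (F : Frame S g) where
    open Frame F

    -- The midpoint of two such points lies in the empty coset of the sublattice.
    not-all-odd : ∀ p q α β γ → p ⊕ q ≡ ⟨ + 2 * α - + 1 , + 2 * β - + 1 , + 2 * γ - + 1 ⟩ → Seen S g p → Seen S g q → ⊥
    not-all-odd p q α β γ eq kp kq =
      let r , eq′ = cover (applyℤ (fwd g) (halfway α β γ))
                      (convex-mid {λ p → LatPt S (applyℤ (fwd g) p)} (convex-preimage (fwd g) latticePoint) (halfway α β γ) (halfway-mid p q α β γ eq) (lattice kp) (lattice kq))
      in halfway-not-comb α β γ r (trans (sym (bwd-fwd g _)) (trans (cong (applyℤ (bwd g)) eq′) (bwd-fwd g _)))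

    config : Config (Seen S g)
    config = record
      { mid     = λ m n o k l p q r → convex-mid (seen-convex S g) ⟨ m , n , o ⟩ (V3-≡ p q r) k l
      ; law     = λ {p} → lawful p
      ; vertex  = vertex
      ; between = convex-between (seen-convex S g)
      }
      where
      even+odd : ∀ m → + 2 * m - + 0 + + 1 ≡ + 2 * (m + + 1) - + 1
      even+odd = solve-∀
      odd+0 : ∀ m → + 2 * m - + 1 + + 0 ≡ + 2 * m - + 1
      odd+0 = solve-∀
      -- If at least two coordinates are odd, some vertex completes them to an all-odd sum: the
      -- vertex of the single even coordinate, or O if there is none.
      lawful : ∀ p → Seen S g p → sparse p ≡ true
      lawful ⟨ a , b , c ⟩ k with odd b | halve b | odd c | halve c | odd a | halve a
      ... | _ | 2m n   | _ | 2m o   | _ | _      = refl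
      ... | _ | 2m n   | _ | 2m-1 o | _ | 2m m   = refl
      ... | _ | 2m-1 n | _ | 2m o   | _ | 2m m   = refl
      ... | _ | 2m n   | _ | 2m-1 o | _ | 2m-1 m =
        ⊥-elim (not-all-odd _ uₚ m (n + + 1) o (V3-≡ (odd+0 m) (even+odd n) (odd+0 o)) k (vertex u))
      ... | _ | 2m-1 n | _ | 2m o   | _ | 2m-1 m =
        ⊥-elim (not-all-odd _ vₚ m n (o + + 1) (V3-≡ (odd+0 m) (odd+0 n) (even+odd o)) k (vertex v))
      ... | _ | 2m-1 n | _ | 2m-1 o | _ | 2m m   =
        ⊥-elim (not-all-odd _ Zₚ (m + + 1) n o (V3-≡ (even+odd m) (odd+0 n) (odd+0 o)) k (vertex Z))
      ... | _ | 2m-1 n | _ | 2m-1 o | _ | 2m-1 m =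
        ⊥-elim (not-all-odd _ Oₚ m n o (V3-≡ (odd+0 m) (odd+0 n) (odd+0 o)) k (vertex O))

open Frames

-- Changing frames, and transferring results between frames and polytopes.

module Moves where

  open import Data.Integer.Tactic.RingSolver using (solve-∀)

  open Uni
  open Seen

  idₐ : Aff
  idₐ = aff (pt (+ 1) (+ 0) (+ 0)) (pt (+ 0) (+ 1) (+ 0)) (pt (+ 0) (+ 0) (+ 1)) 𝟎

  idₐ-apply : ∀ p → applyℤ idₐ p ≡ p
  idₐ-apply ⟨ a , b , c ⟩ = V3-≡ (first a b c) (second a b c) (third a b c)
    where
    first : ∀ a b c → + 1 * a + + 0 * b + + 0 * c + + 0 ≡ a
    first = solve-∀
    second : ∀ a b c → + 0 * a + + 1 * b + + 0 * c + + 0 ≡ b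
    second = solve-∀
    third : ∀ a b c → + 0 * a + + 0 * b + + 1 * c + + 0 ≡ c
    third = solve-∀

  inverse : ∀ f g → f ∘ₐ g ≡ idₐ → ∀ p → applyℤ f (applyℤ g p) ≡ p
  inverse f g e p = trans (sym (∘ₐ-apply f g p)) (trans (cong (λ h → applyℤ h p) e) (idₐ-apply p))

  unimodular : ∀ f g → f ∘ₐ g ≡ idₐ → g ∘ₐ f ≡ idₐ → Uni
  unimodular f g e e′ = record { fwd = f ; bwd = g ; fwd-bwd = inverse f g e ; bwd-fwd = inverse g f e′ }

  -- A unimodular map of the ambient lattice together with its action in frame coordinates. Both are
  -- recorded because not every unimodular `ℓ` comes from an integral `h`: its linear part must fix
  -- ⟨1,1,1⟩ modulo 2.
  record Move : Set where
    field
      h         : Uni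
      ℓ ℓ⁻¹     : Aff
      forwards  : ∀ q → applyℤ (fwd h) (comb q) ≡ comb (applyℤ ℓ q)
      backwards : ∀ q → applyℤ (bwd h) (comb q) ≡ comb (applyℤ ℓ⁻¹ q)
  open Move

  commuting : ∀ f ℓ → f ∘ₐ combₐ ≡ combₐ ∘ₐ ℓ → ∀ q → applyℤ f (comb q) ≡ comb (applyℤ ℓ q)
  commuting f ℓ e q = trans (sym (∘ₐ-apply f combₐ q)) (trans (cong (λ h → applyℤ h q) e) (∘ₐ-apply combₐ ℓ q))

  involution : ∀ f ℓ → f ∘ₐ f ≡ idₐ → f ∘ₐ combₐ ≡ combₐ ∘ₐ ℓ → Move
  involution f ℓ e e′ = record
    { h = unimodular f f e e ; ℓ = ℓ ; ℓ⁻¹ = ℓ ; forwards = commuting f ℓ e′ ; backwards = commuting f ℓ e′ }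

  _⨟_ : Move → Move → Move
  m ⨟ n = record
    { h = h m ∘ᵤ h n ; ℓ = ℓ m ∘ₐ ℓ n ; ℓ⁻¹ = ℓ⁻¹ n ∘ₐ ℓ⁻¹ m
    ; forwards = λ q → trans (∘ᵤ-fwd (h m) (h n) (comb q)) (trans (cong (applyℤ (fwd (h m))) (forwards n q))
        (trans (forwards m (applyℤ (ℓ n) q)) (cong comb (sym (∘ₐ-apply (ℓ m) (ℓ n) q)))))
    ; backwards = λ q → trans (∘ᵤ-bwd (h m) (h n) (comb q)) (trans (cong (applyℤ (bwd (h n))) (backwards m q))
        (trans (backwards n (applyℤ (ℓ⁻¹ m) q)) (cong comb (sym (∘ₐ-apply (ℓ⁻¹ n) (ℓ⁻¹ m) q)))))
    }
  infixl 5 _⨟_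

  -- The three transpositions generate all permutations of the vertices; every later frame change is
  -- a composite of these four involutions.
  swapOZ swapZu swapuv reflect : Move
  swapOZ = involution
    (aff (pt (+ 1) (+ 0) (+ 0)) (pt (+ 0) (+ 1) (+ 0)) (pt -1ℤ (+ 0) -1ℤ) (pt (+ 0) (+ 0) (+ 1)))
    (aff (pt -1ℤ -1ℤ -1ℤ) (pt (+ 0) (+ 1) (+ 0)) (pt (+ 0) (+ 0) (+ 1)) (pt (+ 1) (+ 0) (+ 0))) refl refl
  swapZu = involution
    (aff (pt (+ 1) (+ 1) (+ 1)) (pt (+ 0) (+ 0) -1ℤ) (pt (+ 0) -1ℤ (+ 0)) 𝟎)
    (aff (pt (+ 0) (+ 1) (+ 0)) (pt (+ 1) (+ 0) (+ 0)) (pt (+ 0) (+ 0) (+ 1)) 𝟎) refl refl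
  swapuv = involution
    (aff (pt -1ℤ (+ 0) (+ 0)) (pt (+ 0) (+ 1) (+ 0)) (pt (+ 1) (+ 0) (+ 1)) 𝟎)
    (aff (pt (+ 1) (+ 0) (+ 0)) (pt (+ 0) (+ 0) (+ 1)) (pt (+ 0) (+ 1) (+ 0)) 𝟎) refl refl
  -- Replaces Z by its reflection in O.
  reflect = involution
    (aff (pt (+ 1) (+ 0) (+ 0)) (pt (+ 0) (+ 1) (+ 0)) (pt -1ℤ -1ℤ -1ℤ) 𝟎)
    (aff (pt -1ℤ (+ 0) (+ 0)) (pt (+ 0) (+ 1) (+ 0)) (pt (+ 0) (+ 0) (+ 1)) 𝟎) refl refl

  module _ {S : List Pt} {g : Uni} where

    into : ∀ m {q} → Seen S g (applyℤ (ℓ m) q) → Seen S (g ∘ᵤ h m) q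
    into m {q} (seen l) = seen (subst (LatPt S)
      (trans (cong (applyℤ (fwd g)) (sym (forwards m q))) (sym (∘ᵤ-fwd g (h m) (comb q)))) l)

    -- Only the new vertices have to be seen. A move preserves the sublattice, so `cover` carries
    -- over along `ℓ⁻¹`.
    reframe : Frame S g → ∀ m → (∀ {e} → Vertex e → Seen S g (applyℤ (ℓ m) e)) → Frame S (g ∘ᵤ h m)
    reframe F m vs = record { vertex = λ V → into m (vs V) ; cover = λ p l → covered p (Frame.cover F p l) }
      where
      covered : ∀ p → ∃[ q ] p ≡ applyℤ (fwd g) (comb q) → ∃[ q ] p ≡ applyℤ (fwd (g ∘ᵤ h m)) (comb q)
      covered p (q , e) = applyℤ (ℓ⁻¹ m) q , trans e (trans (cong (applyℤ (fwd g))
        (trans (sym (fwd-bwd (h m) (comb q))) (cong (applyℤ (fwd (h m))) (backwards m q))))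
        (sym (∘ᵤ-fwd g (h m) (comb (applyℤ (ℓ⁻¹ m) q)))))

    permute : Frame S g → ∀ m → (∀ {e} → Vertex e → Vertex (applyℤ (ℓ m) e)) → Frame S (g ∘ᵤ h m)
    permute F m vs = reframe F m (λ V → Frame.vertex F (vs V))

  Located : List Pt → Uni → (Pt → Set) → Set
  Located S g X = ∀ {s} → s ∈ S → ∃[ q ] (s ≡ applyℤ (fwd g) (comb q) × X q)

  -- A classification is run over the finite list of generators, and a single exit settles the
  -- outcome. This is where undecided hull membership is avoided.
  locate : ∀ {S g X} {E : Set} → Frame S g → (∀ q → Seen S g q → X q ⊎ E) → Located S g X ⊎ E
  locate {S} {g} {X} {E} F classify = go S id
    where
    go : ∀ R → (∀ {s} → s ∈ R → s ∈ S) →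
         (∀ {s} → s ∈ R → ∃[ q ] (s ≡ applyℤ (fwd g) (comb q) × X q)) ⊎ E
    go []      R⊆S = inj₁ λ ()
    go (s ∷ R) R⊆S with Frame.cover F s (generator (R⊆S (here refl)))
    ... | q , refl with classify q (seen (generator (R⊆S (here refl)))) | go R (R⊆S ∘ there)
    ... | inj₂ e | _      = inj₂ e
    ... | inj₁ _ | inj₂ e = inj₂ e
    ... | inj₁ p | inj₁ k = inj₁ λ { (here refl) → q , refl , p ; (there m) → k m }

  -- Both polytopes are read in frame coordinates, so the equivalence undoes `g` and then applies
  -- `τ`.
  realise : ∀ {S g X T} (τ : Uni) → Located S g X → (∀ {q} → X q → LatPt T (applyℤ (fwd τ) (comb q))) →
            (∀ {t} → t ∈ T → ∃[ q ] (Seen S g q × t ≡ applyℤ (fwd τ) (comb q))) → UnimodEquiv S T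
  realise {S} {g} {X} {T} τ located X⇒T T⇒S = unimodEquiv (fwd τ ∘ₐ bwd g) onto forward backward
    where
    f : ∀ p → applyℤ (fwd τ ∘ₐ bwd g) (applyℤ (fwd g) p) ≡ applyℤ (fwd τ) p
    f p = trans (∘ₐ-apply (fwd τ) (bwd g) _) (cong (applyℤ (fwd τ)) (bwd-fwd g p))
    onto : ∀ p → ∃[ q ] applyℤ (fwd τ ∘ₐ bwd g) q ≡ p
    onto p = applyℤ (fwd g) (applyℤ (bwd τ) p) , trans (f _) (fwd-bwd τ p)
    forward : ∀ {s} → s ∈ S → LatPt T (applyℤ (fwd τ ∘ₐ bwd g) s)
    forward m with located m
    ... | q , refl , p = subst (LatPt T) (sym (f (comb q))) (X⇒T p)
    backward : ∀ {t} → t ∈ T → ∃[ s ] (LatPt S s × applyℤ (fwd τ ∘ₐ bwd g) s ≡ t)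
    backward m with T⇒S m
    ... | q , seen l , refl = applyℤ (fwd g) (comb q) , l , f (comb q)

  -- A coordinate of the frame is pulled back along `bwd g` to a functional with linear part `r`;
  -- the points `a` and `b` witness that it is not constant, hence that `r` is not zero.
  wide-coordinate : ∀ {S g X} → WidthGt1 S → Located S g X → ∀ r t (π : Pt → ℤ) →
                    (∀ p → dot r p + t ≡ π (applyℤ (bwd g) p)) → ∀ a b → ¬ (π a ≡ π b) →
                    ∀ lo → ¬ (∀ {q} → X q → (lo ℤ.≤ π (comb q)) × (π (comb q) ℤ.≤ lo + + 1))
  wide-coordinate {S} {g} W located r t π eq a b a≢b lo slab = no-slab W r (lo - t) r≢0 bounds
    where
    at : ∀ p → dot r (applyℤ (fwd g) p) + t ≡ π p
    at p = trans (eq _) (cong π (bwd-fwd g p))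
    r≢0 : ¬ (r ≡ 𝟎)
    r≢0 refl = a≢b (trans (sym (at a)) (at b))
    back : ∀ d t → d ≡ d + t - t
    back = solve-∀
    shift : ∀ lo t → lo + + 1 - t ≡ lo - t + + 1
    shift = solve-∀
    value : ∀ q → dot r (applyℤ (fwd g) (comb q)) ≡ π (comb q) - t
    value q = trans (back _ t) (cong (λ n → n - t) (at (comb q)))
    bounds : ∀ {s} → s ∈ S → (lo - t ℤ.≤ dot r s) × (dot r s ℤ.≤ lo - t + + 1)
    bounds m with located m
    ... | q , refl , p with slab p
    ... | below , above =
      subst (lo - t ℤ.≤_) (sym (value q)) (ℤP.+-monoˡ-≤ (- t) below) ,
      subst₂ ℤ._≤_ (sym (value q)) (shift lo t) (ℤP.+-monoˡ-≤ (- t) above)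

  wide-y : ∀ {S g X} → WidthGt1 S → Located S g X → ∀ lo →
           ¬ (∀ {q} → X q → (lo ℤ.≤ y (comb q)) × (y (comb q) ℤ.≤ lo + + 1))
  wide-y {g = g} W located = wide-coordinate {g = g} W located (Aff.r₂ (bwd g)) (y (Aff.t (bwd g))) y (λ _ → refl)
    (pt (+ 0) (+ 0) (+ 0)) (pt (+ 0) (+ 1) (+ 0)) λ ()

  wide-z : ∀ {S g X} → WidthGt1 S → Located S g X → ∀ lo →
           ¬ (∀ {q} → X q → (lo ℤ.≤ z (comb q)) × (z (comb q) ℤ.≤ lo + + 1))
  wide-z {g = g} W located = wide-coordinate {g = g} W located (Aff.r₃ (bwd g)) (z (Aff.t (bwd g))) z (λ _ → refl)
    (pt (+ 0) (+ 0) (+ 0)) (pt (+ 0) (+ 0) (+ 1)) λ ()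

open Moves

-- Recognising the normal forms from their points in frame coordinates.

module Recognition where

  open import Data.Integer.Tactic.RingSolver using (solve-∀)

  open Uni
  open Seen

  Classified : List Pt → Set
  Classified S =
      UnimodEquiv S E72 ⊎ UnimodEquiv S E82¹ ⊎ UnimodEquiv S E82² ⊎ UnimodEquiv S E82³
      ⊎ (∃[ a ] ∃[ b ] (a ℤ.≤ + 0 × + 0 ℤ.< b × ¬ ((a , b) ≡ (+ 0 , + 1)) × UnimodEquiv S (F2 a b)))
      ⊎ (∃[ a ] ∃[ b ] ∃[ k ] (a ℤ.≤ + 0 × + 0 ℤ.< b × + 0 ℤ.≤ k × k ℤ.≤ b
          × ¬ ((a , b , k) ≡ (+ 0 , + 1 , + 1)) × UnimodEquiv S (F3 a b k)))
      ⊎ (∃[ a ] ∃[ b ] (a ℤ.≤ + 0 × + 0 ℤ.< b × UnimodEquiv S (F4 a b)))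

  -- Besides the vertices these are the reflections 2O - Z, 2Z - u, 2u - O around a cycle; `4-cycle`
  -- has 2O - Z, 2Z - u, 2u - v, 2v - O.
  3-cycle : List Pt
  3-cycle = pt -1ℤ (+ 0) (+ 0) ∷ pt (+ 2) -1ℤ (+ 0) ∷ pt (+ 0) (+ 2) (+ 0) ∷ vertices

  4-cycle : List Pt
  4-cycle = pt -1ℤ (+ 0) (+ 0) ∷ pt (+ 2) -1ℤ (+ 0) ∷ pt (+ 0) (+ 2) -1ℤ ∷ pt (+ 0) (+ 0) (+ 2) ∷ vertices

  realise-finite : ∀ {S g} (τ : Uni) L T → Located S g (_∈ L) → All (λ q → LatPt T (applyℤ (fwd τ) (comb q))) L →
                   All (λ t → ∃[ q ] (Seen S g q × t ≡ applyℤ (fwd τ) (comb q))) T → UnimodEquiv S T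
  realise-finite τ L T located L⇒T T⇒S = realise τ located (All.lookup L⇒T) (All.lookup T⇒S)

  module _ {T : List Pt} {p q r : Pt} (hp : p ∈ T) (hq : q ∈ T) (hr : r ∈ T) where
    -- Recovers the inner points of a 3-cycle from the outer ones: O = (p + Z)/2, Z = (q + u)/2 and
    -- u = (r + O)/2 solve to 7 O = 4p + 2q + r.
    sevenths : ∀ m → ((+ 4) ⊙ p) ⊕ (((+ 2) ⊙ q) ⊕ (((+ 1) ⊙ r) ⊕ 𝟎)) ≡ (+ 7) ⊙ m → LatPt T m
    sevenths m e = latticePoint 6 ((+ 4 , p) ∷ (+ 2 , q) ∷ (+ 1 , r) ∷ []) m
      ((+≤+ z≤n , generator hp) ∷ (+≤+ z≤n , generator hq) ∷ (+≤+ z≤n , generator hr) ∷ []) refl e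

  module _ {T : List Pt} {p q r s : Pt} (hp : p ∈ T) (hq : q ∈ T) (hr : r ∈ T) (hs : s ∈ T) where
    -- The same elimination around a cycle of four, with 15 = 8 + 4 + 2 + 1.
    fifteenths : ∀ m → ((+ 8) ⊙ p) ⊕ (((+ 4) ⊙ q) ⊕ (((+ 2) ⊙ r) ⊕ (((+ 1) ⊙ s) ⊕ 𝟎))) ≡ (+ 15) ⊙ m → LatPt T m
    fifteenths m e = latticePoint 14 ((+ 8 , p) ∷ (+ 4 , q) ∷ (+ 2 , r) ∷ (+ 1 , s) ∷ []) m
      ((+≤+ z≤n , generator hp) ∷ (+≤+ z≤n , generator hq) ∷ (+≤+ z≤n , generator hr) ∷ (+≤+ z≤n , generator hs) ∷ []) refl e

  pattern 0th = here refl
  pattern 1st = there 0th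
  pattern 2nd = there 1st
  pattern 3rd = there 2nd
  pattern 4th = there 3rd

  -- `τ₁` and `τ₂` send O, Z, u to the three interior lattice points (0,0,0), (1,0,0), (1,1,0) of B
  -- and v to (0,-1,2). They differ by a rotation of the triangle, which puts the eighth point where
  -- E¹ or E² has it. `τ₃` does the same for the tetrahedron E³.
  τ₁ τ₂ τ₃ : Uni
  τ₁ = unimodular (aff (pt (+ 1) (+ 0) (+ 1)) (pt (+ 1) (+ 1) (+ 1)) (pt -1ℤ -1ℤ (+ 0)) 𝟎)
    (aff (pt (+ 1) -1ℤ -1ℤ) (pt -1ℤ (+ 1) (+ 0)) (pt (+ 0) (+ 1) (+ 1)) 𝟎) refl refl
  τ₂ = unimodular (aff (pt (+ 0) (+ 1) (+ 0)) (pt (+ 0) (+ 1) -1ℤ) (pt -1ℤ -1ℤ (+ 0)) (pt (+ 1) (+ 1) (+ 0)))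
    (aff (pt -1ℤ (+ 0) -1ℤ) (pt (+ 1) (+ 0) (+ 0)) (pt (+ 1) -1ℤ (+ 0)) (pt (+ 1) -1ℤ (+ 0))) refl refl
  τ₃ = unimodular (aff (pt (+ 0) -1ℤ (+ 0)) (pt (+ 1) (+ 0) (+ 1)) (pt (+ 0) (+ 0) (+ 1)) 𝟎)
    (aff (pt (+ 0) (+ 1) -1ℤ) (pt -1ℤ (+ 0) (+ 0)) (pt (+ 0) (+ 0) (+ 1)) 𝟎) refl refl

  module _ {S : List Pt} {g : Uni} (F : Frame S g) where
    open Frame F using (vertex)

    realise-E82³ : All (Seen S g) 4-cycle → Located S g (_∈ 4-cycle) → UnimodEquiv S E82³
    realise-E82³ (kZ ∷ ku ∷ kv ∷ kO ∷ _) located = realise-finite τ₃ 4-cycle E82³ located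
      (generator 0th ∷ generator 3rd ∷ generator 2nd ∷ generator 1st ∷
       fifteenths 0th 3rd 2nd 1st (pt (+ 0) (+ 0) (+ 0)) refl ∷ fifteenths 3rd 2nd 1st 0th (pt (+ 0) (+ 1) (+ 1)) refl ∷
       fifteenths 2nd 1st 0th 3rd (pt (+ 1) (+ 1) (+ 0)) refl ∷ fifteenths 1st 0th 3rd 2nd (pt (+ 1) (+ 0) (+ 1)) refl ∷ [])
      ((_ , kZ , refl) ∷ (_ , kO , refl) ∷ (_ , kv , refl) ∷ (_ , ku , refl) ∷ [])

    realise-E72 : All (Seen S g) 3-cycle → Located S g (_∈ 3-cycle) → UnimodEquiv S E72
    realise-E72 (kZ ∷ ku ∷ kO ∷ _) located = realise-finite τ₁ 3-cycle E72 located
      (generator 1st ∷ generator 3rd ∷ generator 2nd ∷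
       sevenths 1st 3rd 2nd (pt (+ 0) (+ 0) (+ 0)) refl ∷ sevenths 3rd 2nd 1st (pt (+ 1) (+ 1) (+ 0)) refl ∷
       sevenths 2nd 1st 3rd (pt (+ 1) (+ 0) (+ 0)) refl ∷ generator 0th ∷ [])
      ((_ , vertex v , refl) ∷ (_ , kZ , refl) ∷ (_ , kO , refl) ∷ (_ , ku , refl) ∷ [])

    realise-E82¹ : All (Seen S g) 3-cycle → Seen S g (pt (+ 0) (+ 0) -1ℤ) →
                   Located S g (_∈ pt (+ 0) (+ 0) -1ℤ ∷ 3-cycle) → UnimodEquiv S E82¹
    realise-E82¹ (kZ ∷ ku ∷ kO ∷ _) kv located = realise-finite τ₁ (pt (+ 0) (+ 0) -1ℤ ∷ 3-cycle) E82¹ located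
      (generator 1st ∷ generator 2nd ∷ generator 4th ∷ generator 3rd ∷
       sevenths 2nd 4th 3rd (pt (+ 0) (+ 0) (+ 0)) refl ∷ sevenths 4th 3rd 2nd (pt (+ 1) (+ 1) (+ 0)) refl ∷
       sevenths 3rd 2nd 4th (pt (+ 1) (+ 0) (+ 0)) refl ∷ generator 0th ∷ [])
      ((_ , vertex v , refl) ∷ (_ , kv , refl) ∷ (_ , kZ , refl) ∷ (_ , kO , refl) ∷ (_ , ku , refl) ∷ [])

    realise-E82² : All (Seen S g) 3-cycle → Seen S g (pt (+ 0) (+ 4) -1ℤ) →
                   Located S g (_∈ pt (+ 0) (+ 4) -1ℤ ∷ 3-cycle) → UnimodEquiv S E82²
    realise-E82² (kZ ∷ ku ∷ kO ∷ _) kv located = realise-finite τ₂ (pt (+ 0) (+ 4) -1ℤ ∷ 3-cycle) E82² located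
      (generator 1st ∷ generator 4th ∷ generator 3rd ∷ generator 2nd ∷
       sevenths 4th 3rd 2nd (pt (+ 1) (+ 1) (+ 0)) refl ∷ sevenths 3rd 2nd 4th (pt (+ 1) (+ 0) (+ 0)) refl ∷
       sevenths 2nd 4th 3rd (pt (+ 0) (+ 0) (+ 0)) refl ∷ generator 0th ∷ [])
      ((_ , vertex v , refl) ∷ (_ , kv , refl) ∷ (_ , kO , refl) ∷ (_ , ku , refl) ∷ (_ , kZ , refl) ∷ [])

  data Within (lo hi : ℤ) (r : Pt) : Pt → Set where
    spike : ∀ a → lo ℤ.≤ a → a ℤ.≤ hi → Within lo hi r ⟨ a , + 0 , + 0 ⟩
    u     : Within lo hi r uₚ
    u′    : Within lo hi r ⟨ + 0 , -1ℤ , + 0 ⟩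
    v     : Within lo hi r vₚ
    w     : Within lo hi r r

  widen : ∀ {lo hi lo′ hi′ r q} → lo′ ℤ.≤ lo → hi ℤ.≤ hi′ → Within lo hi r q → Within lo′ hi′ r q
  widen l h (spike a p q) = spike a (ℤP.≤-trans l p) (ℤP.≤-trans q h)
  widen l h u  = u
  widen l h u′ = u′
  widen l h v  = v
  widen l h w  = w

  module _ {S : List Pt} (g : Uni) where

    Bounded : ℤ → ℤ → Pt → List Pt → Set
    Bounded lo₀ hi₀ r R = ∃[ lo ] ∃[ hi ] (lo ℤ.≤ lo₀ × hi₀ ℤ.≤ hi ×
      Seen S g ⟨ lo , + 0 , + 0 ⟩ × Seen S g ⟨ hi , + 0 , + 0 ⟩ ×
      (∀ {s} → s ∈ R → ∃[ q ] (s ≡ applyℤ (fwd g) (comb q) × Within lo hi r q)))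

    -- The ends of the spike are the running minimum and maximum over the generators on it, started
    -- at a segment already known to be seen.
    bound : ∀ {r lo₀ hi₀} → lo₀ ℤ.≤ hi₀ → Located S g (Spiked r) → Seen S g ⟨ lo₀ , + 0 , + 0 ⟩ → Seen S g ⟨ hi₀ , + 0 , + 0 ⟩ →
            Bounded lo₀ hi₀ r S
    bound {r} {lo₀} {hi₀} lo₀≤hi₀ located klo khi = go S id
      where
      extend : ∀ {s R} q → s ∈ S → s ≡ applyℤ (fwd g) (comb q) → Spiked r q → Bounded lo₀ hi₀ r R → Bounded lo₀ hi₀ r (s ∷ R)
      extend q m refl u  (lo , hi , l , h , kl , kh , loc) = lo , hi , l , h , kl , kh , λ { (here refl) → _ , refl , u  ; (there n) → loc n }
      extend q m refl u′ (lo , hi , l , h , kl , kh , loc) = lo , hi , l , h , kl , kh , λ { (here refl) → _ , refl , u′ ; (there n) → loc n }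
      extend q m refl v  (lo , hi , l , h , kl , kh , loc) = lo , hi , l , h , kl , kh , λ { (here refl) → _ , refl , v  ; (there n) → loc n }
      extend q m refl w  (lo , hi , l , h , kl , kh , loc) = lo , hi , l , h , kl , kh , λ { (here refl) → _ , refl , w  ; (there n) → loc n }
      extend q m refl (spike a) (lo , hi , l , h , kl , kh , loc) with ℤP.≤-total lo a | ℤP.≤-total a hi
      ... | inj₁ p | inj₁ p′ = lo , hi , l , h , kl , kh , λ { (here refl) → _ , refl , spike a p p′ ; (there n) → loc n }
      -- Degenerate case in which `a` is at most the lower and at least the upper end; `lo ≤ a`
      -- still follows through `lo₀ ≤ hi₀`, and `a` is taken as the upper end.
      ... | inj₂ p | inj₂ p′ = lo , a , l , ℤP.≤-trans h p′ , kl , seen (generator m) , λ { (here refl) → _ , refl , spike a (ℤP.≤-trans (ℤP.≤-trans l lo₀≤hi₀) (ℤP.≤-trans h p′)) ℤP.≤-refl ; (there n) → let q , e , x = loc n in q , e , widen ℤP.≤-refl p′ x }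
      ... | inj₂ p | inj₁ p′ = a , hi , ℤP.≤-trans p l , h , seen (generator m) , kh ,
        λ { (here refl) → _ , refl , spike a ℤP.≤-refl p′ ; (there n) → let q , e , x = loc n in q , e , widen p ℤP.≤-refl x }
      ... | inj₁ p | inj₂ p′ = lo , a , l , ℤP.≤-trans h p′ , kl , seen (generator m) ,
        λ { (here refl) → _ , refl , spike a p ℤP.≤-refl ; (there n) → let q , e , x = loc n in q , e , widen ℤP.≤-refl p′ x }
      go : ∀ R → (∀ {s} → s ∈ R → s ∈ S) → Bounded lo₀ hi₀ r R
      go []      _   = lo₀ , hi₀ , ℤP.≤-refl , ℤP.≤-refl , klo , khi , λ ()
      go (s ∷ R) R⊆S = let q , e , x = located (R⊆S (here refl)) in extend q (R⊆S (here refl)) e x (go R (R⊆S ∘ there))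

  idᵤ : Uni
  idᵤ = unimodular idₐ idₐ refl refl

  spike-comb : ∀ a → comb ⟨ a , + 0 , + 0 ⟩ ≡ pt (+ 0) (+ 0) a
  spike-comb a = trans (comb-coordinates a (+ 0) (+ 0)) (V3-≡ refl refl (ℤP.+-identityʳ a))

  w₃-comb : ∀ k → comb (2[ ⟨ k , + 0 , + 0 ⟩ ]- vₚ) ≡ pt (+ 1) (+ 1) (+ 2 * k - + 1)
  w₃-comb k = trans (comb-coordinates (+ 2 * k - + 0) (+ 0) -1ℤ) (V3-≡ refl refl (third k))
    where
    third : ∀ k → + 2 * k - + 0 + -1ℤ ≡ + 2 * k - + 1
    third = solve-∀

  module _ {lo hi : ℤ} {T : List Pt} (T-lo : pt (+ 0) (+ 0) lo ∈ T) (T-hi : pt (+ 0) (+ 0) hi ∈ T)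
           (T-v : pt -1ℤ -1ℤ (+ 1) ∈ T) (T-u : pt (+ 1) -1ℤ (+ 0) ∈ T) (T-u′ : pt -1ℤ (+ 1) (+ 0) ∈ T) where

    within : ∀ {r} → LatPt T (applyℤ idₐ (comb r)) → ∀ {q} → Within lo hi r q → LatPt T (applyℤ idₐ (comb q))
    within T-r (spike a p q) = convex-between {λ q → LatPt T (applyℤ idₐ (comb q))}
      (convex-preimage {λ p → LatPt T (applyℤ idₐ p)} combₐ (convex-preimage {LatPt T} idₐ latticePoint)) a
      (end T-lo) (end T-hi) p q
      where
      end : ∀ {a} → pt (+ 0) (+ 0) a ∈ T → LatPt T (applyℤ idₐ (comb ⟨ a , + 0 , + 0 ⟩))
      end {a} m = subst (LatPt T) (sym (trans (idₐ-apply _) (spike-comb a))) (generator m)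
    within T-r u  = generator T-u
    within T-r u′ = generator T-u′
    within T-r v  = generator T-v
    within T-r w  = T-r

    -- With the spike reduced to OZ everything lies in 0 ≤ z ≤ 1 as soon as `r` does. This rules out
    -- (0,1) for F̃₂ and (0,1,1) for F̃₃.
    within-slab : ∀ {r q} → lo ≡ + 0 → hi ≡ + 1 → (+ 0 ℤ.≤ z (comb r)) × (z (comb r) ℤ.≤ + 1) →
                  Within lo hi r q → (+ 0 ℤ.≤ z (comb q)) × (z (comb q) ℤ.≤ + 1)
    within-slab refl refl h (spike a p q) = subst (λ t → (+ 0 ℤ.≤ t) × (t ℤ.≤ + 1)) (sym (cong z (spike-comb a))) (p , q)
    within-slab refl refl h u  = +≤+ z≤n , +≤+ z≤n
    within-slab refl refl h u′ = +≤+ z≤n , +≤+ z≤n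
    within-slab refl refl h v  = +≤+ z≤n , +≤+ (s≤s z≤n)
    within-slab refl refl h w  = h

  module _ {S : List Pt} (W : WidthGt1 S) {g : Uni} (F : Frame S g) (ku : Seen S g ⟨ + 0 , -1ℤ , + 0 ⟩) where
    open Frame F using (vertex)

    private
      In : Pt → Set
      In t = ∃[ q ] (Seen S g q × t ≡ applyℤ (fwd idᵤ) (comb q))
      at-spike : ∀ {a} → Seen S g ⟨ a , + 0 , + 0 ⟩ → In (pt (+ 0) (+ 0) a)
      at-spike {a} k = _ , k , sym (trans (idₐ-apply _) (spike-comb a))

    realise-F₂ : Located S g (Spiked vₚ) → Classified S
    realise-F₂ located with bound g (+≤+ z≤n) located (vertex O) (vertex Z)
    ... | lo , hi , l , h , kl , kh , loc = inj₂ (inj₂ (inj₂ (inj₂ (inj₁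
      (lo , hi , l , ℤP.<-≤-trans (ℤ.+<+ (s≤s z≤n)) h , proper , realise {g = g} {Within lo hi vₚ} {F2 lo hi} idᵤ loc (within 0th 1st 2nd 3rd 4th (generator 2nd)) (All.lookup {P = In}
        (at-spike kl ∷ at-spike kh ∷ (_ , vertex v , refl) ∷ (_ , vertex u , refl) ∷ (_ , ku , refl) ∷ [])))))))
      where
      proper : ¬ ((lo , hi) ≡ (+ 0 , + 1))
      proper e = wide-z {g = g} {Within lo hi _} W loc (+ 0) (within-slab {T = F2 lo hi} 0th 1st 2nd 3rd 4th (cong proj₁ e) (cong proj₂ e) (+≤+ z≤n , +≤+ (s≤s z≤n)))

    realise-F₃ : ∀ n → Seen S g ⟨ + n , + 0 , + 0 ⟩ → Seen S g (2[ ⟨ + n , + 0 , + 0 ⟩ ]- vₚ) →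
                 Located S g (Spiked (2[ ⟨ + n , + 0 , + 0 ⟩ ]- vₚ)) → Classified S
    realise-F₃ n kn kw located = finish (1-⊔ n kn)
      where
      -- Starting `bound` at the maximum of 1 and n yields both `0 < b` and `k ≤ b`.
      1-⊔ : ∀ n → Seen S g ⟨ + n , + 0 , + 0 ⟩ → ∃[ m ] (1 ℕ.≤ m × n ℕ.≤ m × Seen S g ⟨ + m , + 0 , + 0 ⟩)
      1-⊔ zero    _ = 1 , s≤s z≤n , z≤n , vertex Z
      1-⊔ (suc n) k = suc n , s≤s z≤n , ℕP.≤-refl , k
      w₃ : Pt
      w₃ = 2[ ⟨ + n , + 0 , + 0 ⟩ ]- vₚ
      5th : ∀ {lo hi} → pt (+ 1) (+ 1) (+ 2 * + n - + 1) ∈ F3 lo hi (+ n)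
      5th = there 4th
      finish : ∃[ m ] (1 ℕ.≤ m × n ℕ.≤ m × Seen S g ⟨ + m , + 0 , + 0 ⟩) → Classified S
      finish (m , 1≤m , n≤m , km) with bound g (+≤+ z≤n) located (vertex O) km
      ... | lo , hi , l , h , kl , kh , loc = inj₂ (inj₂ (inj₂ (inj₂ (inj₂ (inj₁
        (lo , hi , + n , l , ℤP.<-≤-trans (ℤ.+<+ 1≤m) h , +≤+ z≤n , ℤP.≤-trans (+≤+ n≤m) h , proper ,
         realise {g = g} {Within lo hi w₃} {F3 lo hi (+ n)} idᵤ loc (within 0th 1st 2nd 3rd 4th (subst (LatPt _) (sym (trans (idₐ-apply _) (w₃-comb (+ n)))) (generator (5th {lo} {hi})))) (All.lookup {P = In}
          (at-spike kl ∷ at-spike kh ∷ (_ , vertex v , refl) ∷ (_ , vertex u , refl) ∷ (_ , ku , refl) ∷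
           (_ , kw , sym (trans (idₐ-apply _) (w₃-comb (+ n)))) ∷ []))))))))
        where
        proper : ¬ ((lo , hi , + n) ≡ (+ 0 , + 1 , + 1))
        proper e = wide-z {g = g} {Within lo hi _} W loc (+ 0) (within-slab {T = F2 lo hi} 0th 1st 2nd 3rd 4th (cong proj₁ e) (cong (proj₁ ∘ proj₂) e)
          (subst (λ k → (+ 0 ℤ.≤ z (comb (2[ ⟨ k , + 0 , + 0 ⟩ ]- vₚ))) × (z (comb (2[ ⟨ k , + 0 , + 0 ⟩ ]- vₚ)) ℤ.≤ + 1))
            (sym (cong (proj₂ ∘ proj₂) e)) (+≤+ z≤n , +≤+ (s≤s z≤n))))

    realise-F₄ : Seen S g ⟨ + 0 , + 2 , -1ℤ ⟩ → Located S g (Spiked ⟨ + 0 , + 2 , -1ℤ ⟩) → Classified S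
    realise-F₄ kw located with bound g (+≤+ z≤n) located (vertex O) (vertex Z)
    ... | lo , hi , l , h , kl , kh , loc = inj₂ (inj₂ (inj₂ (inj₂ (inj₂ (inj₂
      (lo , hi , l , ℤP.<-≤-trans (ℤ.+<+ (s≤s z≤n)) h , realise {g = g} {Within lo hi ⟨ + 0 , + 2 , -1ℤ ⟩} {F4 lo hi} idᵤ loc (within 0th 1st 2nd 3rd 4th (generator (there 4th))) (All.lookup {P = In}
        (at-spike kl ∷ at-spike kh ∷ (_ , vertex v , refl) ∷ (_ , vertex u , refl) ∷ (_ , ku , refl) ∷ (_ , kw , refl) ∷ []))))))))

open Recognition

-- The frame changes that occur, as words in the four basic moves.

module FrameChanges where

  open Uni
  open Seen

  -- The name of a move lists the new vertices O, Z, u, v in terms of the old ones.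
  ⟦O,Z,v,u⟧ ⟦O,u,Z,v⟧ ⟦O,u,v,Z⟧ ⟦O,v,Z,u⟧ ⟦O,v,u,Z⟧ ⟦Z,O,u,v⟧ ⟦Z,O,v,u⟧ ⟦Z,u,O,v⟧ ⟦Z,v,O,u⟧ ⟦u,O,Z,v⟧ ⟦u,Z,O,v⟧ ⟦u,v,O,Z⟧ ⟦v,O,Z,u⟧ ⟦v,Z,O,u⟧ ⟦v,u,O,Z⟧ : Move
  ⟦O,Z,v,u⟧ = swapuv
  ⟦O,u,Z,v⟧ = swapZu
  ⟦Z,O,u,v⟧ = swapOZ
  ⟦O,u,v,Z⟧ = ⟦O,u,Z,v⟧ ⨟ swapuv
  ⟦O,v,Z,u⟧ = swapuv ⨟ swapZu
  ⟦O,v,u,Z⟧ = ⟦O,v,Z,u⟧ ⨟ swapuv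
  ⟦Z,O,v,u⟧ = swapOZ ⨟ swapuv
  ⟦Z,u,O,v⟧ = swapOZ ⨟ swapZu
  ⟦Z,v,O,u⟧ = ⟦Z,O,v,u⟧ ⨟ swapZu
  ⟦u,O,Z,v⟧ = swapZu ⨟ swapOZ
  ⟦u,Z,O,v⟧ = ⟦Z,u,O,v⟧ ⨟ swapOZ
  ⟦u,v,O,Z⟧ = ⟦u,O,Z,v⟧ ⨟ swapuv ⨟ swapZu
  ⟦v,O,Z,u⟧ = ⟦O,v,Z,u⟧ ⨟ swapOZ
  ⟦v,Z,O,u⟧ = ⟦Z,v,O,u⟧ ⨟ swapOZ
  ⟦v,u,O,Z⟧ = ⟦u,v,O,Z⟧ ⨟ swapOZ

  -- Each reflects one vertex in another: a permutation brings the pair to the places of Z and O,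
  -- `reflect` acts, and a second permutation sorts the result.
  ⟦O,2O-Z,u,v⟧ ⟦2O-Z,O,u,v⟧ ⟦O,Z,2O-u,v⟧ ⟦Z,O,2O-u,v⟧ ⟦O,Z,2Z-v,u⟧ ⟦Z,O,2O-v,u⟧ ⟦Z,2Z-O,v,u⟧ ⟦Z,2Z-O,4Z-2O-v,u⟧ ⟦O,u,2u-v,Z⟧ ⟦Z,O,u,2u-v⟧ : Move
  ⟦O,2O-Z,u,v⟧ = reflect
  ⟦2O-Z,O,u,v⟧ = reflect ⨟ swapOZ
  ⟦O,Z,2O-u,v⟧ = swapZu ⨟ reflect ⨟ swapZu
  ⟦Z,O,2O-u,v⟧ = ⟦O,Z,2O-u,v⟧ ⨟ swapOZ
  ⟦O,Z,2Z-v,u⟧ = ⟦Z,v,O,u⟧ ⨟ reflect ⨟ ⟦u,O,Z,v⟧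
  ⟦Z,O,2O-v,u⟧ = ⟦O,v,Z,u⟧ ⨟ reflect ⨟ ⟦u,O,Z,v⟧
  ⟦Z,2Z-O,v,u⟧ = swapOZ ⨟ reflect ⨟ swapuv
  ⟦Z,2Z-O,4Z-2O-v,u⟧ = ⟦Z,2Z-O,v,u⟧ ⨟ ⟦Z,u,O,v⟧ ⨟ reflect ⨟ ⟦u,O,Z,v⟧
  ⟦O,u,2u-v,Z⟧ = ⟦u,v,O,Z⟧ ⨟ reflect ⨟ ⟦u,O,Z,v⟧
  ⟦Z,O,u,2u-v⟧ = ⟦u,v,O,Z⟧ ⨟ reflect ⨟ ⟦v,u,O,Z⟧

open FrameChanges

-- Steps that run around a cycle of vertices.

module Cycles where

  open Uni
  open Seen
  module _ {S : List Pt} where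

    module _ {g : Uni} (F : Frame S g) where
      open Frame F using (vertex)

      -- There are no exits at all: two successive midpoints refute every step that leaves the
      -- configuration.
      4-cyclic : Seen S g ⟨ -1ℤ , + 0 , + 0 ⟩ → Seen S g ⟨ + 2 , -1ℤ , + 0 ⟩ →
                 Seen S g ⟨ + 0 , + 2 , -1ℤ ⟩ → Seen S g ⟨ + 0 , + 0 , + 2 ⟩ → Classified S
      4-cyclic kZ ku kv kO = finish (locate F (finite-closure (config F) 2 4-cycle [] ks))
        where
        ks : All (Seen S g) 4-cycle
        ks = kZ ∷ ku ∷ kv ∷ kO ∷ vertex O ∷ vertex Z ∷ vertex u ∷ vertex v ∷ []
        finish : Located S g (_∈ 4-cycle) ⊎ (∃[ r ] (r ∈ [] × Seen S g r)) → Classified S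
        finish (inj₁ located) = inj₂ (inj₂ (inj₂ (inj₁ (realise-E82³ F ks located))))

      module _ (ks : All (Seen S g) 3-cycle) where

        3-cyclic¹ : Seen S g ⟨ + 0 , + 0 , -1ℤ ⟩ → Classified S
        3-cyclic¹ k = finish (locate F (finite-closure (config F) 2 (pt (+ 0) (+ 0) -1ℤ ∷ 3-cycle) [] (k ∷ ks)))
          where
          finish : Located S g (_∈ pt (+ 0) (+ 0) -1ℤ ∷ 3-cycle) ⊎ (∃[ r ] (r ∈ [] × Seen S g r)) → Classified S
          finish (inj₁ located) = inj₂ (inj₁ (realise-E82¹ F ks k located))

        3-cyclic² : Seen S g ⟨ + 0 , + 4 , -1ℤ ⟩ → Classified S
        3-cyclic² k = finish (locate F (finite-closure (config F) 2 (pt (+ 0) (+ 4) -1ℤ ∷ 3-cycle) [] (k ∷ ks)))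
          where
          finish : Located S g (_∈ pt (+ 0) (+ 4) -1ℤ ∷ 3-cycle) ⊎ (∃[ r ] (r ∈ [] × Seen S g r)) → Classified S
          finish (inj₁ located) = inj₂ (inj₂ (inj₁ (realise-E82² F ks k located)))

    module _ {g : Uni} (F : Frame S g) where
      open Frame F using (vertex)

      3-cyclic : Seen S g ⟨ -1ℤ , + 0 , + 0 ⟩ → Seen S g ⟨ + 2 , -1ℤ , + 0 ⟩ → Seen S g ⟨ + 0 , + 2 , + 0 ⟩ → Classified S
      3-cyclic kZ ku kO = finish (locate F (finite-closure (config F) 2 3-cycle exits ks))
        where
        exits : List Pt
        -- The reflections of v in the six points of the 3-cycle: those in O, Z, u lead to E¹, those
        -- in the three outer points to E². Rotating the cycle reduces them to the first two.
        exits = pt (+ 0) (+ 0) -1ℤ ∷ pt (+ 0) (+ 4) -1ℤ ∷ pt (+ 2) (+ 0) -1ℤ ∷ pt -2ℤ (+ 0) -1ℤ ∷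
                pt (+ 0) (+ 2) -1ℤ ∷ pt (+ 4) -2ℤ -1ℤ ∷ []
        ks : All (Seen S g) 3-cycle
        ks = kZ ∷ ku ∷ kO ∷ vertex O ∷ vertex Z ∷ vertex u ∷ vertex v ∷ []
        m₁ m₂ : Move
        m₁ = ⟦Z,u,O,v⟧
        m₂ = ⟦u,O,Z,v⟧
        F₁ : Frame S (g ∘ᵤ Move.h m₁)
        F₁ = permute F m₁ λ { O → Z ; Z → u ; u → O ; v → v }
        F₂ : Frame S (g ∘ᵤ Move.h m₂)
        F₂ = permute F m₂ λ { O → u ; Z → O ; u → Z ; v → v }
        ks₁ : All (Seen S (g ∘ᵤ Move.h m₁)) 3-cycle
        ks₁ = into m₁ ku ∷ into m₁ kO ∷ into m₁ kZ ∷ into m₁ (vertex Z) ∷ into m₁ (vertex u) ∷ into m₁ (vertex O) ∷ into m₁ (vertex v) ∷ []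
        ks₂ : All (Seen S (g ∘ᵤ Move.h m₂)) 3-cycle
        ks₂ = into m₂ kO ∷ into m₂ kZ ∷ into m₂ ku ∷ into m₂ (vertex u) ∷ into m₂ (vertex O) ∷ into m₂ (vertex Z) ∷ into m₂ (vertex v) ∷ []
        finish : Located S g (_∈ 3-cycle) ⊎ (∃[ r ] (r ∈ exits × Seen S g r)) → Classified S
        finish (inj₁ located)             = inj₁ (realise-E72 F ks located)
        finish (inj₂ (_ , 0th , k))       = 3-cyclic¹ F ks k
        finish (inj₂ (_ , 1st , k))       = 3-cyclic² F ks k
        finish (inj₂ (_ , 2nd , k))       = 3-cyclic¹ F₁ ks₁ (into m₁ k)
        finish (inj₂ (_ , 3rd , k))       = 3-cyclic² F₁ ks₁ (into m₁ k)
        finish (inj₂ (_ , 4th , k))       = 3-cyclic¹ F₂ ks₂ (into m₂ k)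
        finish (inj₂ (_ , there 4th , k)) = 3-cyclic² F₂ ks₂ (into m₂ k)

open Cycles

-- Configurations in which -u is present: long spikes, stars and paths.

module Spikes where

  open import Data.Integer.Tactic.RingSolver using (solve-∀)

  open Uni
  open Seen
  -- A spike of at least four points, in the form that `noO` and `noZ` require; side points then
  -- have no step away from O or Z.
  Long : List Pt → Uni → Set
  Long S g = (Seen S g ⟨ + 2 , + 0 , + 0 ⟩ ⊎ Seen S g ⟨ -2ℤ , + 0 , + 0 ⟩) ×
             (Seen S g ⟨ -1ℤ , + 0 , + 0 ⟩ ⊎ Seen S g ⟨ + 3 , + 0 , + 0 ⟩)

  module _ {S : List Pt} where

    neg-spike : ∀ {g} a → Seen S g ⟨ a , + 0 , + 0 ⟩ → Seen S g (applyℤ (Move.ℓ ⟦O,2O-Z,u,v⟧) ⟨ - a , + 0 , + 0 ⟩)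
    neg-spike {g} a = subst (λ t → Seen S g ⟨ t , + 0 , + 0 ⟩) (identity a)
      where
      identity : ∀ a → a ≡ -1ℤ * (- a) + + 0 * + 0 + + 0 * + 0 + + 0
      identity = solve-∀

    neg-u : ∀ {g} a → Seen S g ⟨ + 2 * a - + 0 , -1ℤ , + 0 ⟩ →
            Seen S g (applyℤ (Move.ℓ ⟦O,2O-Z,u,v⟧) ⟨ + 2 * (- a) - + 0 , -1ℤ , + 0 ⟩)
    neg-u {g} a = subst (λ t → Seen S g ⟨ t , -1ℤ , + 0 ⟩) (identity a)
      where
      identity : ∀ a → + 2 * a - + 0 ≡ -1ℤ * (+ 2 * (- a) - + 0) + + 0 * -1ℤ + + 0 * + 0 + + 0
      identity = solve-∀

    neg-v : ∀ {g} a → Seen S g ⟨ + 2 * a - + 0 , + 0 , -1ℤ ⟩ →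
            Seen S g (applyℤ (Move.ℓ ⟦O,2O-Z,u,v⟧) ⟨ + 2 * (- a) - + 0 , + 0 , -1ℤ ⟩)
    neg-v {g} a = subst (λ t → Seen S g ⟨ t , + 0 , -1ℤ ⟩) (identity a)
      where
      identity : ∀ a → + 2 * a - + 0 ≡ -1ℤ * (+ 2 * (- a) - + 0) + + 0 * + 0 + + 0 * -1ℤ + + 0
      identity = solve-∀

    reflected : ∀ {g} → Frame S g → Seen S g ⟨ -1ℤ , + 0 , + 0 ⟩ → Frame S (g ∘ᵤ Move.h ⟦O,2O-Z,u,v⟧)
    reflected F k = reframe F ⟦O,2O-Z,u,v⟧ λ { O → Frame.vertex F O ; Z → k ; u → Frame.vertex F u ; v → Frame.vertex F v }

    u-reflected : ∀ {g} → Frame S g → Seen S g ⟨ + 0 , -1ℤ , + 0 ⟩ → Frame S (g ∘ᵤ Move.h ⟦O,Z,2O-u,v⟧)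
    u-reflected F k = reframe F ⟦O,Z,2O-u,v⟧ λ { O → Frame.vertex F O ; Z → Frame.vertex F Z ; u → k ; v → Frame.vertex F v }

  module _ {S : List Pt} (W : WidthGt1 S) where

    module _ {g : Uni} (F : Frame S g) (ku : Seen S g ⟨ + 0 , -1ℤ , + 0 ⟩) (far : Long S g) where
      open Frame F using (vertex)

      private
        hO : ∀ {r q} → Anchored r → Side r q → ¬ Seen S g (2[ q ]- Oₚ)
        hO {q = q} anchor s k = noO (config F) q (anchored anchor s) k (proj₁ far)
        hZ : ∀ {r q} → Anchored r → Side r q → ¬ Seen S g (2[ q ]- Zₚ)
        hZ {q = q} anchor s k = noZ (config F) q (anchored anchor s) k (proj₂ far)

      long₃⁺ : ∀ n → Seen S g ⟨ + n , + 0 , + 0 ⟩ → Seen S g (2[ ⟨ + n , + 0 , + 0 ⟩ ]- vₚ) → Classified S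
      long₃⁺ n kn kw = finish (locate F (F₃-closure (config F) ku (+ n) kw (hO refl) (hZ refl)))
        where
        finish : Located S g (Spiked (2[ ⟨ + n , + 0 , + 0 ⟩ ]- vₚ)) ⊎ ⊥ → Classified S
        finish (inj₁ located) = realise-F₃ W F ku n kn kw located

      long₄ : Seen S g ⟨ + 0 , + 2 , -1ℤ ⟩ → Classified S
      long₄ kw = finish (locate F (F₄-closure (config F) ku kw (hO refl) (hZ refl)))
        where
        finish : Located S g (Spiked ⟨ + 0 , + 2 , -1ℤ ⟩) ⊎ ⊥ → Classified S
        finish (inj₁ located) = realise-F₄ W F ku kw located

      long₂ : (F₃-extension (config F) ku → Classified S) → (F₄-extension (config F) ku → Classified S) → Classified S
      long₂ h₃ h₄ = finish (locate F (F₂-closure (config F) ku (hO refl) (hZ refl)))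
        where
        finish : Located S g (Spiked vₚ) ⊎ (F₃-extension (config F) ku ⊎ F₄-extension (config F) ku ⊎ ⊥) → Classified S
        finish (inj₁ located)         = realise-F₂ W F ku located
        finish (inj₂ (inj₁ e))        = h₃ e
        finish (inj₂ (inj₂ (inj₁ e))) = h₄ e

    module _ {g : Uni} (F : Frame S g) (ku : Seen S g ⟨ + 0 , -1ℤ , + 0 ⟩) where
      open Frame F using (vertex)
      open Config (config F) using (between)

      long : Long S g → Classified S
      long far@(kO , kZ) = long₂ F ku far h₃ h₄
        where
        m : Move
        m = ⟦O,2O-Z,u,v⟧
        swap : Seen S g ⟨ + 2 , + 0 , + 0 ⟩ ⊎ Seen S g ⟨ -2ℤ , + 0 , + 0 ⟩ →
               Seen S (g ∘ᵤ Move.h m) ⟨ + 2 , + 0 , + 0 ⟩ ⊎ Seen S (g ∘ᵤ Move.h m) ⟨ -2ℤ , + 0 , + 0 ⟩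
        swap (inj₁ k) = inj₂ (into m k)
        swap (inj₂ k) = inj₁ (into m k)
        h₃ : F₃-extension (config F) ku → Classified S
        h₃ (+ n , kn , kw) = long₃⁺ F ku far n kn kw
        -- A negative centre becomes positive by reflecting Z in O; -Z is available because it lies
        -- between the centre and O.
        h₃ (-[1+ n ] , kn , kw) =
          long₃⁺ (reflected F (between -1ℤ kn (vertex O) (-≤- z≤n) -≤+)) (into m ku) (swap kO , inj₁ (into m (vertex Z)))
            (suc n) (into m (neg-spike -[1+ n ] kn)) (into m (neg-v -[1+ n ] kw))
        m′ : Move
        m′ = ⟦O,Z,2O-u,v⟧
        fixed : ∀ c → Seen S g ⟨ c , + 0 , + 0 ⟩ → Seen S (g ∘ᵤ Move.h m′) ⟨ c , + 0 , + 0 ⟩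
        fixed c k = into m′ (subst (λ t → Seen S g ⟨ t , + 0 , + 0 ⟩) (identity c) k)
          where
          identity : ∀ c → c ≡ + 1 * c + + 0 * + 0 + + 0 * + 0 + + 0
          identity = solve-∀
        h₄ : F₄-extension (config F) ku → Classified S
        h₄ (inj₁ k) = long₄ F ku far k
        -- Replacing u by -u exchanges the two forms of the extension and fixes the spike.
        h₄ (inj₂ k) = long₄ (u-reflected F ku) (into m′ (vertex u)) (Sum.map (fixed _) (fixed _) kO , Sum.map (fixed _) (fixed _) kZ) (into m′ k)

    -- The spikes of length two: O is the midpoint of Z and another point (star), or Z is the midpoint of O and another point (path).

    module _ {g : Uni} (F : Frame S g) (k₋₁ : Seen S g ⟨ -1ℤ , + 0 , + 0 ⟩) (ku : Seen S g ⟨ + 0 , -1ℤ , + 0 ⟩) where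
      open Frame F using (vertex)

      private
        swapped : Frame S (g ∘ᵤ Move.h ⟦O,u,Z,v⟧)
        swapped = permute F ⟦O,u,Z,v⟧ λ { O → O ; Z → u ; u → Z ; v → v }

      -- The line through O and u now carries -u, O, u, 2u, so it serves as a long spike with Z in
      -- the role of u.
      star-u : Seen S g ⟨ + 0 , + 2 , + 0 ⟩ → Classified S
      star-u k = long swapped (into m k₋₁) (inj₁ (into m k) , inj₁ (into m ku))
        where m = ⟦O,u,Z,v⟧

      star-u′ : Seen S g ⟨ + 0 , -2ℤ , + 0 ⟩ → Classified S
      star-u′ k = long swapped (into m k₋₁) (inj₂ (into m k) , inj₁ (into m ku))
        where m = ⟦O,u,Z,v⟧

      star-Z : ∀ {A : Set} {r q} → Anchored r → Side r q → Seen S g (2[ q ]- Zₚ) → A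
      star-Z {q = q} anchor s k = ⊥-elim (noZ (config F) q (anchored anchor s) k (inj₁ k₋₁))

      -- Doubling v closes the 3-cycle O, u, v, because -u and 2u - v are present; doubling w = 2u -
      -- v closes O, u, w, because v = 2u - w.
      star₄ : Seen S g ⟨ + 0 , + 2 , -1ℤ ⟩ → Classified S
      star₄ kw = finish (locate F (F₄-closure (config F) ku kw hO (star-Z refl)))
        where
        hO : ∀ {r} → Side ⟨ + 0 , + 2 , -1ℤ ⟩ r → Seen S g (2[ r ]- Oₚ) → Classified S
        hO u  k = star-u k
        hO u′ k = star-u′ k
        hO v  k = 3-cyclic (permute F m λ { O → O ; Z → u ; u → v ; v → Z }) (into m ku) (into m kw) (into m k)
          where m = ⟦O,u,v,Z⟧
        hO w  k = 3-cyclic (reframe F m λ { O → vertex O ; Z → vertex u ; u → kw ; v → vertex Z })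
          (into m ku) (into m (vertex v)) (into m k)
          where m = ⟦O,u,2u-v,Z⟧
        finish : Located S g (Spiked ⟨ + 0 , + 2 , -1ℤ ⟩) ⊎ Classified S → Classified S
        finish (inj₁ located) = realise-F₄ W F ku kw located
        finish (inj₂ c)       = c

      star₃⁺ : ∀ n → Seen S g ⟨ + n , + 0 , + 0 ⟩ → (kw : Seen S g (2[ ⟨ + n , + 0 , + 0 ⟩ ]- vₚ)) →
               (∀ {r} → Side (2[ ⟨ + n , + 0 , + 0 ⟩ ]- vₚ) r → Seen S g (2[ r ]- Oₚ) → Classified S) → Classified S
      star₃⁺ n kn kw hO = finish (locate F (F₃-closure (config F) ku (+ n) kw hO (star-Z refl)))
        where
        finish : Located S g (Spiked (2[ ⟨ + n , + 0 , + 0 ⟩ ]- vₚ)) ⊎ Classified S → Classified S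
        finish (inj₁ located) = realise-F₃ W F ku n kn kw located
        finish (inj₂ c)       = c

      -- The point is -v. Doubling v or -v gives four points on the line Ov, a long spike.
      star₃⁰ : Seen S g ⟨ + 0 , + 0 , -1ℤ ⟩ → Classified S
      star₃⁰ kw = star₃⁺ 0 (vertex O) kw hO
        where
        m : Move
        m = ⟦O,v,u,Z⟧
        F′ : Frame S (g ∘ᵤ Move.h m)
        F′ = permute F m λ { O → O ; Z → v ; u → u ; v → Z }
        hO : ∀ {r} → Side ⟨ + 0 , + 0 , -1ℤ ⟩ r → Seen S g (2[ r ]- Oₚ) → Classified S
        hO u  k = star-u k
        hO u′ k = star-u′ k
        hO v  k = long F′ (into m ku) (inj₁ (into m k) , inj₁ (into m kw))
        hO w  k = long F′ (into m ku) (inj₂ (into m k) , inj₁ (into m kw))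

      -- The point is 2Z - v. Doubling v closes the 3-cycle O, Z, v, and doubling the reflected
      -- point closes the same cycle with it in place of v.
      star₃¹ : Seen S g ⟨ + 2 , + 0 , -1ℤ ⟩ → Classified S
      star₃¹ kw = star₃⁺ 1 (vertex Z) kw hO
        where
        hO : ∀ {r} → Side ⟨ + 2 , + 0 , -1ℤ ⟩ r → Seen S g (2[ r ]- Oₚ) → Classified S
        hO u  k = star-u k
        hO u′ k = star-u′ k
        hO v  k = 3-cyclic (permute F m λ { O → O ; Z → Z ; u → v ; v → u }) (into m k₋₁) (into m kw) (into m k)
          where m = ⟦O,Z,v,u⟧
        hO w  k = 3-cyclic (reframe F m λ { O → vertex O ; Z → vertex Z ; u → kw ; v → vertex u })
          (into m k₋₁) (into m (vertex v)) (into m k)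
          where m = ⟦O,Z,2Z-v,u⟧

    module _ {g : Uni} (F : Frame S g) (k₋₁ : Seen S g ⟨ -1ℤ , + 0 , + 0 ⟩) (ku : Seen S g ⟨ + 0 , -1ℤ , + 0 ⟩) where
      open Frame F using (vertex)
      open Config (config F) using (between)

      -- Centres at distance at least two from O make the spike long, and k = -1 is the mirror image
      -- of k = 1.
      star₃ : ∀ k → Seen S g ⟨ k , + 0 , + 0 ⟩ → Seen S g (2[ ⟨ k , + 0 , + 0 ⟩ ]- vₚ) → Classified S
      star₃ (+ 0)            kk kw = star₃⁰ F k₋₁ ku kw
      star₃ (+ 1)            kk kw = star₃¹ F k₋₁ ku kw
      star₃ (+ suc (suc n))  kk kw = long F ku
        (inj₁ (between (+ 2) (vertex O) kk (+≤+ z≤n) (+≤+ (s≤s (s≤s z≤n)))) , inj₁ k₋₁)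
      star₃ -[1+ 0 ]         kk kw = star₃¹ (reflected F k₋₁) (into m (vertex Z)) (into m ku) (into m kw)
        where m = ⟦O,2O-Z,u,v⟧
      star₃ -[1+ suc n ]     kk kw = long F ku
        (inj₂ (between -2ℤ kk (vertex O) (-≤- (s≤s z≤n)) -≤+) , inj₁ k₋₁)

    module _ {g : Uni} (F : Frame S g) (k₂ : Seen S g ⟨ + 2 , + 0 , + 0 ⟩) (ku : Seen S g ⟨ + 0 , -1ℤ , + 0 ⟩) where
      open Frame F using (vertex)
      open Config (config F) using (between)

      path-O : ∀ {A : Set} {r q} → Anchored r → Side r q → Seen S g (2[ q ]- Oₚ) → A
      path-O {q = q} anchor s k = ⊥-elim (noO (config F) q (anchored anchor s) k (inj₁ k₂))

      -- The point 2u - Z closes the 3-cycle Z, O, u, since 2Z - O and 2O - u are present.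
      path-u : Seen S g ⟨ -1ℤ , + 2 , + 0 ⟩ → Classified S
      path-u k = 3-cyclic (permute F m λ { O → Z ; Z → O ; u → u ; v → v }) (into m k₂) (into m ku) (into m k)
        where m = ⟦Z,O,u,v⟧

      path-u′ : Seen S g ⟨ -1ℤ , -2ℤ , + 0 ⟩ → Classified S
      path-u′ k = 3-cyclic (reframe F m λ { O → vertex Z ; Z → vertex O ; u → ku ; v → vertex v })
        (into m k₂) (into m (vertex u)) (into m k)
        where m = ⟦Z,O,2O-u,v⟧

      -- With 2Z - O, 2O - u and 2u - v present, the step 2v - Z closes a cycle of four; for w = 2u
      -- - v the roles of v and w are exchanged.
      path₄ : Seen S g ⟨ + 0 , + 2 , -1ℤ ⟩ → Classified S
      path₄ kw = finish (locate F (F₄-closure (config F) ku kw (path-O refl) hZ))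
        where
        hZ : ∀ {r} → Side ⟨ + 0 , + 2 , -1ℤ ⟩ r → Seen S g (2[ r ]- Zₚ) → Classified S
        hZ u  k = path-u k
        hZ u′ k = path-u′ k
        hZ v  k = 4-cyclic (permute F m λ { O → Z ; Z → O ; u → u ; v → v }) (into m k₂) (into m ku) (into m kw) (into m k)
          where m = ⟦Z,O,u,v⟧
        hZ w  k = 4-cyclic (reframe F m λ { O → vertex Z ; Z → vertex O ; u → vertex u ; v → kw })
          (into m k₂) (into m ku) (into m (vertex v)) (into m k)
          where m = ⟦Z,O,u,2u-v⟧
        finish : Located S g (Spiked ⟨ + 0 , + 2 , -1ℤ ⟩) ⊎ Classified S → Classified S
        finish (inj₁ located) = realise-F₄ W F ku kw located
        finish (inj₂ c)       = c

      path₃⁺ : ∀ n → Seen S g ⟨ + n , + 0 , + 0 ⟩ → (kw : Seen S g (2[ ⟨ + n , + 0 , + 0 ⟩ ]- vₚ)) →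
               (∀ {r} → Side (2[ ⟨ + n , + 0 , + 0 ⟩ ]- vₚ) r → Seen S g (2[ r ]- Zₚ) → Classified S) → Classified S
      path₃⁺ n kn kw hZ = finish (locate F (F₃-closure (config F) ku (+ n) kw (path-O refl) hZ))
        where
        finish : Located S g (Spiked (2[ ⟨ + n , + 0 , + 0 ⟩ ]- vₚ)) ⊎ Classified S → Classified S
        finish (inj₁ located) = realise-F₃ W F ku n kn kw located
        finish (inj₂ c)       = c

      -- The spike contains 0, 1, 2. For k = 0 or k = 2 a step of v or w away from Z closes a
      -- 3-cycle through Z and spike point k; for k = 1 it puts four points on the line Zv. Any
      -- other k makes the spike itself long.
      path₃ : ∀ k → Seen S g ⟨ k , + 0 , + 0 ⟩ → Seen S g (2[ ⟨ k , + 0 , + 0 ⟩ ]- vₚ) → Classified S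
      path₃ (+ 0) kk kw = path₃⁺ 0 kk kw hZ
        where
        hZ : ∀ {r} → Side ⟨ + 0 , + 0 , -1ℤ ⟩ r → Seen S g (2[ r ]- Zₚ) → Classified S
        hZ u  k = path-u k
        hZ u′ k = path-u′ k
        hZ v  k = 3-cyclic (permute F m λ { O → Z ; Z → O ; u → v ; v → u }) (into m k₂) (into m kw) (into m k)
          where m = ⟦Z,O,v,u⟧
        hZ w  k = 3-cyclic (reframe F m λ { O → vertex Z ; Z → vertex O ; u → kw ; v → vertex u })
          (into m k₂) (into m (vertex v)) (into m k)
          where m = ⟦Z,O,2O-v,u⟧
      path₃ (+ 1) kk kw = path₃⁺ 1 kk kw hZ
        where
        m : Move
        m = ⟦Z,v,O,u⟧
        F′ : Frame S (g ∘ᵤ Move.h m)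
        F′ = permute F m λ { O → Z ; Z → v ; u → O ; v → u }
        hZ : ∀ {r} → Side ⟨ + 2 , + 0 , -1ℤ ⟩ r → Seen S g (2[ r ]- Zₚ) → Classified S
        hZ u  k = path-u k
        hZ u′ k = path-u′ k
        hZ v  k = long F′ (into m k₂) (inj₁ (into m k) , inj₁ (into m kw))
        hZ w  k = long F′ (into m k₂) (inj₂ (into m k) , inj₁ (into m kw))
      path₃ (+ 2) kk kw = path₃⁺ 2 kk kw hZ
        where
        hZ : ∀ {r} → Side ⟨ + 4 , + 0 , -1ℤ ⟩ r → Seen S g (2[ r ]- Zₚ) → Classified S
        hZ u  k = path-u k
        hZ u′ k = path-u′ k
        hZ v  k = 3-cyclic (reframe F m λ { O → vertex Z ; Z → k₂ ; u → vertex v ; v → vertex u })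
          (into m (vertex O)) (into m kw) (into m k)
          where m = ⟦Z,2Z-O,v,u⟧
        hZ w  k = 3-cyclic (reframe F m λ { O → vertex Z ; Z → k₂ ; u → kw ; v → vertex u })
          (into m (vertex O)) (into m (vertex v)) (into m k)
          where m = ⟦Z,2Z-O,4Z-2O-v,u⟧
      path₃ (+ suc (suc (suc n))) kk kw = long F ku
        (inj₁ k₂ , inj₂ (between (+ 3) (vertex O) kk (+≤+ z≤n) (+≤+ (s≤s (s≤s (s≤s z≤n))))))
      path₃ -[1+ n ] kk kw = long F ku (inj₁ k₂ , inj₁ (between -1ℤ kk (vertex O) (-≤- z≤n) -≤+))

    module _ {g : Uni} (F : Frame S g) (k₋₁ : Seen S g ⟨ -1ℤ , + 0 , + 0 ⟩) (ku : Seen S g ⟨ + 0 , -1ℤ , + 0 ⟩) where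
      open Frame F using (vertex)

      -- If 2v occurs, the line Ov is the spike of a path, in which -Z is the reflection in O of Z,
      -- the new v; this is `path₃` with k = 0.
      star : Classified S
      star = finish (locate F (F₂-closure (config F) ku hO (star-Z F k₋₁ ku refl)))
        where
        raise : Seen S g ⟨ + 0 , + 0 , + 2 ⟩ → Classified S
        raise k = path₃ (permute F m λ { O → O ; Z → v ; u → u ; v → Z }) (into m k) (into m ku) (+ 0) (into m (vertex O)) (into m k₋₁)
          where m = ⟦O,v,u,Z⟧
        hO : ∀ {r} → Side vₚ r → Seen S g (2[ r ]- Oₚ) → Classified S
        hO u  k = star-u F k₋₁ ku k
        hO u′ k = star-u′ F k₋₁ ku k
        hO v  k = raise k
        hO w  k = raise k
        m′ : Move
        m′ = ⟦O,Z,2O-u,v⟧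
        finish : Located S g (Spiked vₚ) ⊎ (F₃-extension (config F) ku ⊎ F₄-extension (config F) ku ⊎ Classified S) → Classified S
        finish (inj₁ located)                = realise-F₂ W F ku located
        finish (inj₂ (inj₁ (k , kk , kw)))   = star₃ F k₋₁ ku k kk kw
        finish (inj₂ (inj₂ (inj₁ (inj₁ k)))) = star₄ F k₋₁ ku k
        finish (inj₂ (inj₂ (inj₁ (inj₂ k)))) = star₄ (u-reflected F ku) (into m′ k₋₁) (into m′ (vertex u)) (into m′ k)
        finish (inj₂ (inj₂ (inj₂ c)))        = c

    module _ {g : Uni} (F : Frame S g) (k₂ : Seen S g ⟨ + 2 , + 0 , + 0 ⟩) (ku : Seen S g ⟨ + 0 , -1ℤ , + 0 ⟩) where
      open Frame F using (vertex)

      -- If 2v - Z occurs, the line Zv is the spike of a path with O as the new u and u as the new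
      -- v; then 2O - u is the extension that `path₄` expects.
      path : Classified S
      path = finish (locate F (F₂-closure (config F) ku (path-O F k₂ ku refl) hZ))
        where
        raise : Seen S g ⟨ -1ℤ , + 0 , + 2 ⟩ → Classified S
        raise k = path₄ (permute F m λ { O → Z ; Z → v ; u → O ; v → u }) (into m k) (into m k₂) (into m ku)
          where m = ⟦Z,v,O,u⟧
        hZ : ∀ {r} → Side vₚ r → Seen S g (2[ r ]- Zₚ) → Classified S
        hZ u  k = path-u F k₂ ku k
        hZ u′ k = path-u′ F k₂ ku k
        hZ v  k = raise k
        hZ w  k = raise k
        m′ : Move
        m′ = ⟦O,Z,2O-u,v⟧
        finish : Located S g (Spiked vₚ) ⊎ (F₃-extension (config F) ku ⊎ F₄-extension (config F) ku ⊎ Classified S) → Classified S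
        finish (inj₁ located)                = realise-F₂ W F ku located
        finish (inj₂ (inj₁ (k , kk , kw)))   = path₃ F k₂ ku k kk kw
        finish (inj₂ (inj₂ (inj₁ (inj₁ k)))) = path₄ F k₂ ku k
        finish (inj₂ (inj₂ (inj₁ (inj₂ k)))) = path₄ (u-reflected F ku) (into m′ k₂) (into m′ (vertex u)) (into m′ k)
        finish (inj₂ (inj₂ (inj₂ c)))        = c

open Spikes

-- The first step out of the tetrahedron, and the reduction to spikes.

module Classification where

  open import Data.Integer.Tactic.RingSolver using (solve-∀)

  open Uni
  open Seen
  -- The twelve points 2e - e′ for distinct vertices e, e′, in the order O, Z, u, v of e.
  arrows : List Pt
  arrows =
      pt -1ℤ (+ 0) (+ 0) ∷ pt (+ 0) -1ℤ (+ 0) ∷ pt (+ 0) (+ 0) -1ℤ ∷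
      pt (+ 2) (+ 0) (+ 0) ∷ pt (+ 2) -1ℤ (+ 0) ∷ pt (+ 2) (+ 0) -1ℤ ∷
      pt (+ 0) (+ 2) (+ 0) ∷ pt -1ℤ (+ 2) (+ 0) ∷ pt (+ 0) (+ 2) -1ℤ ∷
      pt (+ 0) (+ 0) (+ 2) ∷ pt -1ℤ (+ 0) (+ 2) ∷ pt (+ 0) -1ℤ (+ 2) ∷ []

  -- The lines OZ and uv, which lie on two consecutive planes.
  data Lines : Pt → Set where
    oz : ∀ a → Lines ⟨ a , + 0 , + 0 ⟩
    uv : ∀ b → Lines ⟨ + 0 , b , + 1 - b ⟩

  lines-slab : ∀ {q} → Lines q → (-1ℤ ℤ.≤ y (comb q)) × (y (comb q) ℤ.≤ + 0)
  lines-slab (oz a) = subst (λ t → (-1ℤ ℤ.≤ t) × (t ℤ.≤ + 0)) (sym (cong y (spike-comb a))) (-≤+ , +≤+ z≤n)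
  lines-slab (uv b) = subst (λ t → (-1ℤ ℤ.≤ t) × (t ℤ.≤ + 0))
    (sym (trans (cong y (comb-coordinates (+ 0) b (+ 1 - b))) (identity b))) (-≤- z≤n , -≤+)
    where
    identity : ∀ b → - b - (+ 1 - b) ≡ -1ℤ
    identity = solve-∀

  -- The numbers b and 1 - b have opposite parity.
  uv-anchored : ∀ b → Anchored ⟨ + 0 , b , + 1 - b ⟩
  uv-anchored b with odd b | halve b
  ... | _ | 2m-1 n = refl
  ... | _ | 2m n   = trans (cong odd (identity n)) (odd-2m-1 (+ 1 - n))
    where
    identity : ∀ n → + 1 - (+ 2 * n - + 0) ≡ + 2 * (+ 1 - n) - + 1
    identity = solve-∀

  module _ {K : Pt → Set} (C : Config K) (k₋₁ : K ⟨ -1ℤ , + 0 , + 0 ⟩) where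

    -- The ways off the two lines: reflecting u or v in a point of the spike, or moving a point of
    -- uv away from O. Moving it away from Z is impossible by `noZ`, since -Z is present.
    Departure : Set
    Departure = (∃[ a ] (K ⟨ a , + 0 , + 0 ⟩ × K ⟨ + 2 * a - + 0 , -1ℤ , + 0 ⟩)) ⊎
                (∃[ a ] (K ⟨ a , + 0 , + 0 ⟩ × K ⟨ + 2 * a - + 0 , + 0 , -1ℤ ⟩)) ⊎
                (∃[ b ] (K ⟨ + 0 , b , + 1 - b ⟩ × K (2[ ⟨ + 0 , b , + 1 - b ⟩ ]- Oₚ)))

    lines-closure : ∀ q → K q → Lines q ⊎ Departure
    lines-closure = closure C Lines (λ { O → oz (+ 0) ; Z → oz (+ 1) ; u → uv (+ 1) ; v → uv (+ 0) }) step
      where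
      step-u : ∀ b → + 2 * (+ 1 - b) - + 0 ≡ + 1 - (+ 2 * b - + 1)
      step-u = solve-∀
      step-v : ∀ b → + 2 * (+ 1 - b) - + 1 ≡ + 1 - (+ 2 * b - + 0)
      step-v = solve-∀
      step : ∀ p {e} → Vertex e → Lines p → K p → K (2[ p ]- e) → Lines (2[ p ]- e) ⊎ Departure
      step _ O (oz a) l k = inj₁ (oz _)
      step _ Z (oz a) l k = inj₁ (oz _)
      step _ u (oz a) l k = inj₂ (inj₁ (a , l , k))
      step _ v (oz a) l k = inj₂ (inj₂ (inj₁ (a , l , k)))
      step _ O (uv b) l k = inj₂ (inj₂ (inj₂ (b , l , k)))
      step _ Z (uv b) l k = ⊥-elim (noZ C ⟨ + 0 , b , + 1 - b ⟩ (uv-anchored b) k (inj₁ k₋₁))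
      step _ u (uv b) l k = inj₁ (subst (λ t → Lines ⟨ + 0 , + 2 * b - + 1 , t ⟩) (sym (step-u b)) (uv (+ 2 * b - + 1)))
      step _ v (uv b) l k = inj₁ (subst (λ t → Lines ⟨ + 0 , + 2 * b - + 0 , t ⟩) (sym (step-v b)) (uv (+ 2 * b - + 0)))

  module _ {S : List Pt} (W : WidthGt1 S) where

    -- Moving O along a spike of at least four points to the point in which u is reflected.
    slide : ∀ n {g} → Frame S g → Seen S g ⟨ - (+ n) , + 0 , + 0 ⟩ → Seen S g ⟨ + 2 * (- (+ n)) - + 0 , -1ℤ , + 0 ⟩ →
            ∀ r → Seen S g ⟨ + r , + 0 , + 0 ⟩ → 3 ℕ.≤ n ℕ.+ r → Classified S
    slide zero F _ ku r kr 3≤r = long W F ku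
      (inj₁ (between (+ 2) (vertex O) kr (+≤+ z≤n) (+≤+ (ℕP.≤-trans (s≤s (s≤s z≤n)) 3≤r))) ,
       inj₂ (between (+ 3) (vertex O) kr (+≤+ z≤n) (+≤+ 3≤r)))
      where
      open Frame F using (vertex)
      open Config (config F) using (between)
    slide (suc n) {g} F kn ku r kr 3≤ = slide n
      (reframe F m λ { O → between -1ℤ kn (vertex O) (-≤- z≤n) -≤+ ; Z → vertex O ; u → vertex u ; v → vertex v })
      (into m (subst (λ t → Seen S g ⟨ t , + 0 , + 0 ⟩) (spikes (+ n)) (subst (λ t → Seen S g ⟨ t , + 0 , + 0 ⟩) (ℤP.neg-suc n) kn)))
      (into m (subst (λ t → Seen S g ⟨ t , -1ℤ , + 0 ⟩) (sides (+ n)) (subst (λ t → Seen S g ⟨ + 2 * t - + 0 , -1ℤ , + 0 ⟩) (ℤP.neg-suc n) ku)))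
      (suc r) (into m (subst (λ t → Seen S g ⟨ t , + 0 , + 0 ⟩) (ends (+ r)) kr))
      (subst (3 ℕ.≤_) (sym (ℕP.+-suc n r)) 3≤)
      where
      open Frame F using (vertex)
      open Config (config F) using (between)
      m : Move
      m = ⟦2O-Z,O,u,v⟧
      spikes : ∀ n → -1ℤ + (- n) ≡ + 1 * (- n) + + 1 * + 0 + + 1 * + 0 + -1ℤ
      spikes = solve-∀
      sides : ∀ n → + 2 * (-1ℤ + (- n)) - + 0 ≡ + 1 * (+ 2 * (- n) - + 0) + + 1 * -1ℤ + + 1 * + 0 + -1ℤ
      sides = solve-∀
      ends : ∀ r → r ≡ + 1 * (+ 1 + r) + + 1 * + 0 + + 1 * + 0 + -1ℤ
      ends = solve-∀

    module _ {g : Uni} (F : Frame S g) (k₋₁ : Seen S g ⟨ -1ℤ , + 0 , + 0 ⟩) where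
      open Frame F using (vertex)

      -- The spike contains -1, 0, 1. Reflecting u in the middle gives a star and in an end a path,
      -- after a renaming of O and Z; a centre further out makes the spike have four points, and O
      -- slides to it.
      side : ∀ a → Seen S g ⟨ a , + 0 , + 0 ⟩ → Seen S g ⟨ + 2 * a - + 0 , -1ℤ , + 0 ⟩ → Classified S
      side (+ 0) ka ku = star W F k₋₁ ku
      side (+ 1) ka ku = path W (permute F m λ { O → Z ; Z → O ; u → u ; v → v }) (into m k₋₁) (into m ku)
        where m = ⟦Z,O,u,v⟧
      side (+ suc (suc n)) ka ku = slide (suc (suc n)) (reflected F k₋₁)
        (into m (neg-spike (+ suc (suc n)) ka)) (into m (neg-u (+ suc (suc n)) ku)) 1 (into m k₋₁)
        (s≤s (s≤s (ℕP.m≤n+m 1 n)))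
        where m = ⟦O,2O-Z,u,v⟧
      side -[1+ 0 ] ka ku = path W (reframe F m λ { O → k₋₁ ; Z → vertex O ; u → vertex u ; v → vertex v })
        (into m (vertex Z)) (into m ku)
        where m = ⟦2O-Z,O,u,v⟧
      side -[1+ suc n ] ka ku = slide (suc (suc n)) F ka ku 1 (vertex Z) (s≤s (s≤s (ℕP.m≤n+m 1 n)))

    module _ {g : Uni} (F : Frame S g) (k₋₁ : Seen S g ⟨ -1ℤ , + 0 , + 0 ⟩) where
      open Frame F using (vertex)

      -- For the ends v and u of uv the doubled vertex starts a path with -Z as the reflected point.
      -- Otherwise uv has a point beyond u or v; then the two lines change roles, that end becomes
      -- the origin, and O is reflected in a point of the new spike, as in `side`.
      opposite : ∀ b → Seen S g ⟨ + 0 , b , + 1 - b ⟩ → Seen S g (2[ ⟨ + 0 , b , + 1 - b ⟩ ]- Oₚ) → Classified S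
      opposite (+ 0) kb k = path W (permute F m λ { O → O ; Z → v ; u → Z ; v → u }) (into m k) (into m k₋₁)
        where m = ⟦O,v,Z,u⟧
      opposite (+ 1) kb k = path W (permute F m λ { O → O ; Z → u ; u → Z ; v → v }) (into m k) (into m k₋₁)
        where m = ⟦O,u,Z,v⟧
      opposite b@(+ suc (suc n)) kb k = side F′ (Config.between (config F′) -1ℤ kb′ (Frame.vertex F′ O) (-≤- z≤n) -≤+) (+ 1 - b) kb′
        (into m (subst₂ (λ s t → Seen S g ⟨ + 0 , s , t ⟩) (side₁ b) (side₂ b) k))
        where
        m : Move
        m = ⟦u,v,O,Z⟧
        F′ : Frame S (g ∘ᵤ Move.h m)
        F′ = permute F m λ { O → u ; Z → v ; u → O ; v → Z }
        spike₁ : ∀ b → b ≡ -1ℤ * (+ 1 - b) + -1ℤ * + 0 + -1ℤ * + 0 + + 1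
        spike₁ = solve-∀
        spike₂ : ∀ b → + 1 - b ≡ + 1 * (+ 1 - b) + + 0 * + 0 + + 0 * + 0 + + 0
        spike₂ = solve-∀
        side₁ : ∀ b → + 2 * b - + 0 ≡ -1ℤ * (+ 2 * (+ 1 - b) - + 0) + -1ℤ * -1ℤ + -1ℤ * + 0 + + 1
        side₁ = solve-∀
        side₂ : ∀ b → + 2 * (+ 1 - b) - + 0 ≡ + 1 * (+ 2 * (+ 1 - b) - + 0) + + 0 * -1ℤ + + 0 * + 0 + + 0
        side₂ = solve-∀
        kb′ : Seen S (g ∘ᵤ Move.h m) ⟨ + 1 - b , + 0 , + 0 ⟩
        kb′ = into m (subst₂ (λ s t → Seen S g ⟨ + 0 , s , t ⟩) (spike₁ b) (spike₂ b) kb)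
      opposite b@(-[1+ n ]) kb k = side F′ (Config.between (config F′) -1ℤ kb′ (Frame.vertex F′ O) (-≤- z≤n) -≤+) b kb′
        (into m (subst₂ (λ s t → Seen S g ⟨ + 0 , s , t ⟩) (side₁ b) (side₂ b) k))
        where
        m : Move
        m = ⟦v,u,O,Z⟧
        F′ : Frame S (g ∘ᵤ Move.h m)
        F′ = permute F m λ { O → v ; Z → u ; u → O ; v → Z }
        spike₁ : ∀ b → b ≡ + 1 * b + + 0 * + 0 + + 0 * + 0 + + 0
        spike₁ = solve-∀
        spike₂ : ∀ b → + 1 - b ≡ -1ℤ * b + -1ℤ * + 0 + -1ℤ * + 0 + + 1
        spike₂ = solve-∀
        side₁ : ∀ b → + 2 * b - + 0 ≡ + 1 * (+ 2 * b - + 0) + + 0 * -1ℤ + + 0 * + 0 + + 0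
        side₁ = solve-∀
        side₂ : ∀ b → + 2 * (+ 1 - b) - + 0 ≡ -1ℤ * (+ 2 * b - + 0) + -1ℤ * -1ℤ + -1ℤ * + 0 + + 1
        side₂ = solve-∀
        kb′ : Seen S (g ∘ᵤ Move.h m) ⟨ b , + 0 , + 0 ⟩
        kb′ = into m (subst₂ (λ s t → Seen S g ⟨ + 0 , s , t ⟩) (spike₁ b) (spike₂ b) kb)

      -- The width forbids that all points stay on OZ and uv, so some departure exists.
      arrow : Classified S
      arrow = finish (locate F (lines-closure (config F) k₋₁))
        where
        finish : Located S g Lines ⊎ Departure (config F) k₋₁ → Classified S
        finish (inj₁ located)                        = ⊥-elim (wide-y {g = g} {Lines} W located -1ℤ lines-slab)
        finish (inj₂ (inj₁ (a , ka , k)))            = side F k₋₁ a ka k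
        finish (inj₂ (inj₂ (inj₁ (a , ka , k))))     = side (permute F m λ { O → O ; Z → Z ; u → v ; v → u }) (into m k₋₁) a
          (into m (subst (λ t → Seen S g ⟨ t , + 0 , + 0 ⟩) (spikes a) ka)) (into m (subst (λ t → Seen S g ⟨ t , + 0 , -1ℤ ⟩) (sides a) k))
          where
          m : Move
          m = ⟦O,Z,v,u⟧
          spikes : ∀ a → a ≡ + 1 * a + + 0 * + 0 + + 0 * + 0 + + 0
          spikes = solve-∀
          sides : ∀ a → + 2 * a - + 0 ≡ + 1 * (+ 2 * a - + 0) + + 0 * -1ℤ + + 0 * + 0 + + 0
          sides = solve-∀
        finish (inj₂ (inj₂ (inj₂ (b , kb , k))))     = opposite b kb k

    arrow-exit : ∀ {g} → Frame S g → ∃[ r ] (r ∈ arrows × Seen S g r) → Classified S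
    arrow-exit F (_ , 0th , k) = arrow F k
    arrow-exit F (_ , 1st , k) = arrow (permute F ⟦O,u,Z,v⟧ λ { O → O ; Z → u ; u → Z ; v → v }) (into ⟦O,u,Z,v⟧ k)
    arrow-exit F (_ , 2nd , k) = arrow (permute F ⟦O,v,Z,u⟧ λ { O → O ; Z → v ; u → Z ; v → u }) (into ⟦O,v,Z,u⟧ k)
    arrow-exit F (_ , 3rd , k) = arrow (permute F ⟦Z,O,u,v⟧ λ { O → Z ; Z → O ; u → u ; v → v }) (into ⟦Z,O,u,v⟧ k)
    arrow-exit F (_ , 4th , k) = arrow (permute F ⟦Z,u,O,v⟧ λ { O → Z ; Z → u ; u → O ; v → v }) (into ⟦Z,u,O,v⟧ k)
    arrow-exit F (_ , there 4th , k) = arrow (permute F ⟦Z,v,O,u⟧ λ { O → Z ; Z → v ; u → O ; v → u }) (into ⟦Z,v,O,u⟧ k)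
    arrow-exit F (_ , there (there 4th) , k) = arrow (permute F ⟦u,O,Z,v⟧ λ { O → u ; Z → O ; u → Z ; v → v }) (into ⟦u,O,Z,v⟧ k)
    arrow-exit F (_ , there (there (there 4th)) , k) = arrow (permute F ⟦u,Z,O,v⟧ λ { O → u ; Z → Z ; u → O ; v → v }) (into ⟦u,Z,O,v⟧ k)
    arrow-exit F (_ , there (there (there (there 4th))) , k) = arrow (permute F ⟦u,v,O,Z⟧ λ { O → u ; Z → v ; u → O ; v → Z }) (into ⟦u,v,O,Z⟧ k)
    arrow-exit F (_ , there (there (there (there (there 4th)))) , k) = arrow (permute F ⟦v,O,Z,u⟧ λ { O → v ; Z → O ; u → Z ; v → u }) (into ⟦v,O,Z,u⟧ k)
    arrow-exit F (_ , there (there (there (there (there (there 4th))))) , k) = arrow (permute F ⟦v,Z,O,u⟧ λ { O → v ; Z → Z ; u → O ; v → u }) (into ⟦v,Z,O,u⟧ k)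
    arrow-exit F (_ , there (there (there (there (there (there (there 4th)))))) , k) = arrow (permute F ⟦v,u,O,Z⟧ λ { O → v ; Z → u ; u → O ; v → Z }) (into ⟦v,u,O,Z⟧ k)

    -- The four vertices alone lie in 0 ≤ z ≤ 1. Depth 0 suffices since every first step between
    -- distinct vertices is an exit, and up to a permutation it is 2O - Z.
    classify : ∀ {g} → Frame S g → Classified S
    classify {g} F = finish (locate F (finite-closure (config F) 0 vertices arrows
        (vertex O ∷ vertex Z ∷ vertex u ∷ vertex v ∷ [])))
      where
      open Frame F using (vertex)
      slab : ∀ {q} → q ∈ vertices → (+ 0 ℤ.≤ z (comb q)) × (z (comb q) ℤ.≤ + 1)
      slab 0th = +≤+ z≤n , +≤+ z≤n
      slab 1st = +≤+ z≤n , +≤+ (s≤s z≤n)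
      slab 2nd = +≤+ z≤n , +≤+ z≤n
      slab 3rd = +≤+ z≤n , +≤+ (s≤s z≤n)
      finish : Located S g (_∈ vertices) ⊎ (∃[ r ] (r ∈ arrows × Seen S g r)) → Classified S
      finish (inj₁ located) = ⊥-elim (wide-z {g = g} {_∈ vertices} W located (+ 0) slab)
      finish (inj₂ exit)    = arrow-exit F exit

open Classification

-- Parity of sums and products, and integer combinations of total zero.

module Combinations where

  open import Data.Integer.Tactic.RingSolver using (solve-∀)

  odd-2m : ∀ m → odd (+ 2 * m - + 0) ≡ false
  odd-2m m = trans (cong odd (ℤP.+-identityʳ (+ 2 * m))) (2*m-odd m)

  odd-+ : ∀ a b → odd (a + b) ≡ odd a xor odd b
  odd-+ a b with odd a | halve a | odd b | halve b
  ... | _ | 2m m   | _ | 2m n   = trans (cong odd (identity m n)) (odd-2m (m + n))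
    where
    identity : ∀ m n → (+ 2 * m - + 0) + (+ 2 * n - + 0) ≡ + 2 * (m + n) - + 0
    identity = solve-∀
  ... | _ | 2m m   | _ | 2m-1 n = trans (cong odd (identity m n)) (odd-2m-1 (m + n))
    where
    identity : ∀ m n → (+ 2 * m - + 0) + (+ 2 * n - + 1) ≡ + 2 * (m + n) - + 1
    identity = solve-∀
  ... | _ | 2m-1 m | _ | 2m n   = trans (cong odd (identity m n)) (odd-2m-1 (m + n))
    where
    identity : ∀ m n → (+ 2 * m - + 1) + (+ 2 * n - + 0) ≡ + 2 * (m + n) - + 1
    identity = solve-∀
  ... | _ | 2m-1 m | _ | 2m-1 n = trans (cong odd (identity m n)) (odd-2m (m + n - + 1))
    where
    identity : ∀ m n → (+ 2 * m - + 1) + (+ 2 * n - + 1) ≡ + 2 * (m + n - + 1) - + 0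
    identity = solve-∀

  odd-* : ∀ a b → odd (a * b) ≡ odd a ∧ odd b
  odd-* a b with odd a | halve a | odd b | halve b
  ... | _ | 2m m   | _ | _ = trans (cong odd (identity m b)) (odd-2m (m * b))
    where
    identity : ∀ m b → (+ 2 * m - + 0) * b ≡ + 2 * (m * b) - + 0
    identity = solve-∀
  ... | _ | 2m-1 m | _ | 2m n   = trans (cong odd (identity m n)) (odd-2m ((+ 2 * m - + 1) * n))
    where
    identity : ∀ m n → (+ 2 * m - + 1) * (+ 2 * n - + 0) ≡ + 2 * ((+ 2 * m - + 1) * n) - + 0
    identity = solve-∀
  ... | _ | 2m-1 m | _ | 2m-1 n = trans (cong odd (identity m n)) (odd-2m-1 (+ 2 * (m * n) - m - n + + 1))
    where
    identity : ∀ m n → (+ 2 * m - + 1) * (+ 2 * n - + 1) ≡ + 2 * (+ 2 * (m * n) - m - n + + 1) - + 1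
    identity = solve-∀

  odd-neg : ∀ a → odd (- a) ≡ odd a
  odd-neg a = trans (cong odd (identity a)) (odd-* -1ℤ a)
    where
    identity : ∀ a → - a ≡ -1ℤ * a
    identity = solve-∀

  odd-- : ∀ a b → odd (a - b) ≡ odd a xor odd b
  odd-- a b = trans (odd-+ a (- b)) (cong (odd a xor_) (odd-neg b))

  half-even : ∀ n → odd n ≡ false → ∃[ m ] n ≡ m + m
  half-even n e with odd n | halve n
  ... | _ | 2m m = m , identity m
    where
    identity : ∀ m → + 2 * m - + 0 ≡ m + m
    identity = solve-∀

  half-odd : ∀ n → odd n ≡ true → ∃[ m ] n ≡ m + m + + 1
  half-odd n e with odd n | halve n
  ... | _ | 2m-1 m = m - + 1 , identity m
    where
    identity : ∀ m → + 2 * m - + 1 ≡ (m - + 1) + (m - + 1) + + 1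
    identity = solve-∀

  e₁ e₂ e₃ : Pt
  e₁ = pt (+ 1) (+ 0) (+ 0)
  e₂ = pt (+ 0) (+ 1) (+ 0)
  e₃ = pt (+ 0) (+ 0) (+ 1)

  -- `LinLattice S` is `Lin (LatPt S)`; the predicate is a parameter because the same combinations
  -- are needed in sublattice coordinates.
  Lin : (Pt → Set) → Pt → Set
  Lin A p = ∃[ ls ] (All (λ lp → A (proj₂ lp)) ls × intSum ls ≡ + 0 × intComb ls ≡ p)

  intSum-++ : ∀ ls ms → intSum (ls ++ ms) ≡ intSum ls + intSum ms
  intSum-++ []             ms = sym (ℤP.+-identityˡ _)
  intSum-++ ((l , _) ∷ ls) ms = trans (cong (λ t → l + t) (intSum-++ ls ms)) (sym (ℤP.+-assoc l _ _))

  ⊕-assoc : ∀ p q r → (p ⊕ q) ⊕ r ≡ p ⊕ (q ⊕ r)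
  ⊕-assoc p q r = V3-≡ (ℤP.+-assoc (x p) (x q) (x r)) (ℤP.+-assoc (y p) (y q) (y r)) (ℤP.+-assoc (z p) (z q) (z r))

  intComb-++ : ∀ ls ms → intComb (ls ++ ms) ≡ intComb ls ⊕ intComb ms
  intComb-++ []             ms = sym (V3-≡ (ℤP.+-identityˡ _) (ℤP.+-identityˡ _) (ℤP.+-identityˡ _))
  intComb-++ ((l , p) ∷ ls) ms = trans (cong ((l ⊙ p) ⊕_) (intComb-++ ls ms)) (sym (⊕-assoc (l ⊙ p) _ _))

  lin-⊕ : ∀ {A p q} → Lin A p → Lin A q → Lin A (p ⊕ q)
  lin-⊕ (ls , hs , s , refl) (ms , ks , t , refl) =
    ls ++ ms , ++⁺ hs ks , trans (intSum-++ ls ms) (cong₂ _+_ s t) , intComb-++ ls ms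

  lin-⊙ : ∀ {A p} n → Lin A p → Lin A (n ⊙ p)
  lin-⊙ {A} n (ls , hs , s , refl) = map scaled ls , all-scaled ls hs , trans (sums ls) (trans (cong (n *_) s) (ℤP.*-zeroʳ n)) , combs ls
    where
    scaled : ℤ × Pt → ℤ × Pt
    scaled (l , p) = n * l , p
    all-scaled : ∀ ls → All (λ lp → A (proj₂ lp)) ls → All (λ lp → A (proj₂ lp)) (map scaled ls)
    all-scaled []       []       = []
    all-scaled (_ ∷ ls) (h ∷ hs) = h ∷ all-scaled ls hs
    sums : ∀ ls → intSum (map scaled ls) ≡ n * intSum ls
    sums []             = sym (ℤP.*-zeroʳ n)
    sums ((l , _) ∷ ls) = trans (cong (λ t → n * l + t) (sums ls)) (sym (ℤP.*-distribˡ-+ n l _))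
    step : ∀ n l p q → n * l * p + n * q ≡ n * (l * p + q)
    step = solve-∀
    combs : ∀ ls → intComb (map scaled ls) ≡ n ⊙ intComb ls
    combs []             = sym (V3-≡ (ℤP.*-zeroʳ n) (ℤP.*-zeroʳ n) (ℤP.*-zeroʳ n))
    combs ((l , p) ∷ ls) = trans (cong (((n * l) ⊙ p) ⊕_) (combs ls))
      (V3-≡ (step n l (x p) _) (step n l (y p) _) (step n l (z p) _))

  lin-difference : ∀ {A p q} → A p → A q → Lin A (p ⊖ q)
  lin-difference {A} {p} {q} hp hq = (+ 1 , p) ∷ (-1ℤ , q) ∷ [] , hp ∷ hq ∷ [] , refl ,
    V3-≡ (identity (x p) (x q)) (identity (y p) (y q)) (identity (z p) (z q))
    where
    identity : ∀ p q → + 1 * p + (-1ℤ * q + + 0) ≡ p + -1ℤ * q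
    identity = solve-∀

  -- If ψ were even on every term, it would be even on the combination; the given list is searched
  -- for the first odd value.
  odd-witness : ∀ {A p} (ψ : Pt → ℤ) → ψ 𝟎 ≡ + 0 → (∀ l p q → ψ ((l ⊙ p) ⊕ q) ≡ l * ψ p + ψ q) →
                Lin A p → odd (ψ p) ≡ true → ∃[ q ] (A q × odd (ψ q) ≡ true)
  odd-witness {A} ψ ψ0 additive (ls , hs , _ , refl) = go ls hs
    where
    go : ∀ ls → All (λ lp → A (proj₂ lp)) ls → odd (ψ (intComb ls)) ≡ true → ∃[ q ] (A q × odd (ψ q) ≡ true)
    go []             []       h = ⊥-elim (false≢true (trans (sym (cong odd ψ0)) h))
    go ((l , p) ∷ ls) (a ∷ hs) h with odd (ψ p) in e
    ... | true  = p , a , e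
    ... | false = go ls hs (trans (sym (trans (cong odd (additive l p (intComb ls)))
      (trans (odd-+ (l * ψ p) (ψ (intComb ls))) (cong (_xor odd (ψ (intComb ls)))
        (trans (odd-* l (ψ p)) (trans (cong (odd l ∧_) e) (∧-zeroʳ (odd l)))))))) h)

open Combinations

-- Finding a tetrahedron with one corner in each class modulo 2.

module Tetrahedra where

  open import Data.Integer.Tactic.RingSolver using (solve-∀)

  infixl 6 _⊝_
  _⊝_ : Pt → Pt → Pt
  p ⊝ q = ⟨ x p - x q , y p - y q , z p - z q ⟩

  det : Pt → Pt → Pt → ℤ
  det p q r = x p * (y q * z r - z q * y r) - y p * (x q * z r - z q * x r) + z p * (x q * y r - y q * x r)

  pattern #0 = zero
  pattern #1 = suc zero
  pattern #2 = suc #1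
  pattern #3 = suc #2

  vol : (Fin 4 → Pt) → ℤ
  vol p = det (p #1 ⊝ p #0) (p #2 ⊝ p #0) (p #3 ⊝ p #0)

  -- A stands for the lattice points of the polytope, in coordinates for the
  -- sublattice they generate; e₁ is twice a point outside the sublattice.
  sum₄ : (Fin 4 → Pt) → Pt
  sum₄ p = (p #0 ⊕ p #1) ⊕ (p #2 ⊕ p #3)

  -- `rule` expresses that the other coset is empty: if p + q is congruent to e₁ modulo 2, the
  -- midpoint is a lattice point of the polytope outside the sublattice.
  record Lattice (A : Pt → Set) : Set where
    field
      mid    : ∀ {p q} m → p ⊕ q ≡ m ⊕ m → A p → A q → A m
      rule   : ∀ {p q} m → p ⊕ q ≡ (m ⊕ m) ⊕ e₁ → A p → A q → ⊥
      origin : A 𝟎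
      gen₁   : Lin A e₁
      gen₂   : Lin A e₂
      gen₃   : Lin A e₃

  -- `halving` says that the corners represent all classes modulo 2 in `A`, and `odd-vol` that they
  -- are affinely independent modulo 2. `total` records that the class of e₁ is their sum, from
  -- which the half-integral coset of a frame arises.
  record Tetra (A : Pt → Set) : Set where
    field
      p       : Fin 4 → Pt
      inA     : ∀ i → A (p i)
      halving : ∀ q → A q → ∃[ j ] ∃[ m ] q ⊕ p j ≡ m ⊕ m
      total   : ∃[ s ] sum₄ p ≡ (s ⊕ s) ⊕ e₁
      odd-vol : odd (vol p) ≡ true

  -- Fixing e₁ preserves `rule` and `total`; preserving determinants keeps `odd-vol`.
  record Shear : Set where
    field
      f f⁻¹    : Pt → Pt
      linear   : ∀ p q → f (p ⊕ q) ≡ f p ⊕ f q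
      linear⁻¹ : ∀ l p q → f⁻¹ ((l ⊙ p) ⊕ q) ≡ (l ⊙ f⁻¹ p) ⊕ f⁻¹ q
      f-f⁻¹    : ∀ p → f (f⁻¹ p) ≡ p
      f⁻¹-f    : ∀ p → f⁻¹ (f p) ≡ p
      f-e₁     : f e₁ ≡ e₁
      f-0      : f 𝟎 ≡ 𝟎
      f⁻¹-0    : f⁻¹ 𝟎 ≡ 𝟎
      f-⊝      : ∀ p q → f p ⊝ f q ≡ f (p ⊝ q)
      f-det    : ∀ p q r → det (f p) (f q) (f r) ≡ det p q r

  shear-k : ℤ → ℤ → Shear
  shear-k m n = record
    { f   = λ p → ⟨ x p + (m * y p + n * z p) , y p , z p ⟩
    ; f⁻¹ = λ p → ⟨ x p - (m * y p + n * z p) , y p , z p ⟩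
    ; linear   = λ p q → V3-≡ (i₁ m n (x p) (x q) (y p) (y q) (z p) (z q)) refl refl
    ; linear⁻¹ = λ l p q → V3-≡ (i₂ m n l (x p) (x q) (y p) (y q) (z p) (z q)) refl refl
    ; f-f⁻¹    = λ p → V3-≡ (i₃ (x p) (m * y p + n * z p)) refl refl
    ; f⁻¹-f    = λ p → V3-≡ (i₉ (x p) (m * y p + n * z p)) refl refl
    ; f-e₁     = V3-≡ (i₄ m n) refl refl
    ; f-0      = V3-≡ (i₅ m n) refl refl
    ; f⁻¹-0    = V3-≡ (i₆ m n) refl refl
    ; f-⊝      = λ p q → V3-≡ (i₇ m n (x p) (x q) (y p) (y q) (z p) (z q)) refl refl
    ; f-det    = λ p q r → i₈ m n (x p) (y p) (z p) (x q) (y q) (z q) (x r) (y r) (z r)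
    }
    where
    i₁ : ∀ m n a a′ b b′ c c′ → (a + a′) + (m * (b + b′) + n * (c + c′)) ≡ (a + (m * b + n * c)) + (a′ + (m * b′ + n * c′))
    i₁ = solve-∀
    i₂ : ∀ m n l a a′ b b′ c c′ → (l * a + a′) - (m * (l * b + b′) + n * (l * c + c′)) ≡ l * (a - (m * b + n * c)) + (a′ - (m * b′ + n * c′))
    i₂ = solve-∀
    i₃ : ∀ a t → a - t + t ≡ a
    i₃ = solve-∀
    i₉ : ∀ a t → a + t - t ≡ a
    i₉ = solve-∀
    i₄ : ∀ m n → + 1 + (m * + 0 + n * + 0) ≡ + 1
    i₄ = solve-∀
    i₅ : ∀ m n → + 0 + (m * + 0 + n * + 0) ≡ + 0
    i₅ = solve-∀
    i₆ : ∀ m n → + 0 - (m * + 0 + n * + 0) ≡ + 0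
    i₆ = solve-∀
    i₇ : ∀ m n a a′ b b′ c c′ → (a + (m * b + n * c)) - (a′ + (m * b′ + n * c′)) ≡ (a - a′) + (m * (b - b′) + n * (c - c′))
    i₇ = solve-∀
    i₈ : ∀ m n a b c d e f g h i →
      (a + (m * b + n * c)) * (e * i - f * h) - b * ((d + (m * e + n * f)) * i - f * (g + (m * h + n * i))) +
        c * ((d + (m * e + n * f)) * h - e * (g + (m * h + n * i))) ≡
      a * (e * i - f * h) - b * (d * i - f * g) + c * (d * h - e * g)
    i₈ = solve-∀

  shear-y : ℤ → Shear
  shear-y n = record
    { f   = λ p → ⟨ x p , y p + n * z p , z p ⟩
    ; f⁻¹ = λ p → ⟨ x p , y p - n * z p , z p ⟩
    ; linear   = λ p q → V3-≡ refl (i₁ n (y p) (y q) (z p) (z q)) refl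
    ; linear⁻¹ = λ l p q → V3-≡ refl (i₂ n l (y p) (y q) (z p) (z q)) refl
    ; f-f⁻¹    = λ p → V3-≡ refl (i₃ (y p) (n * z p)) refl
    ; f⁻¹-f    = λ p → V3-≡ refl (i₉ (y p) (n * z p)) refl
    ; f-e₁     = V3-≡ refl (i₅ n) refl
    ; f-0      = V3-≡ refl (i₅ n) refl
    ; f⁻¹-0    = V3-≡ refl (i₆ n) refl
    ; f-⊝      = λ p q → V3-≡ refl (i₇ n (y p) (y q) (z p) (z q)) refl
    ; f-det    = λ p q r → i₈ n (x p) (y p) (z p) (x q) (y q) (z q) (x r) (y r) (z r)
    }
    where
    i₁ : ∀ n b b′ c c′ → (b + b′) + n * (c + c′) ≡ (b + n * c) + (b′ + n * c′)
    i₁ = solve-∀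
    i₂ : ∀ n l b b′ c c′ → (l * b + b′) - n * (l * c + c′) ≡ l * (b - n * c) + (b′ - n * c′)
    i₂ = solve-∀
    i₃ : ∀ a t → a - t + t ≡ a
    i₃ = solve-∀
    i₉ : ∀ a t → a + t - t ≡ a
    i₉ = solve-∀
    i₅ : ∀ n → + 0 + n * + 0 ≡ + 0
    i₅ = solve-∀
    i₆ : ∀ n → + 0 - n * + 0 ≡ + 0
    i₆ = solve-∀
    i₇ : ∀ n b b′ c c′ → (b + n * c) - (b′ + n * c′) ≡ (b - b′) + n * (c - c′)
    i₇ = solve-∀
    i₈ : ∀ n a b c d e f g h i →
      a * ((e + n * f) * i - f * (h + n * i)) - (b + n * c) * (d * i - f * g) + c * (d * (h + n * i) - (e + n * f) * g) ≡
      a * (e * i - f * h) - b * (d * i - f * g) + c * (d * h - e * g)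
    i₈ = solve-∀

  shear-z : ℤ → Shear
  shear-z n = record
    { f   = λ p → ⟨ x p , y p , z p + n * y p ⟩
    ; f⁻¹ = λ p → ⟨ x p , y p , z p - n * y p ⟩
    ; linear   = λ p q → V3-≡ refl refl (i₁ n (z p) (z q) (y p) (y q))
    ; linear⁻¹ = λ l p q → V3-≡ refl refl (i₂ n l (z p) (z q) (y p) (y q))
    ; f-f⁻¹    = λ p → V3-≡ refl refl (i₃ (z p) (n * y p))
    ; f⁻¹-f    = λ p → V3-≡ refl refl (i₉ (z p) (n * y p))
    ; f-e₁     = V3-≡ refl refl (i₅ n)
    ; f-0      = V3-≡ refl refl (i₅ n)
    ; f⁻¹-0    = V3-≡ refl refl (i₆ n)
    ; f-⊝      = λ p q → V3-≡ refl refl (i₇ n (z p) (z q) (y p) (y q))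
    ; f-det    = λ p q r → i₈ n (x p) (y p) (z p) (x q) (y q) (z q) (x r) (y r) (z r)
    }
    where
    i₁ : ∀ n b b′ c c′ → (b + b′) + n * (c + c′) ≡ (b + n * c) + (b′ + n * c′)
    i₁ = solve-∀
    i₂ : ∀ n l b b′ c c′ → (l * b + b′) - n * (l * c + c′) ≡ l * (b - n * c) + (b′ - n * c′)
    i₂ = solve-∀
    i₃ : ∀ a t → a - t + t ≡ a
    i₃ = solve-∀
    i₉ : ∀ a t → a + t - t ≡ a
    i₉ = solve-∀
    i₅ : ∀ n → + 0 + n * + 0 ≡ + 0
    i₅ = solve-∀
    i₆ : ∀ n → + 0 - n * + 0 ≡ + 0
    i₆ = solve-∀
    i₇ : ∀ n b b′ c c′ → (b + n * c) - (b′ + n * c′) ≡ (b - b′) + n * (c - c′)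
    i₇ = solve-∀
    i₈ : ∀ n a b c d e f g h i →
      a * (e * (i + n * h) - (f + n * e) * h) - b * (d * (i + n * h) - (f + n * e) * g) + (c + n * b) * (d * h - e * g) ≡
      a * (e * i - f * h) - b * (d * i - f * g) + c * (d * h - e * g)
    i₈ = solve-∀

  lin-all : ∀ {A} → Lattice A → ∀ p → Lin A p
  lin-all {A} L p = subst (Lin A) (V3-≡ (i₁ (x p) (y p) (z p)) (i₂ (x p) (y p) (z p)) (i₃ (x p) (y p) (z p)))
    (lin-⊕ (lin-⊙ (x p) (Lattice.gen₁ L)) (lin-⊕ (lin-⊙ (y p) (Lattice.gen₂ L)) (lin-⊙ (z p) (Lattice.gen₃ L))))
    where
    i₁ : ∀ a b c → a * + 1 + (b * + 0 + c * + 0) ≡ a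
    i₁ = solve-∀
    i₂ : ∀ a b c → a * + 0 + (b * + 1 + c * + 0) ≡ b
    i₂ = solve-∀
    i₃ : ∀ a b c → a * + 0 + (b * + 0 + c * + 1) ≡ c
    i₃ = solve-∀

  module _ {A : Pt → Set} (σ : Shear) where
    open Shear σ

    sheared-lin : ∀ p → Lin A (f p) → Lin (A ∘ f) p
    sheared-lin o (ls , hs , s , e) = map pulled ls , all-pulled ls hs , trans (sums ls) s , trans (combs ls) (trans (cong f⁻¹ e) (f⁻¹-f o))
      where
      pulled : ℤ × Pt → ℤ × Pt
      pulled (l , p) = l , f⁻¹ p
      all-pulled : ∀ ls → All (λ lp → A (proj₂ lp)) ls → All (λ lp → A (f (proj₂ lp))) (map pulled ls)
      all-pulled []             []       = []
      all-pulled ((_ , p) ∷ ls) (h ∷ hs) = subst A (sym (f-f⁻¹ p)) h ∷ all-pulled ls hs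
      sums : ∀ ls → intSum (map pulled ls) ≡ intSum ls
      sums []             = refl
      sums ((l , _) ∷ ls) = cong (λ t → l + t) (sums ls)
      combs : ∀ ls → intComb (map pulled ls) ≡ f⁻¹ (intComb ls)
      combs []             = sym f⁻¹-0
      combs ((l , p) ∷ ls) = trans (cong ((l ⊙ f⁻¹ p) ⊕_) (combs ls)) (sym (linear⁻¹ l p (intComb ls)))

    sheared : Lattice A → Lattice (A ∘ f)
    sheared L = record
      { mid    = λ {p} {q} m e → Lattice.mid L (f m) (trans (sym (linear p q)) (trans (cong f e) (linear m m)))
      ; rule   = λ {p} {q} m e → Lattice.rule L (f m) (trans (sym (linear p q)) (trans (cong f e)
                   (trans (linear (m ⊕ m) e₁) (cong₂ _⊕_ (linear m m) f-e₁))))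
      ; origin = subst A (sym f-0) (Lattice.origin L)
      ; gen₁   = sheared-lin e₁ (lin-all L (f e₁))
      ; gen₂   = sheared-lin e₂ (lin-all L (f e₂))
      ; gen₃   = sheared-lin e₃ (lin-all L (f e₃)) }

    unshear : Tetra (A ∘ f) → Tetra A
    unshear T = record
      { p = f ∘ p ; inA = inA
      ; halving = λ q a → let j , m , e = halving (f⁻¹ q) (subst A (sym (f-f⁻¹ q)) a) in
          j , f m , trans (cong (_⊕ f (p j)) (sym (f-f⁻¹ q))) (trans (sym (linear (f⁻¹ q) (p j))) (trans (cong f e) (linear m m)))
      ; total = let s , e = total in f s , trans (sym (trans (linear _ _) (cong₂ _⊕_ (linear _ _) (linear _ _))))
          (trans (cong f e) (trans (linear (s ⊕ s) e₁) (cong₂ _⊕_ (linear s s) f-e₁)))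
      ; odd-vol = trans (cong odd (trans (cong₃ det (f-⊝ _ _) (f-⊝ _ _) (f-⊝ _ _)) (f-det _ _ _))) odd-vol }
      where
      open Tetra T

  module _ {A : Pt → Set} (L : Lattice A) where
    open Lattice L

    -- Equal second and third parities leave 0 or e₁ as the difference modulo 2, and `rule` excludes
    -- e₁.
    common-midpoint : ∀ {p q} → A p → A q → odd (y p + y q) ≡ false → odd (z p + z q) ≡ false → ∃[ m ] p ⊕ q ≡ m ⊕ m
    common-midpoint {p} {q} hp hq ey ez with odd (x p + x q) in ex
    ... | false = let a , ea = half-even _ ex ; b , eb = half-even _ ey ; c , ec = half-even _ ez in ⟨ a , b , c ⟩ , V3-≡ ea eb ec
    ... | true  = let a , ea = half-odd _ ex ; b , eb = half-even _ ey ; c , ec = half-even _ ez in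
      ⊥-elim (rule ⟨ a , b , c ⟩ (V3-≡ ea (trans eb (sym (ℤP.+-identityʳ (b + b)))) (trans ec (sym (ℤP.+-identityʳ (c + c))))) hp hq)

    not-congruent : ∀ {p q} → A p → odd (x p) ≡ true → A q → odd (x q) ≡ false →
                    odd (y p + y q) ≡ false → odd (z p + z q) ≡ false → ⊥
    not-congruent {p} {q} hp xp hq xq ey ez with common-midpoint hp hq ey ez
    ... | m , e = false≢true (trans (sym (trans (odd-+ (x m) (x m)) (xor-same (odd (x m)))))
      (trans (cong odd (sym (cong x e))) (trans (odd-+ (x p) (x q)) (cong₂ _xor_ xp xq))))

    -- Modulo 2 the corners are 0, e₂, e₃ and e₁ + e₂ + e₃, which exhaust the four pairs of second
    -- and third parities; hence every point of `A` shares the class of a corner.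
    tetra₃ : ∀ {b c d} → A b → A c → A d →
             odd (x b) ≡ false → odd (y b) ≡ true  → odd (z b) ≡ false →
             odd (x c) ≡ false → odd (y c) ≡ false → odd (z c) ≡ true →
             odd (x d) ≡ true  → odd (y d) ≡ true  → odd (z d) ≡ true → Tetra A
    tetra₃ {b} {c} {d} hb hc hd xb yb zb xc yc zc xd yd zd = record
      { p = corner ; inA = corner∈ ; halving = halves ; total = total ; odd-vol = odd-vol }
      where
      corner : Fin 4 → Pt
      corner #0 = 𝟎
      corner #1 = b
      corner #2 = c
      corner #3 = d
      corner∈ : ∀ i → A (corner i)
      corner∈ #0 = origin
      corner∈ #1 = hb
      corner∈ #2 = hc
      corner∈ #3 = hd
      sum : ∀ a b {s t} → odd a ≡ s → odd b ≡ t → odd (a + b) ≡ s xor t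
      sum a b refl refl = odd-+ a b
      halves : ∀ q → A q → ∃[ j ] ∃[ m ] q ⊕ corner j ≡ m ⊕ m
      halves q hq with odd (y q) in ey | odd (z q) in ez
      ... | false | false = #0 , common-midpoint hq origin (sum (y q) (+ 0) ey refl) (sum (z q) (+ 0) ez refl)
      ... | true  | false = #1 , common-midpoint hq hb (sum (y q) (y b) ey yb) (sum (z q) (z b) ez zb)
      ... | false | true  = #2 , common-midpoint hq hc (sum (y q) (y c) ey yc) (sum (z q) (z c) ez zc)
      ... | true  | true  = #3 , common-midpoint hq hd (sum (y q) (y d) ey yd) (sum (z q) (z d) ez zd)
      total : ∃[ s ] (𝟎 ⊕ b) ⊕ (c ⊕ d) ≡ (s ⊕ s) ⊕ e₁
      total =
        let i , ei = half-odd _ (sum (+ 0 + x b) (x c + x d) (sum (+ 0) (x b) refl xb) (sum (x c) (x d) xc xd))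
            j , ej = half-even _ (sum (+ 0 + y b) (y c + y d) (sum (+ 0) (y b) refl yb) (sum (y c) (y d) yc yd))
            k , ek = half-even _ (sum (+ 0 + z b) (z c + z d) (sum (+ 0) (z b) refl zb) (sum (z c) (z d) zc zd))
        in ⟨ i , j , k ⟩ , V3-≡ ei (trans ej (sym (ℤP.+-identityʳ (j + j)))) (trans ek (sym (ℤP.+-identityʳ (k + k))))
      difference : ∀ a b {s t} → odd a ≡ s → odd b ≡ t → odd (a - b) ≡ s xor t
      difference a b refl refl = odd-- a b
      product : ∀ a b {s t} → odd a ≡ s → odd b ≡ t → odd (a * b) ≡ s ∧ t
      product a b refl refl = odd-* a b
      from-0 : ∀ a {s} → odd a ≡ s → odd (a - + 0) ≡ s
      from-0 a refl = cong odd (ℤP.+-identityʳ a)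
      odd-vol : odd (vol corner) ≡ true
      odd-vol = sum (X b * (Y c * Z′ d - Z′ c * Y d) - Y b * (X c * Z′ d - Z′ c * X d)) (Z′ b * (X c * Y d - Y c * X d))
        (difference (X b * (Y c * Z′ d - Z′ c * Y d)) (Y b * (X c * Z′ d - Z′ c * X d))
          (product (X b) (Y c * Z′ d - Z′ c * Y d) Xb (difference (Y c * Z′ d) (Z′ c * Y d) (product (Y c) (Z′ d) Yc Zd) (product (Z′ c) (Y d) Zc Yd)))
          (product (Y b) (X c * Z′ d - Z′ c * X d) Yb (difference (X c * Z′ d) (Z′ c * X d) (product (X c) (Z′ d) Xc Zd) (product (Z′ c) (X d) Zc Xd))))
        (product (Z′ b) (X c * Y d - Y c * X d) Zb (difference (X c * Y d) (Y c * X d) (product (X c) (Y d) Xc Yd) (product (Y c) (X d) Yc Xd)))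
        where
        X Y Z′ : Pt → ℤ
        X q = x q - + 0
        Y q = y q - + 0
        Z′ q = z q - + 0
        Xb = from-0 (x b) xb
        Yb = from-0 (y b) yb
        Zb = from-0 (z b) zb
        Xc = from-0 (x c) xc
        Yc = from-0 (y c) yc
        Zc = from-0 (z c) zc
        Xd = from-0 (x d) xd
        Yd = from-0 (y d) yd
        Zd = from-0 (z d) zd

    -- Since `A` generates e₁ it has a point with odd first coordinate. Three of the four pairs of
    -- remaining parities are taken by 0, b, c with even first coordinate, so this point has all
    -- coordinates odd.
    tetra₂ : ∀ {b c} → A b → A c → odd (x b) ≡ false → odd (y b) ≡ true  → odd (z b) ≡ false →
             odd (x c) ≡ false → odd (y c) ≡ false → odd (z c) ≡ true → Tetra A
    tetra₂ {b} {c} hb hc xb yb zb xc yc zc with odd-witness x refl (λ _ _ _ → refl) gen₁ refl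
    ... | d , hd , xd with odd (y d) in yd | odd (z d) in zd
    ... | true  | true  = tetra₃ hb hc hd xb yb zb xc yc zc xd yd zd
    ... | false | false = ⊥-elim (not-congruent hd xd origin refl (trans (odd-+ (y d) (+ 0)) (cong (_xor false) yd)) (trans (odd-+ (z d) (+ 0)) (cong (_xor false) zd)))
    ... | true  | false = ⊥-elim (not-congruent hd xd hb xb (trans (odd-+ (y d) (y b)) (cong₂ _xor_ yd yb)) (trans (odd-+ (z d) (z b)) (cong₂ _xor_ zd zb)))
    ... | false | true  = ⊥-elim (not-congruent hd xd hc xc (trans (odd-+ (y d) (y c)) (cong₂ _xor_ yd yc)) (trans (odd-+ (z d) (z c)) (cong₂ _xor_ zd zc)))

  bit : Bool → ℤ
  bit true  = + 1
  bit false = + 0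

  odd-bit : ∀ b → odd (bit b) ≡ b
  odd-bit true  = refl
  odd-bit false = refl

  clear : ∀ a b → odd b ≡ true → odd (a - bit (odd a) * b) ≡ false
  clear a b e = trans (odd-- a (bit (odd a) * b)) (trans (cong (odd a xor_)
    (trans (odd-* (bit (odd a)) b) (trans (cong₂ _∧_ (odd-bit (odd a)) e) (∧-identityʳ (odd a))))) (xor-same (odd a)))

  keep : ∀ a n b → odd b ≡ false → odd (a - n * b) ≡ odd a
  keep a n b e = trans (odd-- a (n * b)) (trans (cong (odd a xor_) (trans (odd-* n b) (trans (cong (odd n ∧_) e) (∧-zeroʳ (odd n))))) (xor-identityʳ (odd a)))

  tetra₁ : ∀ {A} → Lattice A → ∀ {b c} → A b → A c → odd (y b) ≡ true  → odd (z b) ≡ false →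
           odd (y c) ≡ false → odd (z c) ≡ true → Tetra A
  tetra₁ {A} L {b} {c} hb hc yb zb yc zc = unshear σ (tetra₂ (sheared σ L) {f⁻¹ b} {f⁻¹ c}
      (subst A (sym (f-f⁻¹ b)) hb) (subst A (sym (f-f⁻¹ c)) hc) xb yb zb xc yc zc)
    where
    σ : Shear
    σ = shear-k (bit (odd (x b))) (bit (odd (x c)))
    open Shear σ
    regroup₁ : ∀ a m b n c → a - (m * b + n * c) ≡ (a - m * b) - n * c
    regroup₁ = solve-∀
    regroup₂ : ∀ a m b n c → a - (m * b + n * c) ≡ (a - n * c) - m * b
    regroup₂ = solve-∀
    xb : odd (x (f⁻¹ b)) ≡ false
    xb = trans (cong odd (regroup₁ (x b) (bit (odd (x b))) (y b) (bit (odd (x c))) (z b)))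
      (trans (keep (x b - bit (odd (x b)) * y b) (bit (odd (x c))) (z b) zb) (clear (x b) (y b) yb))
    xc : odd (x (f⁻¹ c)) ≡ false
    xc = trans (cong odd (regroup₂ (x c) (bit (odd (x b))) (y c) (bit (odd (x c))) (z c)))
      (trans (keep (x c - bit (odd (x c)) * z c) (bit (odd (x b))) (y c) yc) (clear (x c) (z c) zc))

  tetra₀ : ∀ {A} → Lattice A → ∀ {b} → A b → odd (y b) ≡ true → odd (z b) ≡ false → Tetra A
  tetra₀ {A} L {b} hb yb zb with odd-witness z refl (λ _ _ _ → refl) (Lattice.gen₃ L) refl
  ... | c , hc , zc = unshear σ (tetra₁ (sheared σ L) {f⁻¹ b} {f⁻¹ c}
      (subst A (sym (f-f⁻¹ b)) hb) (subst A (sym (f-f⁻¹ c)) hc)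
      (trans (keep (y b) (bit (odd (y c))) (z b) zb) yb) zb (clear (y c) (z c) zc) zc)
    where
    σ : Shear
    σ = shear-y (bit (odd (y c)))
    open Shear σ

  -- Elimination modulo 2: here the third coordinate of b is cleared, in `tetra₀` the second
  -- coordinate of c, in `tetra₁` the first coordinates of both. Each shear is undone on the
  -- resulting tetrahedron.
  tetra : ∀ {A} → Lattice A → Tetra A
  tetra {A} L with odd-witness y refl (λ _ _ _ → refl) (Lattice.gen₂ L) refl
  ... | b , hb , yb = unshear σ (tetra₀ (sheared σ L) {f⁻¹ b} (subst A (sym (f-f⁻¹ b)) hb) yb (clear (z b) (y b) yb))
    where
    σ : Shear
    σ = shear-z (bit (odd (z b)))
    open Shear σ

open Tetrahedra

-- Descent on the volume, until the edges of the tetrahedron generate the sublattice.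

module Descent where

  open import Data.Integer.Tactic.RingSolver using (solve-∀)

  det-half₁ : ∀ c d p q m → p ⊕ q ≡ m ⊕ m → + 2 * det m c d ≡ det p c d + det q c d
  det-half₁ c d p q m e = trans (left (x m) (y m) (z m) (y c * z d - z c * y d) (x c * z d - z c * x d) (x c * y d - y c * x d))
    (trans (cong₃ (λ s t r → s * (y c * z d - z c * y d) - t * (x c * z d - z c * x d) + r * (x c * y d - y c * x d)) (sym (cong x e)) (sym (cong y e)) (sym (cong z e)))
      (right (x p) (y p) (z p) (x q) (y q) (z q) (y c * z d - z c * y d) (x c * z d - z c * x d) (x c * y d - y c * x d)))
    where
    left : ∀ a b c s t r → + 2 * (a * s - b * t + c * r) ≡ (a + a) * s - (b + b) * t + (c + c) * r
    left = solve-∀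
    right : ∀ a b c a′ b′ c′ s t r → (a + a′) * s - (b + b′) * t + (c + c′) * r ≡ (a * s - b * t + c * r) + (a′ * s - b′ * t + c′ * r)
    right = solve-∀

  det-swap₁₂ : ∀ p q r → det p q r ≡ - det q p r
  det-swap₁₂ p q r = identity (x p) (y p) (z p) (x q) (y q) (z q) (x r) (y r) (z r)
    where
    identity : ∀ a b c d e f g h i → a * (e * i - f * h) - b * (d * i - f * g) + c * (d * h - e * g) ≡
               - (d * (b * i - c * h) - e * (a * i - c * g) + f * (a * h - b * g))
    identity = solve-∀

  det-rotate : ∀ p q r → det p q r ≡ det r p q
  det-rotate p q r = identity (x p) (y p) (z p) (x q) (y q) (z q) (x r) (y r) (z r)
    where
    identity : ∀ a b c d e f g h i → a * (e * i - f * h) - b * (d * i - f * g) + c * (d * h - e * g) ≡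
               g * (b * f - c * e) - h * (a * f - c * d) + i * (a * e - b * d)
    identity = solve-∀

  det-repeat : ∀ p q → det p p q ≡ + 0
  det-repeat p q = identity (x p) (y p) (z p) (x q) (y q) (z q)
    where
    identity : ∀ a b c g h i → a * (b * i - c * h) - b * (a * i - c * g) + c * (a * h - b * g) ≡ + 0
    identity = solve-∀

  det-zero : ∀ a q r → det (a ⊝ a) q r ≡ + 0
  det-zero a q r = identity (x a) (y a) (z a) (y q * z r - z q * y r) (x q * z r - z q * x r) (x q * y r - y q * x r)
    where
    identity : ∀ a b c s t r → (a - a) * s - (b - b) * t + (c - c) * r ≡ + 0
    identity = solve-∀

  det-translate : ∀ b c d q → det (b ⊝ q) (c ⊝ q) (d ⊝ q) ≡ det b c d - det q c d - det b q d - det b c q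
  det-translate b c d q = identity (x b) (y b) (z b) (x c) (y c) (z c) (x d) (y d) (z d) (x q) (y q) (z q)
    where
    identity : ∀ a b c d e f g h i j k l →
      (a - j) * ((e - k) * (i - l) - (f - l) * (h - k)) - (b - k) * ((d - j) * (i - l) - (f - l) * (g - j)) + (c - l) * ((d - j) * (h - k) - (e - k) * (g - j)) ≡
      (a * (e * i - f * h) - b * (d * i - f * g) + c * (d * h - e * g)) - (j * (e * i - f * h) - k * (d * i - f * g) + l * (d * h - e * g))
      - (a * (k * i - l * h) - b * (j * i - l * g) + c * (j * h - k * g)) - (a * (e * l - f * k) - b * (d * l - f * j) + c * (d * k - e * j))
    identity = solve-∀

  -- The linear map with columns b, c, d.
  Θ : Pt → Pt → Pt → Pt → Pt
  Θ b c d n = (x n ⊙ b) ⊕ ((y n ⊙ c) ⊕ (z n ⊙ d))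

  cramer : ∀ b c d q → det b c d ⊙ q ≡ Θ b c d ⟨ det q c d , det b q d , det b c q ⟩
  cramer b c d q = V3-≡ (first (x b) (y b) (z b) (x c) (y c) (z c) (x d) (y d) (z d) (x q) (y q) (z q))
    (second (x b) (y b) (z b) (x c) (y c) (z c) (x d) (y d) (z d) (x q) (y q) (z q))
    (third (x b) (y b) (z b) (x c) (y c) (z c) (x d) (y d) (z d) (x q) (y q) (z q))
    where
    first : ∀ a b c d e f g h i j k l → (a * (e * i - f * h) - b * (d * i - f * g) + c * (d * h - e * g)) * j ≡
      (j * (e * i - f * h) - k * (d * i - f * g) + l * (d * h - e * g)) * a +
      ((a * (k * i - l * h) - b * (j * i - l * g) + c * (j * h - k * g)) * d + (a * (e * l - f * k) - b * (d * l - f * j) + c * (d * k - e * j)) * g)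
    first = solve-∀
    second : ∀ a b c d e f g h i j k l → (a * (e * i - f * h) - b * (d * i - f * g) + c * (d * h - e * g)) * k ≡
      (j * (e * i - f * h) - k * (d * i - f * g) + l * (d * h - e * g)) * b +
      ((a * (k * i - l * h) - b * (j * i - l * g) + c * (j * h - k * g)) * e + (a * (e * l - f * k) - b * (d * l - f * j) + c * (d * k - e * j)) * h)
    second = solve-∀
    third : ∀ a b c d e f g h i j k l → (a * (e * i - f * h) - b * (d * i - f * g) + c * (d * h - e * g)) * l ≡
      (j * (e * i - f * h) - k * (d * i - f * g) + l * (d * h - e * g)) * c +
      ((a * (k * i - l * h) - b * (j * i - l * g) + c * (j * h - k * g)) * f + (a * (e * l - f * k) - b * (d * l - f * j) + c * (d * k - e * j)) * i)
    third = solve-∀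

  ⊝-half : ∀ a p q m → p ⊕ q ≡ m ⊕ m → (p ⊝ a) ⊕ (q ⊝ a) ≡ (m ⊝ a) ⊕ (m ⊝ a)
  ⊝-half a p q m e = V3-≡ (component (x a) (x p) (x q) (x m) (cong x e)) (component (y a) (y p) (y q) (y m) (cong y e))
    (component (z a) (z p) (z q) (z m) (cong z e))
    where
    component : ∀ a p q m → p + q ≡ m + m → (p - a) + (q - a) ≡ (m - a) + (m - a)
    component a p q m e = trans (left a p q) (trans (cong (λ t → t - a - a) e) (sym (left a m m)))
      where
      left : ∀ a p q → (p - a) + (q - a) ≡ p + q - a - a
      left = solve-∀

  ⊝-⊝ : ∀ b q a → b ⊝ q ≡ (b ⊝ a) ⊝ (q ⊝ a)
  ⊝-⊝ b q a = V3-≡ (identity (x b) (x q) (x a)) (identity (y b) (y q) (y a)) (identity (z b) (z q) (z a))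
    where
    identity : ∀ b q a → b - q ≡ (b - a) - (q - a)
    identity = solve-∀

  at : ∀ {B : Set} → Fin 4 → B → B → Fin 4 → B
  at j s t i = if does (i Fin.≟ j) then s else t

  at-spec : ∀ {B : Set} j i (s t : B) → (i ≡ j × at j s t i ≡ s) ⊎ at j s t i ≡ t
  at-spec j i s t with i Fin.≟ j
  ... | yes e = inj₁ (e , refl)
  ... | no  _ = inj₂ refl

  sum₄-at : ∀ p j q → sum₄ (λ i → at j q (p i) i) ≡ sum₄ p ⊕ (q ⊝ p j)
  sum₄-at p #0 q = V3-≡ (i (x (p #0)) (x (p #1)) (x (p #2)) (x (p #3)) (x q)) (i (y (p #0)) (y (p #1)) (y (p #2)) (y (p #3)) (y q))
    (i (z (p #0)) (z (p #1)) (z (p #2)) (z (p #3)) (z q))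
    where
    i : ∀ a b c d q → (q + b) + (c + d) ≡ (a + b) + (c + d) + (q - a)
    i = solve-∀
  sum₄-at p #1 q = V3-≡ (i (x (p #0)) (x (p #1)) (x (p #2)) (x (p #3)) (x q)) (i (y (p #0)) (y (p #1)) (y (p #2)) (y (p #3)) (y q))
    (i (z (p #0)) (z (p #1)) (z (p #2)) (z (p #3)) (z q))
    where
    i : ∀ a b c d q → (a + q) + (c + d) ≡ (a + b) + (c + d) + (q - b)
    i = solve-∀
  sum₄-at p #2 q = V3-≡ (i (x (p #0)) (x (p #1)) (x (p #2)) (x (p #3)) (x q)) (i (y (p #0)) (y (p #1)) (y (p #2)) (y (p #3)) (y q))
    (i (z (p #0)) (z (p #1)) (z (p #2)) (z (p #3)) (z q))
    where
    i : ∀ a b c d q → (a + b) + (q + d) ≡ (a + b) + (c + d) + (q - c)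
    i = solve-∀
  sum₄-at p #3 q = V3-≡ (i (x (p #0)) (x (p #1)) (x (p #2)) (x (p #3)) (x q)) (i (y (p #0)) (y (p #1)) (y (p #2)) (y (p #3)) (y q))
    (i (z (p #0)) (z (p #1)) (z (p #2)) (z (p #3)) (z q))
    where
    i : ∀ a b c d q → (a + b) + (c + q) ≡ (a + b) + (c + d) + (q - d)
    i = solve-∀

  ∑∣_∣ : (Fin 4 → ℤ) → ℕ
  ∑∣ Y ∣ = ∣ Y #0 ∣ ℕ.+ (∣ Y #1 ∣ ℕ.+ (∣ Y #2 ∣ ℕ.+ ∣ Y #3 ∣))

  -- The four absolute values add up to at most that of V, and the first already uses all of it.
  dominant : ∀ a b c d V → a + (b + (c + d)) ≡ V → ∣ a ∣ ℕ.+ (∣ b ∣ ℕ.+ (∣ c ∣ ℕ.+ ∣ d ∣)) ℕ.≤ ∣ V ∣ → ∣ V ∣ ℕ.≤ ∣ a ∣ →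
             a ≡ V × b ≡ + 0 × c ≡ + 0 × d ≡ + 0
  dominant a b c d V total le ge = trans (sym a+0) total , b≡0 , c≡0 , d≡0
    where
    rest : ∣ b ∣ ℕ.+ (∣ c ∣ ℕ.+ ∣ d ∣) ≡ 0
    rest = ℕP.n≤0⇒n≡0 (ℕP.+-cancelˡ-≤ ∣ a ∣ _ 0 (ℕP.≤-trans le (ℕP.≤-trans ge (ℕP.≤-reflexive (sym (ℕP.+-identityʳ ∣ a ∣))))))
    b≡0 : b ≡ + 0
    b≡0 = ℤP.∣i∣≡0⇒i≡0 (ℕP.m+n≡0⇒m≡0 ∣ b ∣ rest)
    c≡0 : c ≡ + 0
    c≡0 = ℤP.∣i∣≡0⇒i≡0 (ℕP.m+n≡0⇒m≡0 ∣ c ∣ (ℕP.m+n≡0⇒n≡0 ∣ b ∣ rest))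
    d≡0 : d ≡ + 0
    d≡0 = ℤP.∣i∣≡0⇒i≡0 (ℕP.m+n≡0⇒n≡0 ∣ c ∣ (ℕP.m+n≡0⇒n≡0 ∣ b ∣ rest))
    a+0 : a + (b + (c + d)) ≡ a
    a+0 = trans (cong (λ t → a + t) (cong₂ _+_ b≡0 (cong₂ _+_ c≡0 d≡0))) (ℤP.+-identityʳ a)

  pinned : ∀ (Y : Fin 4 → ℤ) V j → Y #0 + (Y #1 + (Y #2 + Y #3)) ≡ V → ∑∣ Y ∣ ℕ.≤ ∣ V ∣ → ∣ V ∣ ℕ.≤ ∣ Y j ∣ →
           ∀ i → Y i ≡ at j V (+ 0) i
  pinned Y V #0 t le ge with dominant (Y #0) (Y #1) (Y #2) (Y #3) V t le ge
  ... | e₀ , e₁ , e₂ , e₃ = λ { #0 → e₀ ; #1 → e₁ ; #2 → e₂ ; #3 → e₃ }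
  pinned Y V #1 t le ge with dominant (Y #1) (Y #0) (Y #2) (Y #3) V (trans (swap (Y #1) (Y #0) (Y #2 + Y #3)) t)
      (subst (ℕ._≤ ∣ V ∣) (swapℕ (∣ Y #0 ∣) (∣ Y #1 ∣) (∣ Y #2 ∣ ℕ.+ ∣ Y #3 ∣)) le) ge
    where
    swap : ∀ a b c → a + (b + c) ≡ b + (a + c)
    swap = solve-∀
    swapℕ : ∀ a b c → a ℕ.+ (b ℕ.+ c) ≡ b ℕ.+ (a ℕ.+ c)
    swapℕ = ℕSolver.solve-∀
  ... | e₁ , e₀ , e₂ , e₃ = λ { #0 → e₀ ; #1 → e₁ ; #2 → e₂ ; #3 → e₃ }
  pinned Y V #2 t le ge with dominant (Y #2) (Y #0) (Y #1) (Y #3) V (trans (swap (Y #2) (Y #0) (Y #1) (Y #3)) t)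
      (subst (ℕ._≤ ∣ V ∣) (swapℕ (∣ Y #0 ∣) (∣ Y #1 ∣) (∣ Y #2 ∣) (∣ Y #3 ∣)) le) ge
    where
    swap : ∀ c a b d → c + (a + (b + d)) ≡ a + (b + (c + d))
    swap = solve-∀
    swapℕ : ∀ a b c d → a ℕ.+ (b ℕ.+ (c ℕ.+ d)) ≡ c ℕ.+ (a ℕ.+ (b ℕ.+ d))
    swapℕ = ℕSolver.solve-∀
  ... | e₂ , e₀ , e₁ , e₃ = λ { #0 → e₀ ; #1 → e₁ ; #2 → e₂ ; #3 → e₃ }
  pinned Y V #3 t le ge with dominant (Y #3) (Y #0) (Y #1) (Y #2) V (trans (swap (Y #3) (Y #0) (Y #1) (Y #2)) t)
      (subst (ℕ._≤ ∣ V ∣) (swapℕ (∣ Y #0 ∣) (∣ Y #1 ∣) (∣ Y #2 ∣) (∣ Y #3 ∣)) le) ge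
    where
    swap : ∀ d a b c → d + (a + (b + c)) ≡ a + (b + (c + d))
    swap = solve-∀
    swapℕ : ∀ a b c d → a ℕ.+ (b ℕ.+ (c ℕ.+ d)) ≡ d ℕ.+ (a ℕ.+ (b ℕ.+ c))
    swapℕ = ℕSolver.solve-∀
  ... | e₃ , e₀ , e₁ , e₂ = λ { #0 → e₀ ; #1 → e₁ ; #2 → e₂ ; #3 → e₃ }

  ∑-at : ∀ V j → ∑∣ at j V (+ 0) ∣ ≡ ∣ V ∣
  ∑-at V #0 = ℕP.+-identityʳ ∣ V ∣
  ∑-at V #1 = ℕP.+-identityʳ ∣ V ∣
  ∑-at V #2 = ℕP.+-identityʳ ∣ V ∣
  ∑-at V #3 = refl

  ∣half∣ : ∀ m a b → + 2 * m ≡ a + b → ∣ m ∣ ℕ.+ ∣ m ∣ ℕ.≤ ∣ a ∣ ℕ.+ ∣ b ∣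
  ∣half∣ m a b e = subst (ℕ._≤ ∣ a ∣ ℕ.+ ∣ b ∣) (trans (cong ∣_∣ (sym e)) (trans (ℤP.∣i*j∣≡∣i∣*∣j∣ (+ 2) m) (cong (∣ m ∣ ℕ.+_) (ℕP.+-identityʳ ∣ m ∣))))
    (ℤP.∣i+j∣≤∣i∣+∣j∣ a b)

  ∑-half : ∀ (M Y D : Fin 4 → ℤ) → (∀ i → + 2 * M i ≡ Y i + D i) → ∑∣ M ∣ ℕ.+ ∑∣ M ∣ ℕ.≤ ∑∣ Y ∣ ℕ.+ ∑∣ D ∣
  ∑-half M Y D e = subst₂ ℕ._≤_ (regroup (∣ M #0 ∣) (∣ M #1 ∣) (∣ M #2 ∣) (∣ M #3 ∣) (∣ M #0 ∣) (∣ M #1 ∣) (∣ M #2 ∣) (∣ M #3 ∣))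
      (regroup (∣ Y #0 ∣) (∣ Y #1 ∣) (∣ Y #2 ∣) (∣ Y #3 ∣) (∣ D #0 ∣) (∣ D #1 ∣) (∣ D #2 ∣) (∣ D #3 ∣))
      (ℕP.+-mono-≤ (each #0) (ℕP.+-mono-≤ (each #1) (ℕP.+-mono-≤ (each #2) (each #3))))
    where
    each : ∀ i → ∣ M i ∣ ℕ.+ ∣ M i ∣ ℕ.≤ ∣ Y i ∣ ℕ.+ ∣ D i ∣
    each i = ∣half∣ (M i) (Y i) (D i) (e i)
    regroup : ∀ a b c d a′ b′ c′ d′ → (a ℕ.+ a′) ℕ.+ ((b ℕ.+ b′) ℕ.+ ((c ℕ.+ c′) ℕ.+ (d ℕ.+ d′))) ≡
              (a ℕ.+ (b ℕ.+ (c ℕ.+ d))) ℕ.+ (a′ ℕ.+ (b′ ℕ.+ (c′ ℕ.+ d′)))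
    regroup = ℕSolver.solve-∀

  unit : Fin 4 → Pt
  unit #0 = 𝟎
  unit #1 = e₁
  unit #2 = e₂
  unit #3 = e₃

  module _ {A : Pt → Set} (T : Tetra A) where
    open Tetra T

    private
      a B C D : Pt
      a = p #0
      B = p #1 ⊝ a
      C = p #2 ⊝ a
      D = p #3 ⊝ a
      V : ℤ
      V = vol p

    -- V times the barycentric coordinates of q.
    Y : Pt → Fin 4 → ℤ
    Y q #0 = V - det (q ⊝ a) C D - det B (q ⊝ a) D - det B C (q ⊝ a)
    Y q #1 = det (q ⊝ a) C D
    Y q #2 = det B (q ⊝ a) D
    Y q #3 = det B C (q ⊝ a)

    Y-total : ∀ q → Y q #0 + (Y q #1 + (Y q #2 + Y q #3)) ≡ V
    Y-total q = identity V (Y q #1) (Y q #2) (Y q #3)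
      where
      identity : ∀ V a b c → V - a - b - c + (a + (b + c)) ≡ V
      identity = solve-∀

    Y-half : ∀ {q r m} → q ⊕ r ≡ m ⊕ m → ∀ i → + 2 * Y m i ≡ Y q i + Y r i
    Y-half {q} {r} {m} e #1 = det-half₁ C D (q ⊝ a) (r ⊝ a) (m ⊝ a) (⊝-half a q r m e)
    Y-half {q} {r} {m} e #2 = trans (cong (+ 2 *_) (det-swap₁₂ B (m ⊝ a) D)) (trans (negate (det (m ⊝ a) B D))
      (trans (cong -_ (det-half₁ B D (q ⊝ a) (r ⊝ a) (m ⊝ a) (⊝-half a q r m e))) (trans (split (det (q ⊝ a) B D) (det (r ⊝ a) B D))
        (sym (cong₂ _+_ (det-swap₁₂ B (q ⊝ a) D) (det-swap₁₂ B (r ⊝ a) D))))))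
      where
      negate : ∀ t → + 2 * (- t) ≡ - (+ 2 * t)
      negate = solve-∀
      split : ∀ s t → - (s + t) ≡ - s + - t
      split = solve-∀
    Y-half {q} {r} {m} e #3 = trans (cong (+ 2 *_) (det-rotate B C (m ⊝ a))) (trans (det-half₁ B C (q ⊝ a) (r ⊝ a) (m ⊝ a) (⊝-half a q r m e))
      (sym (cong₂ _+_ (det-rotate B C (q ⊝ a)) (det-rotate B C (r ⊝ a)))))
    Y-half {q} {r} {m} e #0 = trans (left V (Y m #1) (Y m #2) (Y m #3))
      (trans (cong₃ (λ s t o → + 2 * V - s - t - o) (Y-half {q} {r} {m} e #1) (Y-half {q} {r} {m} e #2) (Y-half {q} {r} {m} e #3))
        (right V (Y q #1) (Y q #2) (Y q #3) (Y r #1) (Y r #2) (Y r #3)))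
      where
      left : ∀ V a b c → + 2 * (V - a - b - c) ≡ + 2 * V - + 2 * a - + 2 * b - + 2 * c
      left = solve-∀
      right : ∀ V a b c a′ b′ c′ → + 2 * V - (a + a′) - (b + b′) - (c + c′) ≡ (V - a - b - c) + (V - a′ - b′ - c′)
      right = solve-∀

    Y-corner : ∀ j i → Y (p j) i ≡ at j V (+ 0) i
    Y-corner #0 #1 = det-zero a C D
    Y-corner #0 #2 = trans (det-swap₁₂ B (a ⊝ a) D) (cong -_ (det-zero a B D))
    Y-corner #0 #3 = trans (det-rotate B C (a ⊝ a)) (det-zero a B C)
    Y-corner #1 #1 = refl
    Y-corner #1 #2 = det-repeat B D
    Y-corner #1 #3 = trans (det-rotate B C B) (det-repeat B C)
    Y-corner #2 #1 = det-repeat C D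
    Y-corner #2 #2 = refl
    Y-corner #2 #3 = trans (det-rotate B C C) (trans (det-rotate C B C) (det-repeat C B))
    Y-corner #3 #1 = trans (det-rotate D C D) (det-repeat D C)
    Y-corner #3 #2 = trans (det-rotate B D D) (trans (det-rotate D B D) (det-repeat D B))
    Y-corner #3 #3 = refl
    Y-corner #0 #0 = trans (cong₃ (λ s t o → V - s - t - o) (Y-corner #0 #1) (Y-corner #0 #2) (Y-corner #0 #3)) (identity V)
      where
      identity : ∀ V → V - + 0 - + 0 - + 0 ≡ V
      identity = solve-∀
    Y-corner #1 #0 = trans (cong₂ (λ s t → V - V - s - t) (Y-corner #1 #2) (Y-corner #1 #3)) (identity V)
      where
      identity : ∀ V → V - V - + 0 - + 0 ≡ + 0
      identity = solve-∀
    Y-corner #2 #0 = trans (cong₂ (λ s t → V - s - V - t) (Y-corner #2 #1) (Y-corner #2 #3)) (identity V)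
      where
      identity : ∀ V → V - + 0 - V - + 0 ≡ + 0
      identity = solve-∀
    Y-corner #3 #0 = trans (cong₂ (λ s t → V - s - t - V) (Y-corner #3 #1) (Y-corner #3 #2)) (identity V)
      where
      identity : ∀ V → V - + 0 - + 0 - V ≡ + 0
      identity = solve-∀

    V≢0 : ¬ (V ≡ + 0)
    V≢0 e = false≢true (trans (sym (cong odd e)) odd-vol)

    cancel-V : ∀ q r → V ⊙ q ≡ V ⊙ r → q ≡ r
    cancel-V q r e = V3-≡ (ℤP.*-cancelˡ-≡ V (x q) (x r) {{nz}} (cong x e)) (ℤP.*-cancelˡ-≡ V (y q) (y r) {{nz}} (cong y e))
      (ℤP.*-cancelˡ-≡ V (z q) (z r) {{nz}} (cong z e))
      where
      nz : ℤ.NonZero V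
      nz = ℤ.≢-nonZero V≢0

    Y-injective : ∀ {q r} → (∀ i → Y q i ≡ Y r i) → q ≡ r
    Y-injective {q} {r} h = shift (cancel-V (q ⊝ a) (r ⊝ a) (trans (cramer B C D (q ⊝ a)) (trans
        (cong (Θ B C D) (V3-≡ (h #1) (h #2) (h #3))) (sym (cramer B C D (r ⊝ a))))))
      where
      component : ∀ a q r → q - a ≡ r - a → q ≡ r
      component a q r e = trans (back q a) (trans (cong (λ t → t + a) e) (sym (back r a)))
        where
        back : ∀ q a → q ≡ q - a + a
        back = solve-∀
      shift : q ⊝ a ≡ r ⊝ a → q ≡ r
      shift e = V3-≡ (component (x a) (x q) (x r) (cong x e)) (component (y a) (y q) (y r) (cong y e)) (component (z a) (z q) (z r) (cong z e))

    -- Barycentric coordinates are quotients of volumes: exchanging corner j for q multiplies the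
    -- volume by coordinate j of q.
    vol-replace : ∀ j q → vol (λ i → at j q (p i) i) ≡ Y q j
    vol-replace #0 q = trans (cong₃ det (⊝-⊝ (p #1) q a) (⊝-⊝ (p #2) q a) (⊝-⊝ (p #3) q a)) (det-translate B C D (q ⊝ a))
    vol-replace #1 q = refl
    vol-replace #2 q = refl
    vol-replace #3 q = refl

    Smaller : Set
    Smaller = Σ (Tetra A) λ T′ → ∣ vol (Tetra.p T′) ∣ ℕ.< ∣ V ∣

    Span : Pt → Set
    Span q = ∃[ n ] q ≡ a ⊕ Θ B C D n

    -- Coordinate j of q plus that of its own corner, which is the odd number V, is twice coordinate
    -- j of the midpoint.
    odd-Y : ∀ j q m → q ⊕ p j ≡ m ⊕ m → odd (Y q j) ≡ true
    odd-Y j q m e = xor-true (odd (Y q j)) (trans (sym (trans (odd-+ (Y q j) (Y (p j) j)) (cong (odd (Y q j) xor_) corner)))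
        (trans (cong odd (sym (Y-half {q} {p j} {m} e j))) (2*m-odd (Y m j))))
      where
      self : ∀ j → at j V (+ 0) j ≡ V
      self #0 = refl
      self #1 = refl
      self #2 = refl
      self #3 = refl
      corner : odd (Y (p j) j) ≡ true
      corner = trans (cong odd (trans (Y-corner j j) (self j))) odd-vol
      xor-true : ∀ b → b xor true ≡ false → b ≡ true
      xor-true true _ = refl

    -- The new corner lies in the class of the old one, so all conditions modulo 2 survive; oddness
    -- of the new volume is `odd-Y`.
    replace : ∀ j q m → A q → q ⊕ p j ≡ m ⊕ m → Tetra A
    replace j q m hq e = record
      { p = p′ ; inA = inA′ ; halving = λ r hr → let i , n , e′ = halving r hr in halving′ r i n e′
      ; total = total′ ; odd-vol = trans (cong odd (vol-replace j q)) (odd-Y j q m e) }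
      where
      p′ : Fin 4 → Pt
      p′ i = at j q (p i) i
      inA′ : ∀ i → A (p′ i)
      inA′ i with at-spec j i q (p i)
      ... | inj₁ (_ , e) = subst A (sym e) hq
      ... | inj₂ e       = subst A (sym e) (inA i)
      through : ∀ r o n → q ⊕ o ≡ m ⊕ m → r ⊕ o ≡ n ⊕ n → r ⊕ q ≡ ((n ⊕ m) ⊝ o) ⊕ ((n ⊕ m) ⊝ o)
      through r o n e e′ = V3-≡ (component (x q) (x r) (x o) (x m) (x n) (cong x e) (cong x e′))
        (component (y q) (y r) (y o) (y m) (y n) (cong y e) (cong y e′)) (component (z q) (z r) (z o) (z m) (z n) (cong z e) (cong z e′))
        where
        component : ∀ q r o m n → q + o ≡ m + m → r + o ≡ n + n → r + q ≡ (n + m - o) + (n + m - o)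
        component q r o m n e e′ = trans (left q r o) (trans (cong₂ (λ s t → s + t - o - o) e′ e) (right o m n))
          where
          left : ∀ q r o → r + q ≡ (r + o) + (q + o) - o - o
          left = solve-∀
          right : ∀ o m n → (n + n) + (m + m) - o - o ≡ (n + m - o) + (n + m - o)
          right = solve-∀
      halving′ : ∀ r i n → r ⊕ p i ≡ n ⊕ n → ∃[ i ] ∃[ n ] r ⊕ p′ i ≡ n ⊕ n
      halving′ r i n e′ with at-spec j i q (p i)
      ... | inj₁ (refl , e″) = i , (n ⊕ m) ⊝ p i , trans (cong (r ⊕_) e″) (through r (p i) n e e′)
      ... | inj₂ e″          = i , n , trans (cong (r ⊕_) e″) e′
      shifted : ∀ s t q o m k → t ≡ (s + s) + k → q + o ≡ m + m → t + (q - o) ≡ ((s + m - o) + (s + m - o)) + k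
      shifted s t q o m k refl e′ = trans (left s q o k) (trans (cong (λ i → (s + s) + k + i - o - o) e′) (right s k m o))
        where
        left : ∀ s q o k → (s + s) + k + (q - o) ≡ (s + s) + k + (q + o) - o - o
        left = solve-∀
        right : ∀ s k m o → (s + s) + k + (m + m) - o - o ≡ ((s + m - o) + (s + m - o)) + k
        right = solve-∀
      total′ : ∃[ s ] sum₄ p′ ≡ (s ⊕ s) ⊕ e₁
      total′ = let s , t = total ; o = p j in (s ⊕ m) ⊝ o , trans (sum₄-at p j q) (V3-≡
        (shifted (x s) _ (x q) (x o) (x m) (+ 1) (cong x t) (cong x e)) (shifted (y s) _ (y q) (y o) (y m) (+ 0) (cong y t) (cong y e))
        (shifted (z s) _ (z q) (z o) (z m) (+ 0) (cong z t) (cong z e)))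

    corner-span : ∀ j → p j ≡ a ⊕ Θ B C D (unit j)
    corner-span #0 = V3-≡ (i (x a) (x B) (x C) (x D)) (i (y a) (y B) (y C) (y D)) (i (z a) (z B) (z C) (z D))
      where
      i : ∀ a b c d → a ≡ a + (+ 0 * b + (+ 0 * c + + 0 * d))
      i = solve-∀
    corner-span #1 = V3-≡ (i (x a) (x (p #1)) (x C) (x D)) (i (y a) (y (p #1)) (y C) (y D)) (i (z a) (z (p #1)) (z C) (z D))
      where
      i : ∀ a b c d → b ≡ a + (+ 1 * (b - a) + (+ 0 * c + + 0 * d))
      i = solve-∀
    corner-span #2 = V3-≡ (i (x a) (x B) (x (p #2)) (x D)) (i (y a) (y B) (y (p #2)) (y D)) (i (z a) (z B) (z (p #2)) (z D))
      where
      i : ∀ a b c d → c ≡ a + (+ 0 * b + (+ 1 * (c - a) + + 0 * d))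
      i = solve-∀
    corner-span #3 = V3-≡ (i (x a) (x B) (x C) (x (p #3))) (i (y a) (y B) (y C) (y (p #3))) (i (z a) (z B) (z C) (z (p #3)))
      where
      i : ∀ a b c d → d ≡ a + (+ 0 * b + (+ 0 * c + + 1 * (d - a)))
      i = solve-∀

    -- Halving pulls every point towards the tetrahedron; inside, a new point gives a smaller tetrahedron.
    reach : Lattice A → ∀ q → A q → Span q ⊎ Smaller
    reach L q hq = go q hq (<-wellFounded ∑∣ Y q ∣)
      where
      double : ∀ q j m n → q ⊕ p j ≡ m ⊕ m → m ≡ a ⊕ Θ B C D n → q ≡ a ⊕ Θ B C D ((n ⊕ n) ⊝ unit j)
      double q j m n e e′ = V3-≡
        (component (x q) (x (p j)) (x m) (x a) (x B) (x C) (x D) (x n) (y n) (z n) (x (unit j)) (y (unit j)) (z (unit j)) (cong x e) (cong x e′) (cong x (corner-span j)))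
        (component (y q) (y (p j)) (y m) (y a) (y B) (y C) (y D) (x n) (y n) (z n) (x (unit j)) (y (unit j)) (z (unit j)) (cong y e) (cong y e′) (cong y (corner-span j)))
        (component (z q) (z (p j)) (z m) (z a) (z B) (z C) (z D) (x n) (y n) (z n) (x (unit j)) (y (unit j)) (z (unit j)) (cong z e) (cong z e′) (cong z (corner-span j)))
        where
        component : ∀ q o m a b c d i j k i′ j′ k′ → q + o ≡ m + m → m ≡ a + (i * b + (j * c + k * d)) → o ≡ a + (i′ * b + (j′ * c + k′ * d)) →
                    q ≡ a + ((i + i - i′) * b + ((j + j - j′) * c + (k + k - k′) * d))
        component q o m a b c d i j k i′ j′ k′ e refl refl = trans (left q o) (trans (cong (λ t → t - o) e) (right a b c d i j k i′ j′ k′))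
          where
          left : ∀ q o → q ≡ q + o - o
          left = solve-∀
          right : ∀ a b c d i j k i′ j′ k′ → (a + (i * b + (j * c + k * d))) + (a + (i * b + (j * c + k * d))) - (a + (i′ * b + (j′ * c + k′ * d))) ≡
                  a + ((i + i - i′) * b + ((j + j - j′) * c + (k + k - k′) * d))
          right = solve-∀
      go : ∀ q → A q → Acc ℕ._<_ ∑∣ Y q ∣ → Span q ⊎ Smaller
      go q hq (acc rs) with halving q hq
      ... | j , m , e with ∑∣ Y q ∣ ℕP.≤? ∣ V ∣
      -- The absolute coordinates add up to more than that of V exactly outside the tetrahedron. For
      -- a corner the sum equals it, so halving towards a corner lowers the sum.
      ... | no  ≰V = Sum.map₁ (λ { (n , e′) → (n ⊕ n) ⊝ unit j , double q j m n e e′ }) (go m (Lattice.mid L m e hq (inA j)) (rs shrinks))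
        where
        shrinks : ∑∣ Y m ∣ ℕ.< ∑∣ Y q ∣
        shrinks = ℕP.*-cancelˡ-< 2 _ _ (subst₂ ℕ._<_ (twice ∑∣ Y m ∣) (twice ∑∣ Y q ∣) (ℕP.≤-<-trans
            (∑-half (Y m) (Y q) (at j V (+ 0)) (λ i → trans (Y-half {q} {p j} {m} e i) (cong (λ t → Y q i + t) (Y-corner j i))))
            (ℕP.+-monoʳ-< ∑∣ Y q ∣ (subst (ℕ._< ∑∣ Y q ∣) (sym (∑-at V j)) (ℕP.≰⇒> ≰V)))))
          where
          twice : ∀ n → n ℕ.+ n ≡ 2 ℕ.* n
          twice = ℕSolver.solve-∀
      -- Inside, coordinate j attains the absolute value of V only at corner j; at any other point
      -- the exchange gives a smaller volume.
      ... | yes ≤V with ∣ V ∣ ℕP.≤? ∣ Y q j ∣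
      ... | yes V≤ = inj₁ (unit j , trans (Y-injective {q} {p j} (λ i → trans (pinned (Y q) V j (Y-total q) ≤V V≤ i) (sym (Y-corner j i)))) (corner-span j))
      ... | no  V≰ = inj₂ (replace j q m hq e , subst (ℕ._< ∣ V ∣) (cong ∣_∣ (sym (vol-replace j q))) (ℕP.≰⇒> V≰))

    -- The corner `a` enters with the sum of the coefficients, which is zero, so a combination of
    -- spanned points is a combination of edges.
    lin-span : Lattice A → ∀ {q} → Lin A q → (∃[ n ] q ≡ Θ B C D n) ⊎ Smaller
    lin-span L {q} (ls , hs , s , e) = Sum.map₁ (λ { (n , e′) → n , trans (sym e) (trans e′ (trans (cong (λ t → (t ⊙ a) ⊕ Θ B C D n) s)
        (V3-≡ (ℤP.+-identityˡ _) (ℤP.+-identityˡ _) (ℤP.+-identityˡ _)))) }) (go ls hs)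
      where
      step : ∀ l t a b c d i j k i′ j′ k′ → l * (a + (i * b + (j * c + k * d))) + (t * a + (i′ * b + (j′ * c + k′ * d))) ≡
             (l + t) * a + ((l * i + i′) * b + ((l * j + j′) * c + (l * k + k′) * d))
      step = solve-∀
      nought : ∀ a b c d → + 0 ≡ + 0 * a + (+ 0 * b + (+ 0 * c + + 0 * d))
      nought = solve-∀
      go : ∀ ls → All (λ lp → A (proj₂ lp)) ls → (∃[ n ] intComb ls ≡ (intSum ls ⊙ a) ⊕ Θ B C D n) ⊎ Smaller
      go []             []       = inj₁ (𝟎 , V3-≡ (nought (x a) (x B) (x C) (x D)) (nought (y a) (y B) (y C) (y D)) (nought (z a) (z B) (z C) (z D)))
      go ((l , q) ∷ ls) (h ∷ hs) with reach L q h | go ls hs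
      ... | inj₂ t        | _             = inj₂ t
      ... | inj₁ _        | inj₂ t        = inj₂ t
      ... | inj₁ (n , e) | inj₁ (n′ , e′) = inj₁ ((l ⊙ n) ⊕ n′ , trans (cong₂ (λ s t → (l ⊙ s) ⊕ t) e e′) (V3-≡
        (step l (intSum ls) (x a) (x B) (x C) (x D) (x n) (y n) (z n) (x n′) (y n′) (z n′))
        (step l (intSum ls) (y a) (y B) (y C) (y D) (x n) (y n) (z n) (x n′) (y n′) (z n′))
        (step l (intSum ls) (z a) (z B) (z C) (z D) (x n) (y n) (z n) (x n′) (y n′) (z n′))))

  edges : (Fin 4 → Pt) → Pt → Pt
  edges p = Θ (p #1 ⊝ p #0) (p #2 ⊝ p #0) (p #3 ⊝ p #0)

  record Basic (A : Pt → Set) : Set where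
    field
      tetrahedron : Tetra A
      n₁ n₂ n₃    : Pt
      span₁       : e₁ ≡ edges (Tetra.p tetrahedron) n₁
      span₂       : e₂ ≡ edges (Tetra.p tetrahedron) n₂
      span₃       : e₃ ≡ edges (Tetra.p tetrahedron) n₃

  -- Minimality of the volume is never established: the descent stops as soon as e₁, e₂ and e₃ have
  -- all been expressed in the edges.
  basic : ∀ {A} → Lattice A → Basic A
  basic {A} L = go (tetra L) (<-wellFounded _)
    where
    go : (T : Tetra A) → Acc ℕ._<_ ∣ vol (Tetra.p T) ∣ → Basic A
    go T (acc rs) with lin-span T L (Lattice.gen₁ L) | lin-span T L (Lattice.gen₂ L) | lin-span T L (Lattice.gen₃ L)
    ... | inj₂ (T′ , lt) | _ | _ = go T′ (rs lt)
    ... | inj₁ _ | inj₂ (T′ , lt) | _ = go T′ (rs lt)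
    ... | inj₁ _ | inj₁ _ | inj₂ (T′ , lt) = go T′ (rs lt)
    ... | inj₁ (n₁ , s₁) | inj₁ (n₂ , s₂) | inj₁ (n₃ , s₃) = record
      { tetrahedron = T ; n₁ = n₁ ; n₂ = n₂ ; n₃ = n₃ ; span₁ = s₁ ; span₂ = s₂ ; span₃ = s₃ }

open Descent

-- From a basic tetrahedron to a frame; half-integral vectors are compared after doubling.

module FrameConstruction where

  open import Data.Integer.Tactic.RingSolver using (solve-∀)

  open Uni

  -- Passes from coordinates in the basis 2b₁, b₂, b₃ of the sublattice to coordinates in the basis
  -- b₁, b₂, b₃ of the whole lattice.
  doubled : Pt → Pt
  doubled p = ⟨ + 2 * x p , y p , z p ⟩

  -- Sublattice coordinates of 2p.
  δ : Pt → Pt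
  δ p = ⟨ x p , y p + y p , z p + z p ⟩

  -- Frame coordinates of 2p.
  ν : Pt → Pt
  ν p = ⟨ z p + z p + x p + y p , x p - y p , - x p - y p ⟩

  double-injective : ∀ {a b} → a + a ≡ b + b → a ≡ b
  double-injective {a} {b} e = ℤP.*-cancelˡ-≡ (+ 2) a b (trans (twice a) (trans e (sym (twice b))))
    where
    twice : ∀ a → + 2 * a ≡ a + a
    twice = solve-∀

  δ-injective : ∀ {p q} → δ p ≡ δ q → p ≡ q
  δ-injective e = V3-≡ (cong x e) (double-injective (cong y e)) (double-injective (cong z e))

  ν-injective : ∀ {p q} → ν p ≡ ν q → p ≡ q
  ν-injective {p} {q} e = V3-≡ xs ys (double-injective (trans (third p) (trans (cong₃ (λ a b c → a - b - c) (cong x e) xs ys) (sym (third q)))))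
    where
    first : ∀ a b → a + a ≡ (a - b) - (- a - b)
    first = solve-∀
    second : ∀ a b → b + b ≡ - ((a - b) + (- a - b))
    second = solve-∀
    third : ∀ p → z p + z p ≡ (z p + z p + x p + y p) - x p - y p
    third p = identity (x p) (y p) (z p)
      where
      identity : ∀ a b c → c + c ≡ (c + c + a + b) - a - b
      identity = solve-∀
    xs : x p ≡ x q
    xs = double-injective (trans (first (x p) (y p)) (trans (cong₂ _-_ (cong y e) (cong z e)) (sym (first (x q) (y q)))))
    ys : y p ≡ y q
    ys = double-injective (trans (second (x p) (y p)) (trans (cong₂ (λ a b → - (a + b)) (cong y e) (cong z e)) (sym (second (x q) (y q)))))

  columns : Pt → Pt → Pt → Pt → Aff
  columns b c d t = aff ⟨ x b , x c , x d ⟩ ⟨ y b , y c , y d ⟩ ⟨ z b , z c , z d ⟩ t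

  columns-apply : ∀ b c d t n → applyℤ (columns b c d t) n ≡ Θ b c d n ⊕ t
  columns-apply b c d t n = V3-≡ (row (x b) (x c) (x d) (x t) (x n) (y n) (z n)) (row (y b) (y c) (y d) (y t) (x n) (y n) (z n))
    (row (z b) (z c) (z d) (z t) (x n) (y n) (z n))
    where
    row : ∀ b c d t i j k → b * i + c * j + d * k + t ≡ i * b + (j * c + k * d) + t
    row = solve-∀

  Θ-compose : ∀ b c d i j k n → Θ b c d (Θ i j k n) ≡ Θ (Θ b c d i) (Θ b c d j) (Θ b c d k) n
  Θ-compose b c d i j k n = V3-≡ (component (x b) (x c) (x d)) (component (y b) (y c) (y d)) (component (z b) (z c) (z d))
    where
    identity : ∀ b c d i i′ i″ j j′ j″ k k′ k″ l m n →
      (l * i + (m * j + n * k)) * b + ((l * i′ + (m * j′ + n * k′)) * c + (l * i″ + (m * j″ + n * k″)) * d) ≡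
      l * (i * b + (i′ * c + i″ * d)) + (m * (j * b + (j′ * c + j″ * d)) + n * (k * b + (k′ * c + k″ * d)))
    identity = solve-∀
    component : ∀ β γ ε →
      (x n * x i + (y n * x j + z n * x k)) * β + ((x n * y i + (y n * y j + z n * y k)) * γ + (x n * z i + (y n * z j + z n * z k)) * ε) ≡
      x n * (x i * β + (y i * γ + z i * ε)) + (y n * (x j * β + (y j * γ + z j * ε)) + z n * (x k * β + (y k * γ + z k * ε)))
    component β γ ε = identity β γ ε (x i) (y i) (z i) (x j) (y j) (z j) (x k) (y k) (z k) (x n) (y n) (z n)

  Θ-units : ∀ n → Θ e₁ e₂ e₃ n ≡ n
  Θ-units n = V3-≡ (i₁ (x n) (y n) (z n)) (i₂ (x n) (y n) (z n)) (i₃ (x n) (y n) (z n))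
    where
    i₁ : ∀ a b c → a * + 1 + (b * + 0 + c * + 0) ≡ a
    i₁ = solve-∀
    i₂ : ∀ a b c → a * + 0 + (b * + 1 + c * + 0) ≡ b
    i₂ = solve-∀
    i₃ : ∀ a b c → a * + 0 + (b * + 0 + c * + 1) ≡ c
    i₃ = solve-∀

  Θ-⊕ : ∀ b c d m n → Θ b c d (m ⊕ n) ≡ Θ b c d m ⊕ Θ b c d n
  Θ-⊕ b c d m n = V3-≡ (row (x b) (x c) (x d)) (row (y b) (y c) (y d)) (row (z b) (z c) (z d))
    where
    identity : ∀ b c d i j k i′ j′ k′ → (i + i′) * b + ((j + j′) * c + (k + k′) * d) ≡ (i * b + (j * c + k * d)) + (i′ * b + (j′ * c + k′ * d))
    identity = solve-∀
    row : ∀ b c d → (x m + x n) * b + ((y m + y n) * c + (z m + z n) * d) ≡ (x m * b + (y m * c + z m * d)) + (x n * b + (y n * c + z n * d))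
    row b c d = identity b c d (x m) (y m) (z m) (x n) (y n) (z n)

  det-Θ₁ : ∀ b c d n → det (Θ b c d n) c d ≡ x n * det b c d
  det-Θ₁ b c d n = identity (x b) (y b) (z b) (x c) (y c) (z c) (x d) (y d) (z d) (x n) (y n) (z n)
    where
    identity : ∀ a b c d e f g h i j k l →
      (j * a + (k * d + l * g)) * (e * i - f * h) - (j * b + (k * e + l * h)) * (d * i - f * g) + (j * c + (k * f + l * i)) * (d * h - e * g) ≡
      j * (a * (e * i - f * h) - b * (d * i - f * g) + c * (d * h - e * g))
    identity = solve-∀

  Θ-rotate : ∀ b c d n → Θ b c d n ≡ Θ c d b ⟨ y n , z n , x n ⟩
  Θ-rotate b c d n = V3-≡ (row (x b) (x c) (x d) (x n) (y n) (z n)) (row (y b) (y c) (y d) (x n) (y n) (z n)) (row (z b) (z c) (z d) (x n) (y n) (z n))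
    where
    row : ∀ b c d i j k → i * b + (j * c + k * d) ≡ j * c + (k * d + i * b)
    row = solve-∀

  Θ-injective : ∀ b c d → ¬ (det b c d ≡ + 0) → ∀ {m n} → Θ b c d m ≡ Θ b c d n → m ≡ n
  Θ-injective b c d V≢0 {m} {n} e = V3-≡ (first b c d V≢0 m n e)
    (first c d b V≢0′ ⟨ y m , z m , x m ⟩ ⟨ y n , z n , x n ⟩ (trans (sym (Θ-rotate b c d m)) (trans e (Θ-rotate b c d n))))
    (first d b c V≢0″ ⟨ z m , x m , y m ⟩ ⟨ z n , x n , y n ⟩ (trans (sym (twice m)) (trans e (twice n))))
    where
    first : ∀ b c d → ¬ (det b c d ≡ + 0) → ∀ m n → Θ b c d m ≡ Θ b c d n → x m ≡ x n
    first b c d V≢0 m n e = ℤP.*-cancelʳ-≡ (x m) (x n) (det b c d) {{ℤ.≢-nonZero V≢0}}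
      (trans (sym (det-Θ₁ b c d m)) (trans (cong (λ q → det q c d) e) (det-Θ₁ b c d n)))
    V≢0″ : ¬ (det d b c ≡ + 0)
    V≢0″ h = V≢0 (trans (det-rotate b c d) h)
    V≢0′ : ¬ (det c d b ≡ + 0)
    V≢0′ h = V≢0″ (trans (det-rotate d b c) (trans refl h))
    twice : ∀ n → Θ b c d n ≡ Θ d b c ⟨ z n , x n , y n ⟩
    twice n = trans (Θ-rotate b c d n) (Θ-rotate c d b ⟨ y n , z n , x n ⟩)

  ν-Θ : ∀ b c d n → ν (Θ b c d n) ≡ Θ (ν b) (ν c) (ν d) n
  ν-Θ b c d n = V3-≡ (first (x b) (y b) (z b) (x c) (y c) (z c) (x d) (y d) (z d) (x n) (y n) (z n))
    (second (x b) (y b) (x c) (y c) (x d) (y d) (x n) (y n) (z n)) (third (x b) (y b) (x c) (y c) (x d) (y d) (x n) (y n) (z n))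
    where
    first : ∀ a b c d e f g h i j k l → (j * c + (k * f + l * i)) + (j * c + (k * f + l * i)) + (j * a + (k * d + l * g)) + (j * b + (k * e + l * h)) ≡
            j * (c + c + a + b) + (k * (f + f + d + e) + l * (i + i + g + h))
    first = solve-∀
    second : ∀ a b d e g h j k l → (j * a + (k * d + l * g)) - (j * b + (k * e + l * h)) ≡ j * (a - b) + (k * (d - e) + l * (g - h))
    second = solve-∀
    third : ∀ a b d e g h j k l → - (j * a + (k * d + l * g)) - (j * b + (k * e + l * h)) ≡ j * (- a - b) + (k * (- d - e) + l * (- g - h))
    third = solve-∀

  ν-comb : ∀ n → ν (comb n) ≡ n ⊕ n
  ν-comb n = trans (cong ν (comb-coordinates (x n) (y n) (z n))) (V3-≡ (first (x n) (y n) (z n)) (second (y n) (z n)) (third (y n) (z n)))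
    where
    first : ∀ a b c → (a + c) + (a + c) + (b - c) + (- b - c) ≡ a + a
    first = solve-∀
    second : ∀ b c → (b - c) - (- b - c) ≡ b + b
    second = solve-∀
    third : ∀ b c → - (b - c) - (- b - c) ≡ c + c
    third = solve-∀

  ν-halfway : ∀ α β γ → ν (halfway (+ 1 - α) (+ 1 - β) (+ 1 - γ)) ≡ ⟨ + 1 - (α + α) , + 1 - (β + β) , + 1 - (γ + γ) ⟩
  ν-halfway α β γ = V3-≡ (first α β γ) (second β γ) (third β γ)
    where
    first : ∀ α β γ → let b = + 1 - β ; c = + 1 - γ ; t = + 1 - α + c - + 1 in t + t + (b - c) + (+ 1 - b - c) ≡ + 1 - (α + α)
    first = solve-∀
    second : ∀ β γ → let b = + 1 - β ; c = + 1 - γ in (b - c) - (+ 1 - b - c) ≡ + 1 - (β + β)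
    second = solve-∀
    third : ∀ β γ → let b = + 1 - β ; c = + 1 - γ in - (b - c) - (+ 1 - b - c) ≡ + 1 - (γ + γ)
    third = solve-∀

  Θ-δ : ∀ b c d n → Θ b (c ⊕ c) (d ⊕ d) n ≡ Θ b c d (δ n)
  Θ-δ b c d n = V3-≡ (row (x b) (x c) (x d) (x n) (y n) (z n)) (row (y b) (y c) (y d) (x n) (y n) (z n)) (row (z b) (z c) (z d) (x n) (y n) (z n))
    where
    row : ∀ b c d i j k → i * b + (j * (c + c) + k * (d + d)) ≡ i * b + ((j + j) * c + (k + k) * d)
    row = solve-∀

  -- Here t is half of b + c + d in coordinates of the whole lattice. The columns are forced:
  -- (0,0,1), (1,-1,0) and (-1,-1,1) must go to b, c and d.
  δ-Θ : ∀ b c d s → b ⊕ (c ⊕ d) ≡ (s ⊕ s) ⊕ e₁ → let t = ⟨ x s + x s + + 1 , y s , z s ⟩ in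
        ∀ n → δ (Θ (t ⊝ doubled d) (doubled b ⊝ t) (doubled b) n) ≡ Θ b c d (ν n)
  δ-Θ b c d s e n = V3-≡ (first (x b) (x c) (x d) (x s + x s + + 1) (x n) (y n) (z n) (cong x e))
      (other (y b) (y c) (y d) (y s) (x n) (y n) (z n) (cong y e)) (other (z b) (z c) (z d) (z s) (x n) (y n) (z n) (cong z e))
    where
    first : ∀ b c d t i j k → b + (c + d) ≡ t → i * (t - + 2 * d) + (j * (+ 2 * b - t) + k * (+ 2 * b)) ≡ (k + k + i + j) * b + ((i - j) * c + (- i - j) * d)
    first b c d t i j k refl = identity b c d i j k
      where
      identity : ∀ b c d i j k → i * (b + (c + d) - + 2 * d) + (j * (+ 2 * b - (b + (c + d))) + k * (+ 2 * b)) ≡ (k + k + i + j) * b + ((i - j) * c + (- i - j) * d)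
      identity = solve-∀
    other : ∀ b c d t i j k → b + (c + d) ≡ (t + t) + + 0 →
            (i * (t - d) + (j * (b - t) + k * b)) + (i * (t - d) + (j * (b - t) + k * b)) ≡ (k + k + i + j) * b + ((i - j) * c + (- i - j) * d)
    other b c d t i j k e = trans (left b d t i j k) (trans (cong (λ r → i * (r - d - d) + (j * (b + b - r) + k * (b + b))) (sym e)) (right b c d i j k))
      where
      left : ∀ b d t i j k → (i * (t - d) + (j * (b - t) + k * b)) + (i * (t - d) + (j * (b - t) + k * b)) ≡ i * ((t + t) + + 0 - d - d) + (j * (b + b - ((t + t) + + 0)) + k * (b + b))
      left = solve-∀
      right : ∀ b c d i j k → i * (b + (c + d) - d - d) + (j * (b + b - (b + (c + d))) + k * (b + b)) ≡ (k + k + i + j) * b + ((i - j) * c + (- i - j) * d)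
      right = solve-∀

  ⊝-⊕ : ∀ q r → (q ⊝ r) ⊕ r ≡ q
  ⊝-⊕ q r = V3-≡ (identity (x q) (x r)) (identity (y q) (y r)) (identity (z q) (z r))
    where
    identity : ∀ q r → q - r + r ≡ q
    identity = solve-∀
  ⊕-⊝ : ∀ q r → (q ⊕ r) ⊝ r ≡ q
  ⊕-⊝ q r = V3-≡ (identity (x q) (x r)) (identity (y q) (y r)) (identity (z q) (z r))
    where
    identity : ∀ q r → q + r - r ≡ q
    identity = solve-∀

  ⊕-⊝′ : ∀ q r → r ⊕ (q ⊝ r) ≡ q
  ⊕-⊝′ q r = V3-≡ (identity (x q) (x r)) (identity (y q) (y r)) (identity (z q) (z r))
    where
    identity : ∀ q r → r + (q - r) ≡ q
    identity = solve-∀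

  affine-unimodular : (F G : Pt → Pt) → (∀ q → F (G q) ≡ q) → (∀ q → G (F q) ≡ q) → ∀ f b d →
                      (∀ q → applyℤ f q ≡ F q ⊕ d) → (∀ q → applyℤ b q ≡ G (q ⊝ d)) → Uni
  affine-unimodular F G FG GF f b d f-apply b-apply = record
    { fwd = f ; bwd = b
    ; fwd-bwd = λ q → trans (f-apply (applyℤ b q)) (trans (cong (λ t → F t ⊕ d) (b-apply q))
        (trans (cong (_⊕ d) (FG (q ⊝ d))) (⊝-⊕ q d)))
    ; bwd-fwd = λ q → trans (b-apply (applyℤ f q)) (trans (cong (λ t → G (t ⊝ d)) (f-apply q))
        (trans (cong G (⊕-⊝ (F q) d)) (GF q))) }

  module _ {S : List Pt} (g : Uni)
           (T : Basic (λ q → LatPt S (applyℤ (fwd g) (doubled q))))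
           (cover : ∀ p → LatPt S p → ∃[ q ] p ≡ applyℤ (fwd g) (doubled q)) where

    private
      open Basic T
      open Tetra tetrahedron
      a B C D s′ w′ : Pt
      a = p #0
      B = p #1 ⊝ a
      C = p #2 ⊝ a
      D = p #3 ⊝ a
      s′ = proj₁ total ⊝ (a ⊕ a)
      w′ = ⟨ x s′ + x s′ + + 1 , y s′ , z s′ ⟩
      N : Pt → Pt
      N = Θ n₁ n₂ n₃
      ΘN : ∀ q → Θ B C D (N q) ≡ q
      ΘN q = trans (Θ-compose B C D n₁ n₂ n₃ q) (trans (cong₃ (λ i j k → Θ i j k q) (sym span₁) (sym span₂) (sym span₃)) (Θ-units q))
      injective : ∀ {m n} → Θ B C D m ≡ Θ B C D n → m ≡ n
      injective = Θ-injective B C D (V≢0 tetrahedron)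
      NΘ : ∀ n → N (Θ B C D n) ≡ n
      NΘ n = injective (ΘN (Θ B C D n))
      BCD : B ⊕ (C ⊕ D) ≡ (s′ ⊕ s′) ⊕ e₁
      BCD = V3-≡ (component x (+ 1) (cong x (proj₂ total))) (component y (+ 0) (cong y (proj₂ total))) (component z (+ 0) (cong z (proj₂ total)))
        where
        component : ∀ (π : Pt → ℤ) k → (π (p #0) + π (p #1)) + (π (p #2) + π (p #3)) ≡ (π (proj₁ total) + π (proj₁ total)) + k →
          (π (p #1) - π a) + ((π (p #2) - π a) + (π (p #3) - π a)) ≡ ((π (proj₁ total) - (π a + π a)) + (π (proj₁ total) - (π a + π a))) + k
        component π k e = trans (left (π a) (π (p #1)) (π (p #2)) (π (p #3))) (trans (cong (λ t → t - π a - π a - π a - π a) e) (right (π (proj₁ total)) (π a) k))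
          where
          left : ∀ a b c d → (b - a) + ((c - a) + (d - a)) ≡ (a + b) + (c + d) - a - a - a - a
          left = solve-∀
          right : ∀ s a k → (s + s) + k - a - a - a - a ≡ ((s - (a + a)) + (s - (a + a))) + k
          right = solve-∀
      -- By `total`, e₁ is B + C + D minus an even vector, so its edge coordinates are all odd.
      n₁-odd : pt (+ 1) (+ 1) (+ 1) ≡ (N s′ ⊕ N s′) ⊕ n₁
      n₁-odd = injective (trans (ones (B) (C) (D)) (trans BCD (sym (trans (Θ-⊕ B C D (N s′ ⊕ N s′) n₁)
          (cong₂ _⊕_ (trans (Θ-⊕ B C D (N s′) (N s′)) (cong₂ _⊕_ (ΘN s′) (ΘN s′))) (sym span₁))))))
        where
        row : ∀ b c d → + 1 * b + (+ 1 * c + + 1 * d) ≡ b + (c + d)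
        row = solve-∀
        ones : ∀ b c d → Θ b c d (pt (+ 1) (+ 1) (+ 1)) ≡ b ⊕ (c ⊕ d)
        ones b c d = V3-≡ (row (x b) (x c) (x d)) (row (y b) (y c) (y d)) (row (z b) (z c) (z d))
      -- Linear part of the frame map and its inverse. Both are integral although the edges span
      -- only the sublattice: the odd coset goes to the half-integral frame points.
      F G : Pt → Pt
      F = Θ (w′ ⊝ doubled D) (doubled B ⊝ w′) (doubled B)
      h₁ : Pt
      -- The inverse image of b₁, which is half of e₁ in the sublattice: its frame coordinates are
      -- half of `n₁`, that is ½ minus those of `s′`.
      h₁ = halfway (+ 1 - x (N s′)) (+ 1 - y (N s′)) (+ 1 - z (N s′))
      G = Θ h₁ (comb n₂) (comb n₃)
      δF : ∀ q → δ (F q) ≡ Θ B C D (ν q)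
      δF = δ-Θ B C D s′ BCD
      νh₁ : ν h₁ ≡ n₁
      νh₁ = trans (ν-halfway (x (N s′)) (y (N s′)) (z (N s′)))
          (V3-≡ (component (x (N s′)) (x n₁) (cong x n₁-odd)) (component (y (N s′)) (y n₁) (cong y n₁-odd)) (component (z (N s′)) (z n₁) (cong z n₁-odd)))
        where
        component : ∀ a n → + 1 ≡ (a + a) + n → + 1 - (a + a) ≡ n
        component a n e = trans (cong (λ t → t - (a + a)) e) (identity a n)
          where
          identity : ∀ a n → (a + a) + n - (a + a) ≡ n
          identity = solve-∀
      νG : ∀ q → ν (G q) ≡ N (δ q)
      νG q = trans (ν-Θ h₁ (comb n₂) (comb n₃) q) (trans (cong₃ (λ i j k → Θ i j k q) νh₁ (ν-comb n₂) (ν-comb n₃)) (Θ-δ n₁ n₂ n₃ q))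
      FG : ∀ q → F (G q) ≡ q
      FG q = δ-injective (trans (δF (G q)) (trans (cong (Θ B C D) (νG q)) (ΘN (δ q))))
      GF : ∀ q → G (F q) ≡ q
      GF q = ν-injective (trans (νG (F q)) (trans (cong N (δF q)) (NΘ (ν q))))
      F-comb : ∀ n → F (comb n) ≡ doubled (Θ B C D n)
      F-comb n = δ-injective (trans (δF (comb n)) (trans (cong (Θ B C D) (ν-comb n)) (trans (Θ-⊕ B C D n n)
        (V3-≡ (twice (x (Θ B C D n))) refl refl))))
        where
        twice : ∀ t → t + t ≡ + 2 * t
        twice = solve-∀
      fwd′ bwd′ : Aff
      fwd′ = columns (w′ ⊝ doubled D) (doubled B ⊝ w′) (doubled B) (doubled a)
      bwd′ = columns h₁ (comb n₂) (comb n₃) (𝟎 ⊝ G (doubled a))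
      bwd-apply : ∀ q → applyℤ bwd′ q ≡ G (q ⊝ doubled a)
      bwd-apply q = trans (columns-apply h₁ (comb n₂) (comb n₃) (𝟎 ⊝ G (doubled a)) q) (sym (Θ-⊝ h₁ (comb n₂) (comb n₃) q (doubled a)))
        where
        row : ∀ b c d i j k i′ j′ k′ → (i - i′) * b + ((j - j′) * c + (k - k′) * d) ≡ (i * b + (j * c + k * d)) + (+ 0 - (i′ * b + (j′ * c + k′ * d)))
        row = solve-∀
        Θ-⊝ : ∀ b c d m n → Θ b c d (m ⊝ n) ≡ Θ b c d m ⊕ (𝟎 ⊝ Θ b c d n)
        Θ-⊝ b c d m n = V3-≡ (row (x b) (x c) (x d) (x m) (y m) (z m) (x n) (y n) (z n)) (row (y b) (y c) (y d) (x m) (y m) (z m) (x n) (y n) (z n))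
          (row (z b) (z c) (z d) (x m) (y m) (z m) (x n) (y n) (z n))
      fwd-apply : ∀ q → applyℤ fwd′ q ≡ F q ⊕ doubled a
      fwd-apply = columns-apply (w′ ⊝ doubled D) (doubled B ⊝ w′) (doubled B) (doubled a)
      h : Uni
      h = affine-unimodular F G FG GF fwd′ bwd′ (doubled a) fwd-apply bwd-apply
      h-comb : ∀ n → applyℤ fwd′ (comb n) ≡ doubled (a ⊕ Θ B C D n)
      h-comb n = trans (fwd-apply (comb n)) (trans (cong (_⊕ doubled a) (F-comb n)) (V3-≡ (identity (x (Θ B C D n)) (x a)) (ℤP.+-comm (y (Θ B C D n)) (y a)) (ℤP.+-comm (z (Θ B C D n)) (z a))))
        where
        identity : ∀ t a → + 2 * t + + 2 * a ≡ + 2 * (a + t)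
        identity = solve-∀
      seen-corner : ∀ j → Seen S (g ∘ᵤ h) (unit j)
      seen-corner j = seen (subst (LatPt S) (sym (trans (∘ᵤ-fwd g h (comb (unit j))) (cong (applyℤ (fwd g)) (trans (h-comb (unit j)) (cong doubled (sym (corner-span tetrahedron j))))))) (inA j))
      h-N : ∀ q → applyℤ fwd′ (comb (N (q ⊝ a))) ≡ doubled q
      h-N q = trans (h-comb (N (q ⊝ a))) (cong doubled (trans (cong (a ⊕_) (ΘN (q ⊝ a))) (⊕-⊝′ q a)))
      covered : ∀ p → ∃[ q ] p ≡ applyℤ (fwd g) (doubled q) → ∃[ q ] p ≡ applyℤ (fwd (g ∘ᵤ h)) (comb q)
      covered p (q , e) = N (q ⊝ a) , trans e (sym (trans (∘ᵤ-fwd g h (comb (N (q ⊝ a)))) (cong (applyℤ (fwd g)) (h-N q))))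

    frame : ∃[ f ] Frame S f
    frame = g ∘ᵤ h , record { vertex = λ { O → seen-corner #0 ; Z → seen-corner #1 ; u → seen-corner #2 ; v → seen-corner #3 } ; cover = λ p l → covered p (cover p l) }

open FrameConstruction

-- A basis adapted to the sublattice of index two.

module IndexTwo where

  open import Data.Integer.Tactic.RingSolver using (solve-∀)

  open Uni

  -- A basis of the whole lattice for which 2b₁, b₂, b₃ is a basis of the sublattice; `back` is the
  -- inverse of its matrix.
  record Adapted (S : List Pt) : Set where
    field
      b₁ b₂ b₃ : Pt
      back     : Aff
      left     : columns b₁ b₂ b₃ 𝟎 ∘ₐ back ≡ idₐ
      right    : back ∘ₐ columns b₁ b₂ b₃ 𝟎 ≡ idₐ
      out₁     : ¬ LinLattice S b₁
      in₁      : LinLattice S ((+ 2) ⊙ b₁)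
      in₂      : LinLattice S b₂
      in₃      : LinLattice S b₃

  module _ {S : List Pt} (index : Index2 S) where
    private
      o : Pt
      o = proj₁ index
      decide : ∀ p → LinLattice S p ⊎ LinLattice S (p ⊖ o)
      decide = proj₂ (proj₂ index)

      outside : ∀ p → LinLattice S (p ⊖ o) → ¬ LinLattice S p
      outside p l l′ = proj₁ (proj₂ index) (subst (LinLattice S)
          (V3-≡ (identity (x p) (x o)) (identity (y p) (y o)) (identity (z p) (z o))) (lin-⊕ l′ (lin-⊙ -1ℤ l)))
        where
        identity : ∀ p a → p + -1ℤ * (p + -1ℤ * a) ≡ a
        identity = solve-∀

      difference : ∀ p q → LinLattice S (p ⊖ o) → LinLattice S (q ⊖ o) → LinLattice S (q ⊖ p)
      difference p q l l′ = subst (LinLattice S)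
          (V3-≡ (identity (x p) (x q) (x o)) (identity (y p) (y q) (y o)) (identity (z p) (z q) (z o))) (lin-⊕ l′ (lin-⊙ -1ℤ l))
        where
        identity : ∀ p q a → q + -1ℤ * a + -1ℤ * (p + -1ℤ * a) ≡ q + -1ℤ * p
        identity = solve-∀

      -- If 2p lay in the other coset together with p, their difference p would be in the
      -- sublattice.
      twice : ∀ p → LinLattice S (p ⊖ o) → LinLattice S ((+ 2) ⊙ p)
      twice p l = resolve (decide ((+ 2) ⊙ p))
        where
        identity : ∀ p a → + 2 * p + -1ℤ * a + -1ℤ * (p + -1ℤ * a) ≡ p
        identity = solve-∀
        resolve : LinLattice S ((+ 2) ⊙ p) ⊎ LinLattice S (((+ 2) ⊙ p) ⊖ o) → LinLattice S ((+ 2) ⊙ p)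
        resolve (inj₁ m) = m
        resolve (inj₂ m) = ⊥-elim (outside p l (subst (LinLattice S)
          (V3-≡ (identity (x p) (x o)) (identity (y p) (y o)) (identity (z p) (z o))) (lin-⊕ m (lin-⊙ -1ℤ l))))

      everything : LinLattice S e₁ → LinLattice S e₂ → LinLattice S e₃ → LinLattice S o
      everything l₁ l₂ l₃ = subst (LinLattice S) (Θ-units o) (lin-⊕ (lin-⊙ (x o) l₁) (lin-⊕ (lin-⊙ (y o) l₂) (lin-⊙ (z o) l₃)))

    -- Some unit vector lies outside the sublattice and becomes b₁; subtracting it from any other
    -- unit vector outside moves that one inside.
    adapted : Adapted S
    adapted = choose (decide e₁) (decide e₂) (decide e₃)
      where
      Member? : Pt → Set
      Member? p = LinLattice S p ⊎ LinLattice S (p ⊖ o)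
      choose : Member? e₁ → Member? e₂ → Member? e₃ → Adapted S
      choose (inj₂ l₁) (inj₁ l₂) (inj₁ l₃) = record
        { b₁ = e₁ ; b₂ = e₂ ; b₃ = e₃ ; back = columns e₁ e₂ e₃ 𝟎 ; left = refl ; right = refl
        ; out₁ = outside e₁ l₁ ; in₁ = twice e₁ l₁ ; in₂ = l₂ ; in₃ = l₃ }
      choose (inj₂ l₁) (inj₂ l₂) (inj₁ l₃) = record
        { b₁ = e₁ ; b₂ = e₂ ⊖ e₁ ; b₃ = e₃ ; back = columns e₁ (e₂ ⊕ e₁) e₃ 𝟎 ; left = refl ; right = refl
        ; out₁ = outside e₁ l₁ ; in₁ = twice e₁ l₁ ; in₂ = difference e₁ e₂ l₁ l₂ ; in₃ = l₃ }
      choose (inj₂ l₁) (inj₁ l₂) (inj₂ l₃) = record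
        { b₁ = e₁ ; b₂ = e₂ ; b₃ = e₃ ⊖ e₁ ; back = columns e₁ e₂ (e₃ ⊕ e₁) 𝟎 ; left = refl ; right = refl
        ; out₁ = outside e₁ l₁ ; in₁ = twice e₁ l₁ ; in₂ = l₂ ; in₃ = difference e₁ e₃ l₁ l₃ }
      choose (inj₂ l₁) (inj₂ l₂) (inj₂ l₃) = record
        { b₁ = e₁ ; b₂ = e₂ ⊖ e₁ ; b₃ = e₃ ⊖ e₁ ; back = columns e₁ (e₂ ⊕ e₁) (e₃ ⊕ e₁) 𝟎 ; left = refl ; right = refl
        ; out₁ = outside e₁ l₁ ; in₁ = twice e₁ l₁ ; in₂ = difference e₁ e₂ l₁ l₂ ; in₃ = difference e₁ e₃ l₁ l₃ }
      choose (inj₁ l₁) (inj₂ l₂) (inj₁ l₃) = record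
        { b₁ = e₂ ; b₂ = e₁ ; b₃ = e₃ ; back = columns e₂ e₁ e₃ 𝟎 ; left = refl ; right = refl
        ; out₁ = outside e₂ l₂ ; in₁ = twice e₂ l₂ ; in₂ = l₁ ; in₃ = l₃ }
      choose (inj₁ l₁) (inj₂ l₂) (inj₂ l₃) = record
        { b₁ = e₂ ; b₂ = e₁ ; b₃ = e₃ ⊖ e₂ ; back = columns e₂ e₁ (e₃ ⊕ e₁) 𝟎 ; left = refl ; right = refl
        ; out₁ = outside e₂ l₂ ; in₁ = twice e₂ l₂ ; in₂ = l₁ ; in₃ = difference e₂ e₃ l₂ l₃ }
      choose (inj₁ l₁) (inj₁ l₂) (inj₂ l₃) = record
        { b₁ = e₃ ; b₂ = e₁ ; b₃ = e₂ ; back = columns e₂ e₃ e₁ 𝟎 ; left = refl ; right = refl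
        ; out₁ = outside e₃ l₃ ; in₁ = twice e₃ l₃ ; in₂ = l₁ ; in₃ = l₂ }
      choose (inj₁ l₁) (inj₁ l₂) (inj₁ l₃) = ⊥-elim (proj₁ (proj₂ index) (everything l₁ l₂ l₃))

  module _ {S : List Pt} (E : Adapted S) (p₀ : Pt) (k₀ : LatPt S p₀) where
    open Adapted E

    private
      H H⁻¹ : Pt → Pt
      H = Θ b₁ b₂ b₃
      H⁻¹ = applyℤ back
      H-columns : ∀ q → applyℤ (columns b₁ b₂ b₃ 𝟎) q ≡ H q
      H-columns q = trans (columns-apply b₁ b₂ b₃ 𝟎 q) (V3-≡ (ℤP.+-identityʳ (x (H q))) (ℤP.+-identityʳ (y (H q))) (ℤP.+-identityʳ (z (H q))))
      HH⁻¹ : ∀ q → H (H⁻¹ q) ≡ q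
      HH⁻¹ q = trans (sym (H-columns (H⁻¹ q))) (inverse (columns b₁ b₂ b₃ 𝟎) back left q)
      H⁻¹H : ∀ q → H⁻¹ (H q) ≡ q
      H⁻¹H q = trans (cong H⁻¹ (sym (H-columns q))) (inverse back (columns b₁ b₂ b₃ 𝟎) right q)
      shiftₐ : Aff
      shiftₐ = aff e₁ e₂ e₃ (𝟎 ⊝ p₀)
      shift-apply : ∀ q → applyℤ shiftₐ q ≡ q ⊝ p₀
      shift-apply q = V3-≡ (i₁ (x q) (y q) (z q) (x p₀)) (i₂ (x q) (y q) (z q) (y p₀)) (i₃ (x q) (y q) (z q) (z p₀))
        where
        i₁ : ∀ a b c d → + 1 * a + + 0 * b + + 0 * c + (+ 0 - d) ≡ a - d
        i₁ = solve-∀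
        i₂ : ∀ a b c d → + 0 * a + + 1 * b + + 0 * c + (+ 0 - d) ≡ b - d
        i₂ = solve-∀
        i₃ : ∀ a b c d → + 0 * a + + 0 * b + + 1 * c + (+ 0 - d) ≡ c - d
        i₃ = solve-∀

    -- The lattice point `p₀` becomes the origin, so the coset that contains the polytope's lattice
    -- points is the sublattice itself.
    g : Uni
    g = affine-unimodular H H⁻¹ HH⁻¹ H⁻¹H (columns b₁ b₂ b₃ p₀) (back ∘ₐ shiftₐ) p₀ (columns-apply b₁ b₂ b₃ p₀)
      (λ q → trans (∘ₐ-apply back shiftₐ q) (cong H⁻¹ (shift-apply q)))

    private
      g-apply : ∀ q → applyℤ (fwd g) q ≡ H q ⊕ p₀
      g-apply = columns-apply b₁ b₂ b₃ p₀

      A : Pt → Set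
      A q = LatPt S (applyℤ (fwd g) (doubled q))

      -- The difference of such a point and `p₀`, reduced by 2b₁, b₂ and b₃, would put b₁ into the
      -- sublattice.
      even-x : ∀ m → ¬ LatPt S (applyℤ (fwd g) ⟨ x m + x m + + 1 , y m , z m ⟩)
      even-x m l = out₁ (subst (LinLattice S) (V3-≡
          (component (x b₁) (x b₂) (x b₃) (x p₀) (x m) (y m) (z m)) (component (y b₁) (y b₂) (y b₃) (y p₀) (x m) (y m) (z m))
          (component (z b₁) (z b₂) (z b₃) (z p₀) (x m) (y m) (z m)))
          (lin-⊕ (lin-difference {LatPt S} {H ⟨ x m + x m + + 1 , y m , z m ⟩ ⊕ p₀} {p₀} (subst (LatPt S) (g-apply ⟨ x m + x m + + 1 , y m , z m ⟩) l) k₀)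
            (lin-⊕ (lin-⊙ (- x m) in₁) (lin-⊕ (lin-⊙ (- y m) in₂) (lin-⊙ (- z m) in₃)))))
        where
        component : ∀ b c d p i j k → (((i + i + + 1) * b + (j * c + k * d)) + p + -1ℤ * p) + ((- i) * (+ 2 * b) + ((- j) * c + (- k) * d)) ≡ b
        component = solve-∀

      cover : ∀ p → LatPt S p → ∃[ q ] p ≡ applyℤ (fwd g) (doubled q)
      cover p l = resolve r (sym (fwd-bwd g p)) (halve (x r))
        where
        r : Pt
        r = applyℤ (bwd g) p
        even : ∀ m → + 2 * m - + 0 ≡ + 2 * m
        even = solve-∀
        odd′ : ∀ m → + 2 * m - + 1 ≡ (m - + 1) + (m - + 1) + + 1
        odd′ = solve-∀
        resolve : ∀ r → p ≡ applyℤ (fwd g) r → ∀ {b} → Half (x r) b → ∃[ q ] p ≡ applyℤ (fwd g) (doubled q)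
        resolve ⟨ _ , b , c ⟩ e (2m m)   = ⟨ m , b , c ⟩ , trans e (cong (λ t → applyℤ (fwd g) ⟨ t , b , c ⟩) (even m))
        resolve ⟨ _ , b , c ⟩ e (2m-1 m) = ⊥-elim (even-x ⟨ m - + 1 , b , c ⟩
          (subst (λ t → LatPt S (applyℤ (fwd g) ⟨ t , b , c ⟩)) (odd′ m) (subst (LatPt S) e l)))

      doubled-injective : ∀ {p q} → doubled p ≡ doubled q → p ≡ q
      doubled-injective {p} {q} e = V3-≡ (ℤP.*-cancelˡ-≡ (+ 2) (x p) (x q) (cong x e)) (cong y e) (cong z e)

      H-injective : ∀ {p q} → H p ≡ H q → p ≡ q
      H-injective {p} {q} e = trans (sym (H⁻¹H p)) (trans (cong H⁻¹ e) (H⁻¹H q))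

      -- Each lattice point of the combination is rewritten by `cover`; the translations by `p₀`
      -- cancel because the coefficients add up to zero.
      pull : ∀ q → LinLattice S (H (doubled q)) → Lin A q
      pull q (ls , hs , s , e) with pulled ls hs
        where
        step : ∀ l b c d p i j k i′ j′ k′ t →
          l * ((+ 2 * i * b + (j * c + k * d)) + p) + ((+ 2 * i′ * b + (j′ * c + k′ * d)) + t * p) ≡
          (+ 2 * (l * i + i′) * b + ((l * j + j′) * c + (l * k + k′) * d)) + (l + t) * p
        step = solve-∀
        nought : ∀ b c d p → + 0 ≡ (+ 2 * + 0 * b + (+ 0 * c + + 0 * d)) + + 0 * p
        nought = solve-∀
        pulled : ∀ ls → All (λ lp → LatPt S (proj₂ lp)) ls →
                 ∃[ ms ] (All (λ lp → A (proj₂ lp)) ms × intSum ms ≡ intSum ls × intComb ls ≡ H (doubled (intComb ms)) ⊕ (intSum ls ⊙ p₀))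
        pulled [] [] = [] , [] , refl , V3-≡ (nought (x b₁) (x b₂) (x b₃) (x p₀)) (nought (y b₁) (y b₂) (y b₃) (y p₀)) (nought (z b₁) (z b₂) (z b₃) (z p₀))
        pulled ((l , p) ∷ ls) (h ∷ hs) =
          let r , e = cover p h
              ms , ks , s , c = pulled ls hs
              n = intComb ms
          in (l , r) ∷ ms , subst (LatPt S) e h ∷ ks , cong (λ t → l + t) s ,
             trans (cong₂ (λ i j → (l ⊙ i) ⊕ j) (trans e (g-apply (doubled r))) c) (V3-≡
               (step l (x b₁) (x b₂) (x b₃) (x p₀) (x r) (y r) (z r) (x n) (y n) (z n) (intSum ls))
               (step l (y b₁) (y b₂) (y b₃) (y p₀) (x r) (y r) (z r) (x n) (y n) (z n) (intSum ls))
               (step l (z b₁) (z b₂) (z b₃) (z p₀) (x r) (y r) (z r) (x n) (y n) (z n) (intSum ls)))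
      ... | ms , ks , t , c = ms , ks , trans t s , doubled-injective (H-injective (trans (sym (trans c (trans (cong (λ n → H (doubled (intComb ms)) ⊕ (n ⊙ p₀)) s)
        (V3-≡ (ℤP.+-identityʳ _) (ℤP.+-identityʳ _) (ℤP.+-identityʳ _))))) e))

      H-e₁ : H (doubled e₁) ≡ (+ 2) ⊙ b₁
      H-e₁ = V3-≡ (i (x b₁) (x b₂) (x b₃)) (i (y b₁) (y b₂) (y b₃)) (i (z b₁) (z b₂) (z b₃))
        where
        i : ∀ b c d → + 2 * b + (+ 0 * c + + 0 * d) ≡ + 2 * b
        i = solve-∀
      H-e₂ : H (doubled e₂) ≡ b₂
      H-e₂ = V3-≡ (i (x b₁) (x b₂) (x b₃)) (i (y b₁) (y b₂) (y b₃)) (i (z b₁) (z b₂) (z b₃))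
        where
        i : ∀ b c d → + 0 * b + (+ 1 * c + + 0 * d) ≡ c
        i = solve-∀
      H-e₃ : H (doubled e₃) ≡ b₃
      H-e₃ = V3-≡ (i (x b₁) (x b₂) (x b₃)) (i (y b₁) (y b₂) (y b₃)) (i (z b₁) (z b₂) (z b₃))
        where
        i : ∀ b c d → + 0 * b + (+ 0 * c + + 1 * d) ≡ d
        i = solve-∀

      convex : Convex (λ q → LatPt S (applyℤ (fwd g) q))
      convex = convex-preimage {LatPt S} (fwd g) latticePoint

      lattice : Lattice A
      lattice = record
        { mid    = λ {p} {q} m e → convex-mid convex (doubled m) (V3-≡ (twice (x p) (x q) (x m) (cong x e)) (cong y e) (cong z e))
        ; rule   = λ {p} {q} m e k l → even-x m (convex-mid convex ⟨ x m + x m + + 1 , y m , z m ⟩ (V3-≡ (centred (x p) (x q) (x m) (cong x e))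
            (trans (cong y e) (ℤP.+-identityʳ (y m + y m))) (trans (cong z e) (ℤP.+-identityʳ (z m + z m)))) k l)
        ; origin = subst (LatPt S) (sym (trans (g-apply (doubled 𝟎)) (V3-≡ (nought (x b₁) (x b₂) (x b₃) (x p₀)) (nought (y b₁) (y b₂) (y b₃) (y p₀)) (nought (z b₁) (z b₂) (z b₃) (z p₀))))) k₀
        ; gen₁   = pull e₁ (subst (LinLattice S) (sym H-e₁) in₁)
        ; gen₂   = pull e₂ (subst (LinLattice S) (sym H-e₂) in₂)
        ; gen₃   = pull e₃ (subst (LinLattice S) (sym H-e₃) in₃)
        }
        where
        twice : ∀ p q m → p + q ≡ m + m → + 2 * p + + 2 * q ≡ + 2 * m + + 2 * m
        twice p q m e = trans (sym (ℤP.*-distribˡ-+ (+ 2) p q)) (trans (cong (+ 2 *_) e) (ℤP.*-distribˡ-+ (+ 2) m m))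
        centred : ∀ p q m → p + q ≡ (m + m) + + 1 → + 2 * p + + 2 * q ≡ (m + m + + 1) + (m + m + + 1)
        centred p q m e = trans (sym (ℤP.*-distribˡ-+ (+ 2) p q)) (trans (cong (+ 2 *_) e) (double m))
          where
          double : ∀ m → + 2 * (m + m + + 1) ≡ (m + m + + 1) + (m + m + + 1)
          double = solve-∀
        nought : ∀ b c d p → (+ 0 * b + (+ 0 * c + + 0 * d)) + p ≡ p
        nought = solve-∀

    adapted-frame : ∃[ f ] Frame S f
    adapted-frame = frame g (basic lattice) cover

  -- The empty combination has total weight 0 and not 1.
  generator-exists : ∀ {S q} → Conv S q → ∃[ s ] s ∈ S
  generator-exists ([] , _ , () , _)
  generator-exists ((_ , s) ∷ _ , (_ , m) ∷ _ , _) = s , m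

open IndexTwo

theorem5p7 : (S : List Pt) → Hyp S →
    UnimodEquiv S E72 ⊎ UnimodEquiv S E82¹ ⊎ UnimodEquiv S E82² ⊎ UnimodEquiv S E82³
    ⊎ (∃[ a ] ∃[ b ] (a ≤ + 0 × + 0 < b × ¬ ((a , b) ≡ (+ 0 , + 1)) × UnimodEquiv S (F2 a b)))
    ⊎ (∃[ a ] ∃[ b ] ∃[ k ] (a ≤ + 0 × + 0 < b × + 0 ≤ k × k ≤ b
    × ¬ ((a , b , k) ≡ (+ 0 , + 1 , + 1)) × UnimodEquiv S (F3 a b k)))
    ⊎ (∃[ a ] ∃[ b ] (a ≤ + 0 × + 0 < b × UnimodEquiv S (F4 a b)))
theorem5p7 S ((_ , _ , _ , _ , conv , _) , wide , index) with generator-exists conv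
... | s , m = classify wide (proj₂ (adapted-frame (adapted index) s (generator m)))
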